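{- Let $p$ be an odd prime, and for $A\in\mathbb{Z}$ let $T_p(1,-A,-1)=\prod_{1\le i,j\le (p-1)/2,\ p\nmid i^2-Aij-j^2}(i^2-Aij-j^2)$. (i) We have $$T_p(1,-1,-1)\equiv\begin{cases}-5^{(p-1)/4}\pmod p&\text{if }p\equiv1,9\pmod{20},\\ (-5)^{(p-1)/4}\pmod p&\text{if }p\equiv13,17\pmod{20},\\ (-1)^{\lfloor(p-10)/20\rfloor}\pmod p&\text{if }p\equiv3,7\pmod{20},\\ (-1)^{\lfloor(p-5)/10\rfloor}\pmod p&\text{if }p\equiv11,19\pmod{20}.\end{cases}$$ (ii) We have $$T_p(1,-2,-1)\equiv\begin{cases}-2^{(p-1)/4}\pmod p&\text{if }p\equiv1\pmod8,\\ 2^{(p-1)/4}\pmod p&\text{if }p\equiv5\pmod8,\\ (-1)^{(p-3)/8}\pmod p&\text{if }p\equiv3\pmod8,\\ (-1)^{(p-7)/8}\pmod p&\text{if }p\equiv7\pmod8.\end{cases}$$ -}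

module Defs where

open import Data.Nat as ℕ using (ℕ; suc)
open import Data.Integer as ℤ using (ℤ; +_; -_; _-_; _*_; _+_; _%ℕ_)
open import Data.Integer.Divisibility.Signed using (_∣_; _∣?_)
open import Data.List using (List; foldr; map; concatMap; filter; upTo)
open import Relation.Nullary using (¬_)
open import Relation.Nullary.Decidable using (¬?)


_≡_[mod_] : ℤ → ℤ → ℕ → Set
a ≡ b [mod m ] = (+ m) ∣ (a - b)

oneTo : ℕ → List ℕ
oneTo n = map suc (upTo n)

prodℤ : List ℤ → ℤ
prodℤ = foldr _*_ (+ 1)

form : ℤ → ℕ → ℕ → ℤ
form A i j = (+ i) * (+ i) - A * (+ i) * (+ j) - (+ j) * (+ j)

T : ℕ → ℤ → ℤ
T p A = prodℤ (filter (λ x → ¬? (_∣?_ (+ p) x))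
          (concatMap (λ i → map (λ j → form A i j) (oneTo h)) (oneTo h)))
  where h = p ℕ./ 2

negOnePow : ℤ → ℤ
negOnePow k with k %ℕ 2
... | 0 = + 1
... | _ = - (+ 1)

{-# OPTIONS --safe #-}
module Submission where

-- Let h = (p - 1)/2, write f for the form, and let w² = Aw + 1, in 𝔽ₚ or in its extension by w. Then
-- -w f(i,j) and g(i,j) = w²j² - i² agree for i = j, and their products over {(i,j), (j,i)} agree, so
-- ∏∏ (-w f) = ∏∏ g. If no value of f vanishes mod p, then ∏ᵢ (X - i²) = Xʰ - 1 gives ∏∏ g = (w²ʰ - 1)ʰ.
-- If some value vanishes, then w is in 𝔽ₚ; once the vanishing factors on the two sides are replaced
-- compatibly, the derivative of Xʰ - 1 determines T (1 + w²)ʰ instead.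
-- It remains to find wᵖ and (1 + w²)ʰ. With θ of order 10 (A = 1, w = θ + θ⁻¹) or 8 (A = 2,
-- w = 1 + θ + θ⁻¹), the element 1 + w² is (1 + θ)²/θ, up to a factor 2 when A = 2, and Frobenius
-- applied to θ + θ⁻¹ and to 1 + θ gives both.

open import Defs using (_≡_[mod_]; form; T; prodℤ; oneTo; negOnePow)
open import Algebra.Bundles using (CommutativeRing)
import Algebra.Properties.CommutativeSemiring.Binomial as Binomial
import Algebra.Properties.CommutativeSemiring.Exp as Exp
import Algebra.Properties.Ring as RingProperties
import Algebra.Properties.Semiring.Mult as Multᵤ
import Algebra.Properties.Semiring.Mult.TCOptimised as Mult
import Algebra.Properties.Semiring.Sum as Sum
import Algebra.Solver.Ring as RingSolver
open import Algebra.Solver.Ring.AlmostCommutativeRing using (fromCommutativeRing; _-Raw-AlmostCommutative⟶_)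
open import Data.Empty using (⊥-elim)
open import Data.Fin as Fin using (toℕ; fromℕ; inject₁)
import Data.Fin.Properties as Finₚ
open import Data.Integer as ℤ using (ℤ; +_; -[1+_]; _⊖_; _%ℕ_; _/ℕ_)
open import Data.Integer.Divisibility.Signed as ℤᵈ using (_∣_; divides; _∣?_; ∣⇒∣ᵤ; ∣ᵤ⇒∣)
import Data.Integer.DivMod as ℤᵐ
import Data.Integer.Properties as ℤₚ
import Data.Integer.Solver as ℤ-Solver
open import Data.List as List using (List; []; _∷_; _++_; filter; map; concatMap; upTo)
import Data.List.Properties as Listₚ
open import Data.Maybe using (Maybe; just; nothing)
open import Data.Nat as ℕ using (ℕ; zero; suc; _∸_; _/_; _%_; _≤_; _<_; _>_; s≤s; z≤n; NonZero)
open import Data.Nat.Combinatorics using (_C_; nCn≡1; nC1≡n; k>n⇒nCk≡0; nCk+nC[k+1]≡[n+1]C[k+1])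
open import Data.Nat.Coprimality using (Coprime; coprime-Bézout)
import Data.Nat.Divisibility as ℕᵈ
import Data.Nat.DivMod as ℕᵐ
open import Data.Nat.GCD using (module Bézout)
open import Data.Nat.Primality using (Prime; prime?; euclidsLemma; prime⇒irreducible; ¬prime[1])
import Data.Nat.Properties as ℕₚ
open import Data.Nat.Solver using (module +-*-Solver)
open import Data.Product using (_×_; _,_; proj₁; proj₂; ∃-syntax)
open import Data.Sum using (_⊎_; inj₁; inj₂; [_,_]′)
open import Data.Vec using (Vec; []; _∷_; replicate)
open import Level using (0ℓ)
open import Relation.Binary.Definitions using (Tri; tri<; tri≈; tri>)
open import Relation.Binary.PropositionalEquality as ≡ using (_≡_; _≢_)
import Relation.Binary.Reasoning.Setoid as SetoidReasoning
open import Relation.Nullary using (¬_; Dec; yes; no)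
open import Relation.Nullary.Decidable using (¬?; toWitness)
open import Relation.Unary using (Pred; Decidable)

-- Integers in commutative rings

-- Whether `f` has a zero mod `p` is read off from Frobenius. The residue of `p` mod 10 or 8 fixes
-- `θᵖ`, so it decides, in every commutative ring of characteristic `p` at once, whether `wᵖ` is `w`
-- or the conjugate `A - w = -1/w`. In the first case some value of `f` must vanish. In the second
-- none can, since a zero `(i, j)` would put `w = i/j` into 𝔽ₚ, where Fermat fixes it. Apart from
-- 𝔽ₚ, the rings involved (the extension by `w`, further extensions by `θ`, dual numbers) may have
-- zero divisors. Cancellation therefore goes through explicit units or regular elements, and only
-- the case of vanishing factors uses that 𝔽ₚ is a field. The parity of `h` matters because `1 + w²`
-- is `w` times `w + 1/w`, a square root of `A² + 4`. For even `h` its power is `wʰ (A² + 4)^(h/2)`;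
-- for odd `h` it takes the root of unity to evaluate it.

module Integers (R : CommutativeRing 0ℓ 0ℓ) where

  open CommutativeRing R public
  open Exp commutativeSemiring public
  open RingProperties ring public
  open SetoidReasoning setoid public
  open Mult semiring using (1+×; ×-homo-+; ×1-homo-*) renaming (_×_ to _×′_)

  -- This form of the multiples makes `ι (+ 0)`, `ι (+ 1)` and `ι -[1+ 0 ]` reduce to `0#`, `1#` and
  -- `- 1#`, so the solver's constants match the ring's definitionally.
  ι : ℤ → Carrier
  ι (+ n)    = n ×′ 1#
  ι -[1+ n ] = - (suc n ×′ 1#)

  ι-neg : ∀ i → ι (ℤ.- i) ≈ - ι i
  ι-neg (+ zero)  = sym -0#≈0#
  ι-neg (+ suc n) = refl
  ι-neg -[1+ n ]  = sym (-‿involutive _)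

  ι-⊖ : ∀ m n → ι (m ⊖ n) ≈ m ×′ 1# - n ×′ 1#
  ι-⊖ m       zero    = sym (trans (+-congˡ -0#≈0#) (+-identityʳ _))
  ι-⊖ zero    (suc n) = sym (+-identityˡ _)
  ι-⊖ (suc m) (suc n) = begin
    ι (suc m ⊖ suc n)                ≡⟨ ≡.cong ι (ℤₚ.[1+m]⊖[1+n]≡m⊖n m n) ⟩
    ι (m ⊖ n)                        ≈⟨ ι-⊖ m n ⟩
    m ×′ 1# - n ×′ 1#                  ≈⟨ +-congʳ (xyx⁻¹≈y 1# (m ×′ 1#)) ⟨
    1# + m ×′ 1# - 1# - n ×′ 1#        ≈⟨ +-assoc _ _ _ ⟩
    1# + m ×′ 1# + (- 1# - n ×′ 1#)    ≈⟨ +-congˡ (-‿+-comm 1# (n ×′ 1#)) ⟩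
    1# + m ×′ 1# - (1# + n ×′ 1#)      ≈⟨ +-cong (1+× m 1#) (-‿cong (1+× n 1#)) ⟨
    suc m ×′ 1# - suc n ×′ 1#          ∎

  ι-+ : ∀ i j → ι (i ℤ.+ j) ≈ ι i + ι j
  ι-+ (+ m)    (+ n)    = ×-homo-+ 1# m n
  ι-+ (+ m)    -[1+ n ] = ι-⊖ m (suc n)
  ι-+ -[1+ m ] (+ n)    = trans (ι-⊖ n (suc m)) (+-comm _ _)
  ι-+ -[1+ m ] -[1+ n ] = begin
    - (suc (suc (m ℕ.+ n)) ×′ 1#)      ≡⟨ ≡.cong (λ k → - (suc k ×′ 1#)) (ℕₚ.+-suc m n) ⟨
    - ((suc m ℕ.+ suc n) ×′ 1#)        ≈⟨ -‿cong (×-homo-+ 1# (suc m) (suc n)) ⟩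
    - (suc m ×′ 1# + suc n ×′ 1#)       ≈⟨ -‿+-comm _ _ ⟨
    - (suc m ×′ 1#) - suc n ×′ 1#       ∎

  ι-*-pos : ∀ i n → ι (i ℤ.* + n) ≈ ι i * ι (+ n)
  ι-*-pos (+ m)    n = trans (reflexive (≡.cong ι (≡.sym (ℤₚ.pos-* m n)))) (×1-homo-* m n)
  ι-*-pos -[1+ m ] n = begin
    ι (-[1+ m ] ℤ.* + n)       ≡⟨ ≡.cong ι (ℤₚ.neg-distribˡ-* (+ suc m) (+ n)) ⟨
    ι (ℤ.- (+ suc m ℤ.* + n))  ≈⟨ ι-neg (+ suc m ℤ.* + n) ⟩
    - ι (+ suc m ℤ.* + n)      ≈⟨ -‿cong (ι-*-pos (+ suc m) n) ⟩
    - (ι (+ suc m) * ι (+ n))  ≈⟨ -‿distribˡ-* _ _ ⟩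
    - ι (+ suc m) * ι (+ n)    ∎

  ι-* : ∀ i j → ι (i ℤ.* j) ≈ ι i * ι j
  ι-* i (+ n)    = ι-*-pos i n
  ι-* i -[1+ n ] = begin
    ι (i ℤ.* -[1+ n ])       ≡⟨ ≡.cong ι (ℤₚ.neg-distribʳ-* i (+ suc n)) ⟨
    ι (ℤ.- (i ℤ.* + suc n))  ≈⟨ ι-neg (i ℤ.* + suc n) ⟩
    - ι (i ℤ.* + suc n)      ≈⟨ -‿cong (ι-*-pos i (suc n)) ⟩
    - (ι i * ι (+ suc n))    ≈⟨ -‿distribʳ-* _ _ ⟩
    ι i * - ι (+ suc n)      ∎

  ι-≟ : ∀ i j → Maybe (ι i ≈ ι j)
  ι-≟ i j with i ℤ.≟ j
  ... | yes i≡j = just (reflexive (≡.cong ι i≡j))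
  ... | no  _   = nothing

  ι-morphism : ℤ.+-*-rawRing -Raw-AlmostCommutative⟶ fromCommutativeRing R
  ι-morphism = record
    { ⟦_⟧ = ι ; +-homo = ι-+ ; *-homo = ι-* ; -‿homo = ι-neg ; 0-homo = refl ; 1-homo = refl }

  open RingSolver ℤ.+-*-rawRing (fromCommutativeRing R) ι-morphism ι-≟
    public using (solve; _:=_; _:+_; _:*_; _:-_; :-_; con)

module _ (R : CommutativeRing 0ℓ 0ℓ) where

  open Integers R

  -- This admits the zero ring; nontriviality enters separately, as `1≉0`, where a contradiction is
  -- drawn.
  HasCharacteristic : ℕ → Set
  HasCharacteristic p = ι (+ p) ≈ 0#

  -- The golden and silver means are the cases A = 1 and A = 2.
  IsMetallicMean : ℤ → Carrier → Set
  IsMetallicMean A w = w * w ≈ ι A * w + 1#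

  -- The two roots have product 1 and sum `t`, so `t` is `b + b⁻¹`.
  IsNormOneRoot : Carrier → Carrier → Set
  IsNormOneRoot t b = b * b ≈ t * b - 1#

-- Products, monic polynomials and the Frobenius map

InRange : ℕ → ℕ → Set
InRange n i = 1 ≤ i × i ≤ n

weaken : ∀ {n i} → InRange n i → InRange (suc n) i
weaken (1≤i , i≤n) = 1≤i , ℕₚ.m≤n⇒m≤1+n i≤n

top : ∀ n → InRange (suc n) (suc n)
top n = s≤s z≤n , ℕₚ.≤-refl

-- The absorption identity, by induction through Pascal's rule. It lets Euclid's lemma strip the
-- factor `1 + k` and leave `p` dividing the binomial coefficient.
[1+k]*[1+n]C[1+k]≡[1+n]*nCk : ∀ n k → suc k ℕ.* (suc n C suc k) ≡ suc n ℕ.* (n C k)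
[1+k]*[1+n]C[1+k]≡[1+n]*nCk zero    zero    = ≡.refl
[1+k]*[1+n]C[1+k]≡[1+n]*nCk zero    (suc k) = begin
  suc (suc k) ℕ.* (1 C suc (suc k))  ≡⟨ ≡.cong (suc (suc k) ℕ.*_) (k>n⇒nCk≡0 {1} {suc (suc k)} (s≤s (s≤s z≤n))) ⟩
  suc (suc k) ℕ.* 0                  ≡⟨ ℕₚ.*-zeroʳ (suc (suc k)) ⟩
  0                                  ≡⟨ ≡.cong (1 ℕ.*_) (k>n⇒nCk≡0 {0} {suc k} (s≤s z≤n)) ⟨
  1 ℕ.* (0 C suc k)                  ∎
  where open ≡.≡-Reasoning
[1+k]*[1+n]C[1+k]≡[1+n]*nCk (suc n) zero    = begin
  1 ℕ.* (suc (suc n) C 1)  ≡⟨ ℕₚ.*-identityˡ _ ⟩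
  suc (suc n) C 1          ≡⟨ nC1≡n (suc (suc n)) ⟩
  suc (suc n)              ≡⟨ ℕₚ.*-identityʳ _ ⟨
  suc (suc n) ℕ.* (suc n C 0)  ∎
  where open ≡.≡-Reasoning
[1+k]*[1+n]C[1+k]≡[1+n]*nCk (suc n) (suc k) = begin
  (2 ℕ.+ k) ℕ.* (suc (suc n) C suc (suc k))
    ≡⟨ ≡.cong ((2 ℕ.+ k) ℕ.*_) (nCk+nC[k+1]≡[n+1]C[k+1] (suc n) (suc k)) ⟨
  (2 ℕ.+ k) ℕ.* (x ℕ.+ y)
    ≡⟨ solve 3 (λ k x y → (con 2 :+ k) :* (x :+ y) := (con 1 :+ k) :* x :+ x :+ (con 2 :+ k) :* y) ≡.refl k x y ⟩
  (1 ℕ.+ k) ℕ.* x ℕ.+ x ℕ.+ (2 ℕ.+ k) ℕ.* y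
    ≡⟨ ≡.cong₂ (λ u v → u ℕ.+ x ℕ.+ v) ([1+k]*[1+n]C[1+k]≡[1+n]*nCk n k) ([1+k]*[1+n]C[1+k]≡[1+n]*nCk n (suc k)) ⟩
  suc n ℕ.* (n C k) ℕ.+ x ℕ.+ suc n ℕ.* (n C suc k)
    ≡⟨ solve 4 (λ n a b x → (con 1 :+ n) :* a :+ x :+ (con 1 :+ n) :* b := (con 1 :+ n) :* (a :+ b) :+ x) ≡.refl n (n C k) (n C suc k) x ⟩
  suc n ℕ.* (n C k ℕ.+ n C suc k) ℕ.+ x
    ≡⟨ ≡.cong (λ u → suc n ℕ.* u ℕ.+ x) (nCk+nC[k+1]≡[n+1]C[k+1] n k) ⟩
  suc n ℕ.* x ℕ.+ x
    ≡⟨ ℕₚ.+-comm _ x ⟩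
  suc (suc n) ℕ.* x ∎
  where
  open ≡.≡-Reasoning
  open +-*-Solver
  x = suc n C suc k
  y = suc n C suc (suc k)

prime∣binomial : ∀ {p} → Prime p → ∀ k → suc k < p → p ℕᵈ.∣ (p C suc k)
prime∣binomial {suc p} pr k 1+k<p with euclidsLemma (suc k) (suc p C suc k) pr
  (ℕᵈ.∣-trans (ℕᵈ.m∣m*n (p C k)) (ℕᵈ.∣-reflexive (≡.sym ([1+k]*[1+n]C[1+k]≡[1+n]*nCk p k))))
... | inj₁ p∣1+k = ⊥-elim (ℕₚ.<⇒≱ 1+k<p (ℕᵈ.∣⇒≤ p∣1+k))
... | inj₂ p∣C   = p∣C

module RingLemmas (R : CommutativeRing 0ℓ 0ℓ) where

  open Integers R public

  1^n≈1 : ∀ n → 1# ^ n ≈ 1#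
  1^n≈1 zero    = refl
  1^n≈1 (suc n) = trans (*-identityˡ _) (1^n≈1 n)

  0^n≈0 : ∀ {n} → 1 ≤ n → 0# ^ n ≈ 0#
  0^n≈0 (s≤s _) = zeroˡ _

  prod : ℕ → (ℕ → Carrier) → Carrier
  prod zero    f = 1#
  prod (suc n) f = prod n f * f (suc n)

  prod-cong : ∀ n {f g} → (∀ i → InRange n i → f i ≈ g i) → prod n f ≈ prod n g
  prod-cong zero    eq = refl
  prod-cong (suc n) eq = *-cong (prod-cong n (λ i r → eq i (weaken r))) (eq (suc n) (top n))

  prod-* : ∀ n f g → prod n (λ i → f i * g i) ≈ prod n f * prod n g
  prod-* zero    f g = sym (*-identityˡ 1#)
  prod-* (suc n) f g = trans (*-congʳ (prod-* n f g))
    (solve 4 (λ a b c d → a :* b :* (c :* d) := a :* c :* (b :* d)) refl _ _ _ _)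

  prod-const : ∀ n c → prod n (λ _ → c) ≈ c ^ n
  prod-const zero    c = refl
  prod-const (suc n) c = trans (*-comm _ c) (*-congˡ (prod-const n c))

  prod-1 : ∀ n {f} → (∀ i → InRange n i → f i ≈ 1#) → prod n f ≈ 1#
  prod-1 zero    eq = refl
  prod-1 (suc n) eq = trans (*-cong (prod-1 n (λ i r → eq i (weaken r))) (eq (suc n) (top n))) (*-identityˡ 1#)

  prod-0 : ∀ n f k → InRange n k → f k ≈ 0# → prod n f ≈ 0#
  prod-0 zero    f zero    (() , _) _
  prod-0 zero    f (suc _) (_ , ()) _
  prod-0 (suc n) f k r fk≈0 with k ℕ.≟ suc n
  ... | yes ≡.refl = trans (*-congˡ fk≈0) (zeroʳ _)
  ... | no k≢1+n = trans (*-congʳ (prod-0 n f k (proj₁ r , ℕₚ.≤-pred (ℕₚ.≤∧≢⇒< (proj₂ r) k≢1+n)) fk≈0)) (zeroˡ _)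

  prod-swap : ∀ m n (f : ℕ → ℕ → Carrier) → prod m (λ i → prod n (f i)) ≈ prod n (λ j → prod m (λ i → f i j))
  prod-swap zero    n f = sym (prod-1 n (λ _ _ → refl))
  prod-swap (suc m) n f = trans (*-congʳ (prod-swap m n f)) (sym (prod-* n _ _))

  prod-single : ∀ n f k → InRange n k → (∀ i → InRange n i → i ≢ k → f i ≈ 1#) → prod n f ≈ f k
  prod-single zero    f zero    (() , _) _
  prod-single zero    f (suc _) (_ , ()) _
  prod-single (suc n) f k r eq with k ℕ.≟ suc n
  ... | yes ≡.refl = trans (*-congʳ (prod-1 n λ i r′ → eq i (weaken r′) (ℕₚ.<⇒≢ (s≤s (proj₂ r′))))) (*-identityˡ _)
  ... | no k≢1+n = trans (*-cong
          (prod-single n f k (proj₁ r , ℕₚ.≤-pred (ℕₚ.≤∧≢⇒< (proj₂ r) k≢1+n)) (λ i r′ → eq i (weaken r′)))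
          (eq (suc n) (top n) (λ e → k≢1+n (≡.sym e)))) (*-identityʳ _)

  -- The last row and column are peeled off together, so that `(i , n + 1)` is multiplied with
  -- `(n + 1 , i)`. Two matrices that differ entrywise can then be compared through their transposed
  -- pairs alone.
  prod-symmetric : ∀ n (f g : ℕ → ℕ → Carrier) → (∀ i → InRange n i → f i i ≈ g i i) →
    (∀ i j → InRange n i → InRange n j → i < j → f i j * f j i ≈ g i j * g j i) →
    prod n (λ i → prod n (f i)) ≈ prod n (λ i → prod n (g i))
  prod-symmetric zero    f g diag off = refl
  prod-symmetric (suc n) f g diag off = begin
    square f (suc n)                            ≈⟨ border f ⟩
    square f n * (edges f * f (suc n) (suc n))
      ≈⟨ *-cong (prod-symmetric n f g (λ i r → diag i (weaken r)) (λ i j r s → off i j (weaken r) (weaken s)))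
                (*-cong (prod-cong n λ i r → off i (suc n) (weaken r) (top n) (s≤s (proj₂ r))) (diag (suc n) (top n))) ⟩
    square g n * (edges g * g (suc n) (suc n))  ≈⟨ border g ⟨
    square g (suc n)                            ∎
    where
    square : (ℕ → ℕ → Carrier) → ℕ → Carrier
    square f n = prod n (λ i → prod n (f i))
    edges : (ℕ → ℕ → Carrier) → Carrier
    edges f = prod n (λ i → f i (suc n) * f (suc n) i)
    border : ∀ f → square f (suc n) ≈ square f n * (edges f * f (suc n) (suc n))
    border f = begin
      prod n (λ i → prod n (f i) * f i (suc n)) * (prod n (f (suc n)) * f (suc n) (suc n))
        ≈⟨ *-congʳ (prod-* n _ _) ⟩
      square f n * prod n (λ i → f i (suc n)) * (prod n (f (suc n)) * f (suc n) (suc n))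
        ≈⟨ solve 4 (λ a b c d → a :* b :* (c :* d) := a :* (b :* c :* d)) refl _ _ _ _ ⟩
      square f n * (prod n (λ i → f i (suc n)) * prod n (f (suc n)) * f (suc n) (suc n))
        ≈⟨ *-congˡ (*-congʳ (prod-* n _ _)) ⟨
      square f n * (edges f * f (suc n) (suc n)) ∎

  -- A vector (c₀ , … , cₙ₋₁) stands for the monic polynomial c₀ + c₁ x + ⋯ + cₙ₋₁ xⁿ⁻¹ + xⁿ.
  eval : ∀ {n} → Vec Carrier n → Carrier → Carrier
  eval []       x = 1#
  eval (c ∷ cs) x = c + x * eval cs x

  -- Synthetic division by `x - r`: the coefficients of the quotient are the intermediate values of
  -- Horner's scheme at `r`.
  quot : ∀ {n} → Carrier → Vec Carrier (suc n) → Vec Carrier n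
  quot r (c ∷ [])     = []
  quot r (c ∷ d ∷ ds) = eval (d ∷ ds) r ∷ quot r (d ∷ ds)

  eval-quot : ∀ {n} r (cs : Vec Carrier (suc n)) x → eval cs x ≈ eval cs r + (x - r) * eval (quot r cs) x
  eval-quot r (c ∷ []) x =
    solve 3 (λ c r x → c :+ x :* con (+ 1) := c :+ r :* con (+ 1) :+ (x :- r) :* con (+ 1)) refl c r x
  eval-quot r (c ∷ cs@(_ ∷ _)) x = begin
    c + x * eval cs x                                      ≈⟨ +-congˡ (*-congˡ (eval-quot r cs x)) ⟩
    c + x * (eval cs r + (x - r) * eval (quot r cs) x)
      ≈⟨ solve 5 (λ c x r e q → c :+ x :* (e :+ (x :- r) :* q) := c :+ r :* e :+ (x :- r) :* (e :+ x :* q)) refl c x r _ _ ⟩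
    c + r * eval cs r + (x - r) * (eval cs r + x * eval (quot r cs) x) ∎

  Regular : Carrier → Set
  Regular a = ∀ x → a * x ≈ 0# → x ≈ 0#

  -- With regular differences, Lagrange's bound on the number of roots needs no integral domain.
  monic-splits : ∀ {n} (cs : Vec Carrier n) (r : ℕ → Carrier) → (∀ i → InRange n i → eval cs (r i) ≈ 0#) →
    (∀ i j → InRange n i → InRange n j → i < j → Regular (r i - r j)) →
    ∀ x → eval cs x ≈ prod n (λ i → x - r i)
  monic-splits []           r root reg x = refl
  monic-splits {suc n} cs@(_ ∷ _) r root reg x = begin
    eval cs x                                          ≈⟨ eval-quot rₙ cs x ⟩
    eval cs rₙ + (x - rₙ) * eval (quot rₙ cs) x
      ≈⟨ +-cong (root (suc n) (top n)) (*-congˡ (monic-splits (quot rₙ cs) r root′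
           (λ i j s t → reg i j (weaken s) (weaken t)) x)) ⟩
    0# + (x - rₙ) * prod n (λ i → x - r i)             ≈⟨ trans (+-identityˡ _) (*-comm _ _) ⟩
    prod n (λ i → x - r i) * (x - rₙ)                  ∎
    where
    rₙ = r (suc n)
    root′ : ∀ i → InRange n i → eval (quot rₙ cs) (r i) ≈ 0#
    root′ i s = reg i (suc n) (weaken s) (top n) (s≤s (proj₂ s)) _ (begin
      (r i - rₙ) * eval (quot rₙ cs) (r i)               ≈⟨ +-identityˡ _ ⟨
      0# + (r i - rₙ) * eval (quot rₙ cs) (r i)          ≈⟨ +-congʳ (root (suc n) (top n)) ⟨
      eval cs rₙ + (r i - rₙ) * eval (quot rₙ cs) (r i)  ≈⟨ eval-quot rₙ cs (r i) ⟨
      eval cs (r i)                                      ≈⟨ root i (weaken s) ⟩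
      0#                                                 ∎)

  eval-0s : ∀ n x → eval (replicate n 0#) x ≈ x ^ n
  eval-0s zero    x = refl
  eval-0s (suc n) x = trans (+-identityˡ _) (*-congˡ (eval-0s n x))

  x^n-1-splits : ∀ n (r : ℕ → Carrier) → (∀ i → InRange (suc n) i → r i ^ suc n ≈ 1#) →
    (∀ i j → InRange (suc n) i → InRange (suc n) j → i < j → Regular (r i - r j)) →
    ∀ x → prod (suc n) (λ i → x - r i) ≈ x ^ suc n - 1#
  x^n-1-splits n r root reg x = trans
    (sym (monic-splits cs r (λ i s → trans (value (r i)) (trans (+-congʳ (root i s)) (-‿inverseʳ 1#))) reg x))
    (value x)
    where
    cs = - 1# ∷ replicate n 0#
    value : ∀ y → eval cs y ≈ y ^ suc n - 1#
    value y = trans (+-comm _ _) (+-congʳ (*-congˡ (eval-0s n y)))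

  module Frobenius {p} (p-prime : Prime p) (char-p : ι (+ p) ≈ 0#) where

    private
      module M = Multᵤ semiring
      module S = Sum semiring

    multiple≈0 : ∀ {n} → p ℕᵈ.∣ n → ∀ x → n M.× x ≈ 0#
    multiple≈0 (ℕᵈ.divides q ≡.refl) x = begin
      (q ℕ.* p) M.× x      ≈⟨ M.×-assocˡ x q p ⟨
      q M.× (p M.× x)      ≈⟨ M.×-congʳ q (M.×-congʳ p (*-identityˡ x)) ⟨
      q M.× (p M.× (1# * x))  ≈⟨ M.×-congʳ q (M.×-assoc-* p 1# x) ⟨
      q M.× ((p M.× 1#) * x)  ≈⟨ M.×-congʳ q (*-congʳ (trans (Mult.×ᵤ≈× semiring p 1#) char-p)) ⟩
      q M.× (0# * x)       ≈⟨ M.×-congʳ q (zeroˡ x) ⟩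
      q M.× 0#             ≈⟨ M.×-congʳ q (zeroˡ 0#) ⟨
      q M.× (0# * 0#)      ≈⟨ M.×-comm-* q 0# 0# ⟨
      0# * (q M.× 0#)      ≈⟨ zeroˡ _ ⟩
      0#                   ∎

    frobenius : ∀ x y → (x + y) ^ p ≈ x ^ p + y ^ p
    frobenius = go p-prime ≡.refl
      where
      -- Replacing the fixed `p` by a variable `n` allows it to be matched as `suc m`, which exposes
      -- the first and last binomial terms.
      go : ∀ {n} → Prime n → n ≡ p → ∀ x y → (x + y) ^ n ≈ x ^ n + y ^ n
      go {suc m} pr ≡.refl x y = begin
        (x + y) ^ suc m  ≈⟨ Binomial.theorem commutativeSemiring (suc m) x y ⟩
        term Fin.zero + S.sum (λ k → term (Fin.suc k))
          ≈⟨ +-congˡ (S.sum-init-last (λ k → term (Fin.suc k))) ⟩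
        term Fin.zero + (S.sum (λ k → term (Fin.suc (inject₁ k))) + term (Fin.suc (fromℕ m)))
          ≈⟨ +-cong first (+-cong (trans (S.sum-cong-≋ middle) (S.sum-replicate-zero m)) last) ⟩
        y ^ suc m + (0# + x ^ suc m)  ≈⟨ solve 2 (λ a b → a :+ (con (+ 0) :+ b) := b :+ a) refl _ _ ⟩
        x ^ suc m + y ^ suc m  ∎
        where
        term = Binomial.binomialTerm commutativeSemiring x y (suc m)
        first : term Fin.zero ≈ y ^ suc m
        first = trans (+-identityʳ _) (*-identityˡ _)
        middle : ∀ k → term (Fin.suc (inject₁ k)) ≈ 0#
        middle k rewrite Finₚ.toℕ-inject₁ k =
          multiple≈0 (prime∣binomial pr (toℕ k) (s≤s (Finₚ.toℕ<n k))) _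
        last : term (Fin.suc (fromℕ m)) ≈ x ^ suc m
        last rewrite Finₚ.toℕ-fromℕ m | nCn≡1 (suc m) | ℕₚ.n∸n≡0 m = trans (+-identityʳ _) (*-identityʳ _)

-- Quadratic extensions and the integers mod p

-- The ring R[θ] with θ² = aθ + b, an element x + yθ being the pair (x , y).
module QuadraticExtension (R : CommutativeRing 0ℓ 0ℓ) (a b : CommutativeRing.Carrier R) where

  open RingLemmas R

  private
    infixl 7 _⊛_
    _⊛_ : Carrier × Carrier → Carrier × Carrier → Carrier × Carrier
    (x₁ , x₂) ⊛ (y₁ , y₂) = x₁ * y₁ + b * (x₂ * y₂) , x₁ * y₂ + x₂ * y₁ + a * (x₂ * y₂)

  extension : CommutativeRing 0ℓ 0ℓ
  extension = record
    { Carrier = Carrier × Carrier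
    ; _≈_ = λ (x₁ , x₂) (y₁ , y₂) → (x₁ ≈ y₁) × (x₂ ≈ y₂)
    ; _+_ = λ (x₁ , x₂) (y₁ , y₂) → x₁ + y₁ , x₂ + y₂
    ; _*_ = _⊛_
    ; -_ = λ (x₁ , x₂) → - x₁ , - x₂
    ; 0# = 0# , 0#
    ; 1# = 1# , 0#
    ; isCommutativeRing = record
      { isRing = record
        { +-isAbelianGroup = record
          { isGroup = record
            { isMonoid = record
              { isSemigroup = record
                { isMagma = record
                  { isEquivalence = record
                    { refl = refl , refl
                    ; sym = λ (e , f) → sym e , sym f
                    ; trans = λ (e , f) (g , h) → trans e g , trans f h
                    }
                  ; ∙-cong = λ (e , f) (g , h) → +-cong e g , +-cong f h
                  }
                ; assoc = λ _ _ _ → +-assoc _ _ _ , +-assoc _ _ _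
                }
              ; identity = (λ _ → +-identityˡ _ , +-identityˡ _) , (λ _ → +-identityʳ _ , +-identityʳ _)
              }
            ; inverse = (λ _ → -‿inverseˡ _ , -‿inverseˡ _) , (λ _ → -‿inverseʳ _ , -‿inverseʳ _)
            ; ⁻¹-cong = λ (e , f) → -‿cong e , -‿cong f
            }
          ; comm = λ _ _ → +-comm _ _ , +-comm _ _
          }
        ; *-cong = λ (e , f) (g , h) →
            +-cong (*-cong e g) (*-congˡ (*-cong f h)) ,
            +-cong (+-cong (*-cong e h) (*-cong f g)) (*-congˡ (*-cong f h))
        ; *-assoc = λ (x₁ , x₂) (y₁ , y₂) (z₁ , z₂) →
            solve 8 (λ a b x₁ x₂ y₁ y₂ z₁ z₂ →
              (x₁ :* y₁ :+ b :* (x₂ :* y₂)) :* z₁ :+ b :* ((x₁ :* y₂ :+ x₂ :* y₁ :+ a :* (x₂ :* y₂)) :* z₂) :=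
              x₁ :* (y₁ :* z₁ :+ b :* (y₂ :* z₂)) :+ b :* (x₂ :* (y₁ :* z₂ :+ y₂ :* z₁ :+ a :* (y₂ :* z₂))))
              refl a b x₁ x₂ y₁ y₂ z₁ z₂ ,
            solve 8 (λ a b x₁ x₂ y₁ y₂ z₁ z₂ →
              (x₁ :* y₁ :+ b :* (x₂ :* y₂)) :* z₂ :+ (x₁ :* y₂ :+ x₂ :* y₁ :+ a :* (x₂ :* y₂)) :* z₁ :+
                a :* ((x₁ :* y₂ :+ x₂ :* y₁ :+ a :* (x₂ :* y₂)) :* z₂) :=
              x₁ :* (y₁ :* z₂ :+ y₂ :* z₁ :+ a :* (y₂ :* z₂)) :+ x₂ :* (y₁ :* z₁ :+ b :* (y₂ :* z₂)) :+
                a :* (x₂ :* (y₁ :* z₂ :+ y₂ :* z₁ :+ a :* (y₂ :* z₂))))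
              refl a b x₁ x₂ y₁ y₂ z₁ z₂
        ; *-identity =
            (λ (x , y) → solve 3 (λ b x y → con (+ 1) :* x :+ b :* (con (+ 0) :* y) := x) refl b x y ,
                         solve 3 (λ a x y → con (+ 1) :* y :+ con (+ 0) :* x :+ a :* (con (+ 0) :* y) := y) refl a x y) ,
            (λ (x , y) → solve 3 (λ b x y → x :* con (+ 1) :+ b :* (y :* con (+ 0)) := x) refl b x y ,
                         solve 3 (λ a x y → x :* con (+ 0) :+ y :* con (+ 1) :+ a :* (y :* con (+ 0)) := y) refl a x y)
        ; distrib =
            (λ (x₁ , x₂) (y₁ , y₂) (z₁ , z₂) →
              solve 7 (λ b x₁ x₂ y₁ y₂ z₁ z₂ →
                x₁ :* (y₁ :+ z₁) :+ b :* (x₂ :* (y₂ :+ z₂)) :=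
                x₁ :* y₁ :+ b :* (x₂ :* y₂) :+ (x₁ :* z₁ :+ b :* (x₂ :* z₂))) refl b x₁ x₂ y₁ y₂ z₁ z₂ ,
              solve 7 (λ a x₁ x₂ y₁ y₂ z₁ z₂ →
                x₁ :* (y₂ :+ z₂) :+ x₂ :* (y₁ :+ z₁) :+ a :* (x₂ :* (y₂ :+ z₂)) :=
                x₁ :* y₂ :+ x₂ :* y₁ :+ a :* (x₂ :* y₂) :+ (x₁ :* z₂ :+ x₂ :* z₁ :+ a :* (x₂ :* z₂)))
                refl a x₁ x₂ y₁ y₂ z₁ z₂) ,
            (λ (x₁ , x₂) (y₁ , y₂) (z₁ , z₂) →
              solve 7 (λ b x₁ x₂ y₁ y₂ z₁ z₂ →
                (y₁ :+ z₁) :* x₁ :+ b :* ((y₂ :+ z₂) :* x₂) :=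
                y₁ :* x₁ :+ b :* (y₂ :* x₂) :+ (z₁ :* x₁ :+ b :* (z₂ :* x₂))) refl b x₁ x₂ y₁ y₂ z₁ z₂ ,
              solve 7 (λ a x₁ x₂ y₁ y₂ z₁ z₂ →
                (y₁ :+ z₁) :* x₂ :+ (y₂ :+ z₂) :* x₁ :+ a :* ((y₂ :+ z₂) :* x₂) :=
                y₁ :* x₂ :+ y₂ :* x₁ :+ a :* (y₂ :* x₂) :+ (z₁ :* x₂ :+ z₂ :* x₁ :+ a :* (z₂ :* x₂)))
                refl a x₁ x₂ y₁ y₂ z₁ z₂)
        }
      ; *-comm = λ (x₁ , x₂) (y₁ , y₂) →
          +-cong (*-comm _ _) (*-congˡ (*-comm _ _)) ,
          +-cong (trans (+-comm _ _) (+-cong (*-comm _ _) (*-comm _ _))) (*-congˡ (*-comm _ _))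
      }
    }

  open CommutativeRing extension using () renaming (Carrier to Carrierᴱ; _≈_ to _≈ᴱ_; _*_ to _*ᴱ_; 1# to 1ᴱ)
  private
    module E = RingLemmas extension

  θ : Carrierᴱ
  θ = 0# , 1#

  embed : Carrier → Carrierᴱ
  embed x = x , 0#

  embed-* : ∀ x y → embed (x * y) ≈ᴱ embed x *ᴱ embed y
  embed-* x y =
    solve 3 (λ b x y → x :* y := x :* y :+ b :* (con (+ 0) :* con (+ 0))) refl b x y ,
    solve 3 (λ a x y → con (+ 0) := x :* con (+ 0) :+ con (+ 0) :* y :+ a :* (con (+ 0) :* con (+ 0))) refl a x y

  embed-^ : ∀ x n → embed (x ^ n) ≈ᴱ embed x E.^ n
  embed-^ x zero    = E.refl
  embed-^ x (suc n) = E.trans (embed-* x (x ^ n)) (E.*-congˡ (embed-^ x n))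

  embed-ι : ∀ n → E.ι n ≈ᴱ embed (ι n)
  embed-ι (+ n)    = go n
    where
    go : ∀ n → E.ι (+ n) ≈ᴱ embed (ι (+ n))
    go zero    = E.refl
    go (suc n) = E.trans (Mult.1+× E.semiring n 1ᴱ) (E.trans (E.+-congˡ (go n))
      (sym (Mult.1+× semiring n 1#) , +-identityˡ 0#))
  embed-ι -[1+ n ] = E.trans (E.-‿cong (embed-ι (+ suc n))) (refl , -0#≈0#)

  θ²≈aθ+b : θ *ᴱ θ ≈ᴱ embed a *ᴱ θ E.+ embed b
  θ²≈aθ+b =
    solve 2 (λ a b → con (+ 0) :* con (+ 0) :+ b :* (con (+ 1) :* con (+ 1)) :=
      a :* con (+ 0) :+ b :* (con (+ 0) :* con (+ 1)) :+ b) refl a b ,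
    solve 1 (λ a → con (+ 0) :* con (+ 1) :+ con (+ 1) :* con (+ 0) :+ a :* (con (+ 1) :* con (+ 1)) :=
      a :* con (+ 1) :+ con (+ 0) :* con (+ 0) :+ a :* (con (+ 0) :* con (+ 1)) :+ con (+ 0)) refl a

module _ (p : ℕ) where

  -- A record, so that the two sides of a congruence can be inferred from it.
  infix 4 _≋_
  record _≋_ (i j : ℤ) : Set where
    constructor congruent
    field difference : i ≡ j [mod p ]

  integersMod : CommutativeRing 0ℓ 0ℓ
  integersMod = record
    { Carrier = ℤ
    ; _≈_ = _≋_
    ; _+_ = ℤ._+_
    ; _*_ = ℤ._*_
    ; -_ = ℤ.-_
    ; 0# = + 0
    ; 1# = + 1
    ; isCommutativeRing = record
      { isRing = record
        { +-isAbelianGroup = record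
          { isGroup = record
            { isMonoid = record
              { isSemigroup = record
                { isMagma = record
                  { isEquivalence = record { refl = ≋-reflexive ≡.refl ; sym = ≋-sym ; trans = ≋-trans }
                  ; ∙-cong = ≋-+
                  }
                ; assoc = λ i j k → ≋-reflexive (ℤₚ.+-assoc i j k)
                }
              ; identity = (λ i → ≋-reflexive (ℤₚ.+-identityˡ i)) , (λ i → ≋-reflexive (ℤₚ.+-identityʳ i))
              }
            ; inverse = (λ i → ≋-reflexive (ℤₚ.+-inverseˡ i)) , (λ i → ≋-reflexive (ℤₚ.+-inverseʳ i))
            ; ⁻¹-cong = ≋-neg
            }
          ; comm = λ i j → ≋-reflexive (ℤₚ.+-comm i j)
          }
        ; *-cong = ≋-*
        ; *-assoc = λ i j k → ≋-reflexive (ℤₚ.*-assoc i j k)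
        ; *-identity = (λ i → ≋-reflexive (ℤₚ.*-identityˡ i)) , (λ i → ≋-reflexive (ℤₚ.*-identityʳ i))
        ; distrib = (λ i j k → ≋-reflexive (ℤₚ.*-distribˡ-+ i j k)) , (λ i j k → ≋-reflexive (ℤₚ.*-distribʳ-+ i j k))
        }
      ; *-comm = λ i j → ≋-reflexive (ℤₚ.*-comm i j)
      }
    }
    where
    open ℤ-Solver.+-*-Solver
    ≋-reflexive : ∀ {i j} → i ≡ j → i ≋ j
    ≋-reflexive {i} ≡.refl = congruent (divides (+ 0) (ℤₚ.+-inverseʳ i))
    ≋-sym : ∀ {i j} → i ≋ j → j ≋ i
    ≋-sym {i} {j} (congruent (divides q e)) = congruent (divides (ℤ.- q)
      (≡.trans (solve 2 (λ i j → j :- i := :- (i :- j)) ≡.refl i j)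
        (≡.trans (≡.cong ℤ.-_ e) (ℤₚ.neg-distribˡ-* q (+ p)))))
    ≋-trans : ∀ {i j k} → i ≋ j → j ≋ k → i ≋ k
    ≋-trans {i} {j} {k} (congruent (divides q e)) (congruent (divides r f)) = congruent (divides (q ℤ.+ r)
      (≡.trans (solve 3 (λ i j k → i :- k := (i :- j) :+ (j :- k)) ≡.refl i j k)
        (≡.trans (≡.cong₂ ℤ._+_ e f) (≡.sym (ℤₚ.*-distribʳ-+ (+ p) q r)))))
    ≋-+ : ∀ {i j k l} → i ≋ j → k ≋ l → i ℤ.+ k ≋ j ℤ.+ l
    ≋-+ {i} {j} {k} {l} (congruent (divides q e)) (congruent (divides r f)) = congruent (divides (q ℤ.+ r)
      (≡.trans (solve 4 (λ i j k l → (i :+ k) :- (j :+ l) := (i :- j) :+ (k :- l)) ≡.refl i j k l)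
        (≡.trans (≡.cong₂ ℤ._+_ e f) (≡.sym (ℤₚ.*-distribʳ-+ (+ p) q r)))))
    ≋-neg : ∀ {i j} → i ≋ j → ℤ.- i ≋ ℤ.- j
    ≋-neg {i} {j} (congruent (divides q e)) = congruent (divides (ℤ.- q)
      (≡.trans (solve 2 (λ i j → (:- i) :- (:- j) := :- (i :- j)) ≡.refl i j)
        (≡.trans (≡.cong ℤ.-_ e) (ℤₚ.neg-distribˡ-* q (+ p)))))
    ≋-* : ∀ {i j k l} → i ≋ j → k ≋ l → i ℤ.* k ≋ j ℤ.* l
    ≋-* {i} {j} {k} {l} (congruent (divides q e)) (congruent (divides r f)) = congruent (divides (q ℤ.* k ℤ.+ j ℤ.* r)
      (≡.trans (solve 4 (λ i j k l → i :* k :- j :* l := (i :- j) :* k :+ j :* (k :- l)) ≡.refl i j k l)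
        (≡.trans (≡.cong₂ (λ x y → x ℤ.* k ℤ.+ j ℤ.* y) e f)
          (solve 5 (λ p q r k j → q :* p :* k :+ j :* (r :* p) := (q :* k :+ j :* r) :* p) ≡.refl (+ p) q r k j))))

  private
    module M = Integers integersMod

  -- It turns an identity `ι i ≈ ι j` obtained for a general ring into a congruence between `i` and
  -- `j` themselves.
  ι-mod : ∀ n → M.ι n ≡ n
  ι-mod (+ n)    = go n
    where
    go : ∀ n → M.ι (+ n) ≡ + n
    go zero          = ≡.refl
    go (suc zero)    = ≡.refl
    go (suc (suc n)) = ≡.trans (≡.cong (ℤ._+ + 1) (go (suc n))) (≡.cong +_ (ℕₚ.+-comm (suc n) 1))
  ι-mod -[1+ n ] = ≡.cong ℤ.-_ (ι-mod (+ suc n))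

-- Rings of characteristic p = 2h + 1

oneTo-snoc : ∀ n → oneTo (suc n) ≡ oneTo n ++ suc n ∷ []
oneTo-snoc n = ≡.trans (≡.cong (map suc) (≡.sym (Listₚ.upTo-∷ʳ n))) (Listₚ.map-++ suc (upTo n) (n ∷ []))

prime∤⇒coprime : ∀ {p n} → Prime p → ¬ p ℕᵈ.∣ n → Coprime p n
prime∤⇒coprime pr p∤n {d} (d∣p , d∣n) with prime⇒irreducible pr d∣p
... | inj₁ d≡1    = d≡1
... | inj₂ ≡.refl = ⊥-elim (p∤n d∣n)

module ListProducts (R : CommutativeRing 0ℓ 0ℓ) where

  open RingLemmas R

  ι-prodℤ-++ : ∀ xs ys → ι (prodℤ (xs ++ ys)) ≈ ι (prodℤ xs) * ι (prodℤ ys)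
  ι-prodℤ-++ []       ys = sym (*-identityˡ _)
  ι-prodℤ-++ (x ∷ xs) ys = begin
    ι (x ℤ.* prodℤ (xs ++ ys))               ≈⟨ ι-* x _ ⟩
    ι x * ι (prodℤ (xs ++ ys))               ≈⟨ *-congˡ (ι-prodℤ-++ xs ys) ⟩
    ι x * (ι (prodℤ xs) * ι (prodℤ ys))      ≈⟨ *-assoc _ _ _ ⟨
    ι x * ι (prodℤ xs) * ι (prodℤ ys)        ≈⟨ *-congʳ (ι-* x _) ⟨
    ι (x ℤ.* prodℤ xs) * ι (prodℤ ys)        ∎

  ι-prodℤ-filter-++ : ∀ {P : Pred ℤ 0ℓ} (P? : Decidable P) xs ys →
    ι (prodℤ (filter P? (xs ++ ys))) ≈ ι (prodℤ (filter P? xs)) * ι (prodℤ (filter P? ys))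
  ι-prodℤ-filter-++ P? xs ys = trans (reflexive (≡.cong (λ zs → ι (prodℤ zs)) (Listₚ.filter-++ P? xs ys)))
    (ι-prodℤ-++ (filter P? xs) (filter P? ys))

  ι-prodℤ-filter : ∀ {P : Pred ℤ 0ℓ} (P? : Decidable P) (F : ℕ → List ℤ) (f : ℕ → Carrier) n →
    (∀ i → InRange n i → ι (prodℤ (filter P? (F i))) ≈ f i) →
    ι (prodℤ (filter P? (concatMap F (oneTo n)))) ≈ prod n f
  ι-prodℤ-filter P? F f zero    eq = refl
  ι-prodℤ-filter P? F f (suc n) eq = begin
    ι (prodℤ (filter P? (concatMap F (oneTo (suc n)))))
      ≡⟨ ≡.cong (λ zs → ι (prodℤ (filter P? zs))) (≡.trans (≡.cong (concatMap F) (oneTo-snoc n))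
           (≡.trans (Listₚ.concatMap-++ F (oneTo n) (suc n ∷ [])) (≡.cong (concatMap F (oneTo n) ++_) (Listₚ.++-identityʳ (F (suc n)))))) ⟩
    ι (prodℤ (filter P? (concatMap F (oneTo n) ++ F (suc n))))
      ≈⟨ ι-prodℤ-filter-++ P? (concatMap F (oneTo n)) (F (suc n)) ⟩
    ι (prodℤ (filter P? (concatMap F (oneTo n)))) * ι (prodℤ (filter P? (F (suc n))))
      ≈⟨ *-cong (ι-prodℤ-filter P? F f n (λ i r → eq i (weaken r))) (eq (suc n) (top n)) ⟩
    prod (suc n) f ∎

-- Writing `p` as `suc (h ℕ.+ h)` builds in that it is odd, makes `(p - 1)/2` a variable, and lets
-- `x ^ p` unfold to `x * x ^ (h ℕ.+ h)`.
module Characteristic (h : ℕ) (p-prime : Prime (suc (h ℕ.+ h))) (R : CommutativeRing 0ℓ 0ℓ)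
  (char-p : HasCharacteristic R (suc (h ℕ.+ h))) where

  open RingLemmas R
  open Frobenius p-prime char-p public

  private
    p = suc (h ℕ.+ h)

  1≤h : 1 ≤ h
  1≤h = ℕₚ.n≢0⇒n>0 λ { ≡.refl → ¬prime[1] p-prime }

  Unit : Carrier → Set
  Unit x = ∃[ y ] x * y ≈ 1#

  unit⇒regular : ∀ {x} → Unit x → Regular x
  unit⇒regular {x} (y , xy≈1) z xz≈0 = begin
    z            ≈⟨ *-identityˡ z ⟨
    1# * z       ≈⟨ *-congʳ xy≈1 ⟨
    x * y * z    ≈⟨ solve 3 (λ x y z → x :* y :* z := y :* (x :* z)) refl x y z ⟩
    y * (x * z)  ≈⟨ *-congˡ xz≈0 ⟩
    y * 0#       ≈⟨ zeroʳ y ⟩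
    0#           ∎

  unit-cong : ∀ {x y} → x ≈ y → Unit x → Unit y
  unit-cong x≈y (z , xz≈1) = z , trans (*-congʳ (sym x≈y)) xz≈1

  unit-neg : ∀ {x} → Unit x → Unit (- x)
  unit-neg {x} (y , xy≈1) = - y , trans (solve 2 (λ x y → (:- x) :* (:- y) := x :* y) refl x y) xy≈1

  unit-* : ∀ {x y} → Unit x → Unit y → Unit (x * y)
  unit-* {x} {y} (x′ , xx′≈1) (y′ , yy′≈1) = x′ * y′ , (begin
    x * y * (x′ * y′)    ≈⟨ solve 4 (λ x y z w → x :* y :* (z :* w) := x :* z :* (y :* w)) refl x y x′ y′ ⟩
    x * x′ * (y * y′)    ≈⟨ *-cong xx′≈1 yy′≈1 ⟩
    1# * 1#              ≈⟨ *-identityˡ 1# ⟩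
    1#                   ∎)

  unit-factor : ∀ {x y} → Unit (x * y) → Unit x
  unit-factor {x} {y} (z , xyz≈1) = y * z , trans (sym (*-assoc x y z)) xyz≈1

  cancel : ∀ {x y z} → Unit x → x * y ≈ x * z → y ≈ z
  cancel {x} {y} {z} u xy≈xz = x∙y⁻¹≈ε⇒x≈y y z (unit⇒regular u (y - z) (begin
    x * (y - z)    ≈⟨ solve 3 (λ x y z → x :* (y :- z) := x :* y :- x :* z) refl x y z ⟩
    x * y - x * z  ≈⟨ +-congʳ xy≈xz ⟩
    x * z - x * z  ≈⟨ -‿inverseʳ _ ⟩
    0#             ∎))

  unit≉0 : ¬ 1# ≈ 0# → ∀ {x} → Unit x → ¬ x ≈ 0#
  unit≉0 1≉0 u x≈0 = 1≉0 (unit⇒regular u 1# (trans (*-identityʳ _) x≈0))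

  prod-unit : ∀ n {f} → (∀ i → InRange n i → Unit (f i)) → Unit (prod n f)
  prod-unit zero    u = 1# , *-identityˡ 1#
  prod-unit (suc n) u = unit-* (prod-unit n (λ i r → u i (weaken r))) (u (suc n) (top n))

  ι-multiple : ∀ {i} → + p ∣ i → ι i ≈ 0#
  ι-multiple (divides q ≡.refl) = trans (ι-* q (+ p)) (trans (*-congˡ char-p) (zeroʳ _))

  -- Bézout gives multiples of `n` and of `p` that differ by 1, and the multiple of `p` is zero in
  -- `R`. Which of the two is larger decides the sign of the inverse.
  ℕ-unit : ∀ n → ¬ p ℕᵈ.∣ n → Unit (ι (+ n))
  ℕ-unit n p∤n with coprime-Bézout (prime∤⇒coprime p-prime p∤n)
  ... | Bézout.+- x y eq = - ι (+ y) , (begin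
      ι (+ n) * - ι (+ y)
        ≈⟨ solve 2 (λ n y → n :* :- y := con (+ 1) :- (con (+ 1) :+ y :* n)) refl (ι (+ n)) (ι (+ y)) ⟩
      1# - (1# + ι (+ y) * ι (+ n))    ≈⟨ +-congˡ (-‿cong (+-congˡ (ι-* (+ y) (+ n)))) ⟨
      1# - (1# + ι (+ y ℤ.* + n))      ≈⟨ +-congˡ (-‿cong (ι-+ (+ 1) (+ y ℤ.* + n))) ⟨
      1# - ι (+ 1 ℤ.+ + y ℤ.* + n)     ≡⟨ ≡.cong (λ k → 1# - ι (+ 1 ℤ.+ k)) (ℤₚ.pos-* y n) ⟨
      1# - ι (+ (1 ℕ.+ y ℕ.* n))       ≡⟨ ≡.cong (λ k → 1# - ι k) (≡.trans (≡.cong +_ eq) (ℤₚ.pos-* x p)) ⟩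
      1# - ι (+ x ℤ.* + p)             ≈⟨ +-congˡ (-‿cong (ι-multiple (divides (+ x) ≡.refl))) ⟩
      1# - 0#                          ≈⟨ solve 0 (con (+ 1) :- con (+ 0) := con (+ 1)) refl ⟩
      1#                               ∎)
  ... | Bézout.-+ x y eq = ι (+ y) , (begin
      ι (+ n) * ι (+ y)          ≈⟨ *-comm _ _ ⟩
      ι (+ y) * ι (+ n)          ≈⟨ ι-* (+ y) (+ n) ⟨
      ι (+ y ℤ.* + n)            ≡⟨ ≡.cong ι (≡.trans (≡.cong (ℤ._+_ (+ 1)) (≡.sym (ℤₚ.pos-* x p))) (≡.trans (≡.cong +_ eq) (ℤₚ.pos-* y n))) ⟨
      ι (+ 1 ℤ.+ + x ℤ.* + p)    ≈⟨ ι-+ (+ 1) (+ x ℤ.* + p) ⟩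
      1# + ι (+ x ℤ.* + p)       ≈⟨ +-congˡ (ι-multiple (divides (+ x) ≡.refl)) ⟩
      1# + 0#                    ≈⟨ +-identityʳ 1# ⟩
      1#                         ∎)

  ℤ-unit : ∀ i → ¬ + p ∣ i → Unit (ι i)
  ℤ-unit i@(+ n)      p∤i = ℕ-unit n (λ p∣n → p∤i (∣ᵤ⇒∣ p∣n))
  ℤ-unit i@(-[1+ n ]) p∤i = unit-neg (ℕ-unit (suc n) (λ p∣n → p∤i (∣ᵤ⇒∣ p∣n)))

  small-unit : ∀ {n} → 1 ≤ n → n ≤ h ℕ.+ h → Unit (ι (+ n))
  small-unit {suc n} _ n≤2h = ℕ-unit (suc n) (ℕᵈ.>⇒∤ (s≤s n≤2h))

  inRange-unit : ∀ {i} → InRange h i → Unit (ι (+ i))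
  inRange-unit (1≤i , i≤h) = small-unit 1≤i (ℕₚ.≤-trans i≤h (ℕₚ.m≤m+n h h))

  -- Frobenius gives `(1 + n)ᵖ = 1 + nᵖ`, so induction on `n` works in any ring of characteristic
  -- `p`.
  fermat : ∀ n → ι (+ n) ^ p ≈ ι (+ n)
  fermat zero    = zeroˡ _
  fermat (suc n) = begin
    ι (+ suc n) ^ p          ≈⟨ ^-congˡ p (ι-+ (+ 1) (+ n)) ⟩
    (1# + ι (+ n)) ^ p       ≈⟨ frobenius 1# (ι (+ n)) ⟩
    1# ^ p + ι (+ n) ^ p     ≈⟨ +-cong (1^n≈1 p) (fermat n) ⟩
    1# + ι (+ n)             ≈⟨ ι-+ (+ 1) (+ n) ⟨
    ι (+ suc n)              ∎

  fermat-unit : ∀ {x} → Unit x → x ^ p ≈ x → x ^ (h ℕ.+ h) ≈ 1#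
  fermat-unit {x} u xᵖ≈x = cancel u (trans xᵖ≈x (sym (*-identityʳ x)))

  square : ℕ → Carrier
  square i = ι (+ i) * ι (+ i)

  [x*x]^h : ∀ x → (x * x) ^ h ≈ x ^ (h ℕ.+ h)
  [x*x]^h x = trans (^-distrib-* x x h) (sym (^-homo-* x h h))

  square^h : ∀ {i} → InRange h i → square i ^ h ≈ 1#
  square^h {i} r = trans ([x*x]^h _) (fermat-unit (inRange-unit r) (fermat i))

  -- `i² - j² = -(j - i)(j + i)`, and both factors lie between 1 and `2h`, hence are prime to `p`.
  square-difference-unit : ∀ {i j} → InRange h i → InRange h j → i < j → Unit (square i - square j)
  square-difference-unit {i} {j} (1≤i , i≤h) (1≤j , j≤h) i<j = unit-cong eq (unit-neg (unit-*
      (small-unit (ℕₚ.m<n⇒0<n∸m i<j) (ℕₚ.≤-trans (ℕₚ.m∸n≤m j i) (ℕₚ.≤-trans j≤h (ℕₚ.m≤m+n h h))))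
      (small-unit {j ℕ.+ i} (ℕₚ.≤-trans 1≤j (ℕₚ.m≤m+n j i)) (ℕₚ.+-mono-≤ j≤h i≤h))))
    where
    d = j ℕ.∸ i
    ιj : ι (+ j) ≈ ι (+ d) + ι (+ i)
    ιj = trans (reflexive (≡.cong (λ k → ι (+ k)) (≡.sym (ℕₚ.m∸n+n≡m (ℕₚ.<⇒≤ i<j))))) (ι-+ (+ d) (+ i))
    eq : - (ι (+ d) * ι (+ (j ℕ.+ i))) ≈ square i - square j
    eq = begin
      - (ι (+ d) * ι (+ (j ℕ.+ i)))                    ≈⟨ -‿cong (*-congˡ (trans (ι-+ (+ j) (+ i)) (+-congʳ ιj))) ⟩
      - (ι (+ d) * (ι (+ d) + ι (+ i) + ι (+ i)))
        ≈⟨ solve 2 (λ d i → :- (d :* (d :+ i :+ i)) := i :* i :- (d :+ i) :* (d :+ i)) refl _ _ ⟩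
      square i - (ι (+ d) + ι (+ i)) * (ι (+ d) + ι (+ i))  ≈⟨ +-congˡ (-‿cong (*-cong ιj ιj)) ⟨
      square i - square j                              ∎

  -- By Fermat each `i²` is a root of `Xʰ - 1`, and the differences of these `h` roots are units.
  squares-split : ∀ x → prod h (λ i → x - square i) ≈ x ^ h - 1#
  squares-split = go h ≡.refl
    where
    go : ∀ n → n ≡ h → ∀ x → prod n (λ i → x - square i) ≈ x ^ n - 1#
    go zero    ≡.refl x = ⊥-elim (¬prime[1] p-prime)
    go (suc n) ≡.refl x = x^n-1-splits n square (λ i → square^h)
      (λ i j r s i<j → unit⇒regular (square-difference-unit r s i<j)) x

  ι-form : ∀ A i j → ι (form A i j) ≈ square i - ι A * (ι (+ i) * ι (+ j)) - square j
  ι-form A i j = begin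
    ι (form A i j)
      ≈⟨ trans (ι-+ (+ i ℤ.* + i ℤ.- A ℤ.* + i ℤ.* + j) _) (+-cong (ι-+ (+ i ℤ.* + i) _) (ι-neg (+ j ℤ.* + j))) ⟩
    ι (+ i ℤ.* + i) + ι (ℤ.- (A ℤ.* + i ℤ.* + j)) - ι (+ j ℤ.* + j)
      ≈⟨ +-cong (+-cong (ι-* (+ i) (+ i)) (ι-neg (A ℤ.* + i ℤ.* + j))) (-‿cong (ι-* (+ j) (+ j))) ⟩
    square i - ι (A ℤ.* + i ℤ.* + j) - square j
      ≈⟨ +-congʳ (+-congˡ (-‿cong (trans (ι-* (A ℤ.* + i) (+ j)) (trans (*-congʳ (ι-* A (+ i))) (*-assoc _ _ _))))) ⟩
    square i - ι A * (ι (+ i) * ι (+ j)) - square j ∎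

  -- Filtering a factor out amounts to replacing it by 1. The decision is an argument so that proofs
  -- can split on it directly.
  maskedBy : ∀ {i} → Dec (+ p ∣ i) → Carrier
  maskedBy     (yes _) = 1#
  maskedBy {i} (no  _) = ι i

  masked : ℤ → Carrier
  masked i = maskedBy (+ p ∣? i)

  ι-T : ∀ A → ι (T p A) ≈ prod h (λ i → prod h (λ j → masked (form A i j)))
  ι-T A = trans (reflexive (≡.cong (λ n → ι (prodℤ (filter P? (concatMap (λ i → map (form A i) (oneTo n)) (oneTo n))))) p/2≡h))
    (ι-prodℤ-filter P? _ _ h (λ i _ → trans (reflexive (≡.cong (λ xs → ι (prodℤ (filter P? xs))) (map-concatMap (form A i) (oneTo h))))
      (ι-prodℤ-filter P? (λ j → form A i j ∷ []) _ h (λ j _ → single (form A i j)))))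
    where
    open ListProducts R
    P? = λ i → ¬? (+ p ∣? i)
    p/2≡h : p ℕ./ 2 ≡ h
    p/2≡h = ≡.trans (≡.cong (ℕ._/ 2) (≡.trans (≡.cong (λ k → suc (h ℕ.+ k)) (≡.sym (ℕₚ.+-identityʳ h))) (≡.cong suc (ℕₚ.*-comm 2 h))))
      (≡.trans (ℕᵐ.+-distrib-/-∣ʳ 1 {h ℕ.* 2} {2} (ℕᵈ.divides h ≡.refl)) (ℕᵐ.m*n/n≡m h 2))
    single : ∀ i → ι (prodℤ (filter P? (i ∷ []))) ≈ masked i
    single i = go (+ p ∣? i)
      where
      go : ∀ d → ι (prodℤ (filter P? (i ∷ []))) ≈ maskedBy {i} d
      go (yes p∣i) = reflexive (≡.cong (λ xs → ι (prodℤ xs)) (Listₚ.filter-reject P? (λ p∤i → p∤i p∣i)))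
      go (no p∤i)  = reflexive (≡.trans (≡.cong (λ xs → ι (prodℤ xs)) (Listₚ.filter-accept P? p∤i)) (≡.cong ι (ℤₚ.*-identityʳ i)))
    map-concatMap : ∀ (f : ℕ → ℤ) xs → map f xs ≡ concatMap (λ x → f x ∷ []) xs
    map-concatMap f xs = ≡.trans (≡.sym (Listₚ.concatMap-pure (map f xs))) (Listₚ.concatMap-map List.[_] f xs)

  T-unit : ∀ A → (∀ i j → InRange h i → InRange h j → ¬ + p ∣ form A i j) → Unit (ι (T p A))
  T-unit A p∤ = unit-cong (sym (ι-T A)) (prod-unit h λ i r → prod-unit h λ j s → masked-unit (p∤ i j r s))
    where
    masked-unit : ∀ {i} → ¬ + p ∣ i → Unit (masked i)
    masked-unit {i} p∤i = go (+ p ∣? i)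
      where
      go : ∀ d → Unit (maskedBy {i} d)
      go (yes p∣i) = ⊥-elim (p∤i p∣i)
      go (no _)    = ℤ-unit i p∤i

-- The product of the values of the form

module DualNumbers (h : ℕ) (p-prime : Prime (suc (h ℕ.+ h))) (R : CommutativeRing 0ℓ 0ℓ)
  (char-p : HasCharacteristic R (suc (h ℕ.+ h))) where

  open RingLemmas R
  open Characteristic h p-prime R char-p
  -- With both parameters zero the adjoined element satisfies `ε² = 0`. A polynomial at `x + ε` then
  -- has its value as first coordinate and its derivative as second.
  open QuadraticExtension R 0# 0#
  private
    module E = RingLemmas extension
    module Eᶜ = Characteristic h p-prime extension
      (E.trans (embed-ι (+ suc (h ℕ.+ h))) (char-p , refl))

    mul-ε : ∀ x y z → (x , y) E.* (z , 1#) E.≈ (x * z , x + y * z)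
    mul-ε x y z =
      solve 3 (λ x y z → x :* z :+ con (+ 0) :* (y :* con (+ 1)) := x :* z) refl x y z ,
      solve 3 (λ x y z → x :* con (+ 1) :+ y :* z :+ con (+ 0) :* (y :* con (+ 1)) := x :+ y :* z) refl x y z

    real-part : ∀ n (f : ℕ → Carrier) → proj₁ (E.prod n (λ i → f i , 1#)) ≈ prod n f
    real-part zero    f = refl
    real-part (suc n) f = trans (proj₁ (mul-ε _ (proj₂ (E.prod n (λ i → f i , 1#))) (f (suc n)))) (*-congʳ (real-part n f))

    -- The product rule at a zero: every summand of the derivative contains the factor `f k ≈ 0`,
    -- except the one in which factor `k` itself is differentiated. In `g` that factor is replaced
    -- by 1.
    dual-part : ∀ n (f g : ℕ → Carrier) k → InRange n k → f k ≈ 0# → g k ≈ 1# → (∀ i → InRange n i → i ≢ k → g i ≈ f i) →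
      proj₂ (E.prod n (λ i → f i , 1#)) ≈ prod n g
    dual-part zero    f g zero    (() , _) _ _ _
    dual-part zero    f g (suc _) (_ , ()) _ _ _
    dual-part (suc n) f g k r fk≈0 gk≈1 g≈f with k ℕ.≟ suc n
    ... | yes ≡.refl = begin
      proj₂ (E.prod n F E.* (f (suc n) , 1#))        ≈⟨ proj₂ (mul-ε _ _ _) ⟩
      proj₁ (E.prod n F) + proj₂ (E.prod n F) * f k  ≈⟨ +-cong (real-part n f) (trans (*-congˡ fk≈0) (zeroʳ _)) ⟩
      prod n f + 0#                                  ≈⟨ trans (+-identityʳ _) (sym (*-identityʳ _)) ⟩
      prod n f * 1#                                  ≈⟨ *-cong (prod-cong n λ i s → sym (g≈f i (weaken s) (ℕₚ.<⇒≢ (s≤s (proj₂ s))))) (sym gk≈1) ⟩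
      prod n g * g (suc n)                           ∎
      where F = λ i → f i , 1#
    ... | no k≢1+n = begin
      proj₂ (E.prod n F E.* (f (suc n) , 1#))                ≈⟨ proj₂ (mul-ε _ _ _) ⟩
      proj₁ (E.prod n F) + proj₂ (E.prod n F) * f (suc n)
        ≈⟨ +-cong (trans (real-part n f) (prod-0 n f k (proj₁ r , k≤n) fk≈0))
             (*-cong (dual-part n f g k (proj₁ r , k≤n) fk≈0 gk≈1 (λ i s → g≈f i (weaken s)))
                     (sym (g≈f (suc n) (top n) (λ e → k≢1+n (≡.sym e))))) ⟩
      0# + prod n g * g (suc n)                              ≈⟨ +-identityˡ _ ⟩
      prod n g * g (suc n)                                   ∎
      where
      F = λ i → f i , 1#
      k≤n = ℕₚ.≤-pred (ℕₚ.≤∧≢⇒< (proj₂ r) k≢1+n)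

    -- The power rule, multiplied through by `x` so that the exponent `n - 1` does not occur.
    derivative : ∀ n x → (proj₁ ((x , 1#) E.^ n) ≈ x ^ n) × (x * proj₂ ((x , 1#) E.^ n) ≈ ι (+ n) * x ^ n)
    derivative zero    x = refl , trans (zeroʳ x) (sym (zeroˡ _))
    derivative (suc n) x = trans (proj₁ step) (trans (*-comm _ _) (*-congˡ (proj₁ (derivative n x)))) , (begin
      x * proj₂ ((x , 1#) E.^ suc n)  ≈⟨ *-congˡ (proj₂ step) ⟩
      x * (a + d * x)                 ≈⟨ solve 3 (λ x a d → x :* (a :+ d :* x) := x :* a :+ x :* (x :* d)) refl x a d ⟩
      x * a + x * (x * d)             ≈⟨ +-cong (*-congˡ (proj₁ (derivative n x))) (*-congˡ (proj₂ (derivative n x))) ⟩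
      x * x ^ n + x * (ι (+ n) * x ^ n)
        ≈⟨ solve 3 (λ x y n → x :* y :+ x :* (n :* y) := (con (+ 1) :+ n) :* (x :* y)) refl x (x ^ n) (ι (+ n)) ⟩
      (1# + ι (+ n)) * x ^ suc n      ≈⟨ *-congʳ (ι-+ (+ 1) (+ n)) ⟨
      ι (+ suc n) * x ^ suc n         ∎)
      where
      a = proj₁ ((x , 1#) E.^ n)
      d = proj₂ ((x , 1#) E.^ n)
      step : (x , 1#) E.^ suc n E.≈ (a * x , a + d * x)
      step = E.trans (E.*-comm (x , 1#) (a , d)) (mul-ε a d x)

  -- The derivative of ∏(X - i²) = Xʰ - 1 at a root x.
  product-of-differences : ∀ x (g : ℕ → Carrier) k → InRange h k → x - square k ≈ 0# → g k ≈ 1# →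
    (∀ i → InRange h i → i ≢ k → g i ≈ x - square i) → x * prod h g ≈ ι (+ h) * x ^ h
  product-of-differences x g k r xk≈0 gk≈1 g≈ = begin
    x * prod h g                                           ≈⟨ *-congˡ (dual-part h (λ i → x - square i) g k r xk≈0 gk≈1 g≈) ⟨
    x * proj₂ (E.prod h (λ i → x - square i , 1#))
      ≈⟨ *-congˡ (proj₂ (E.prod-cong h λ i _ → E.sym (E.trans (E.+-congˡ {x , 1#} (E.-‿cong (square-embed i)))
           (refl , solve 0 (con (+ 1) :- con (+ 0) := con (+ 1)) refl)))) ⟩
    x * proj₂ (E.prod h (λ i → (x , 1#) E.- Eᶜ.square i))   ≈⟨ *-congˡ (proj₂ (Eᶜ.squares-split (x , 1#))) ⟩
    x * (proj₂ ((x , 1#) E.^ h) - 0#)                      ≈⟨ *-congˡ (trans (+-congˡ -0#≈0#) (+-identityʳ _)) ⟩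
    x * proj₂ ((x , 1#) E.^ h)                             ≈⟨ proj₂ (derivative h x) ⟩
    ι (+ h) * x ^ h                                        ∎
    where
    square-embed : ∀ i → Eᶜ.square i E.≈ embed (square i)
    square-embed i = E.trans (E.*-cong (embed-ι (+ i)) (embed-ι (+ i))) (E.sym (embed-* (ι (+ i)) (ι (+ i))))

module MetallicMean (h : ℕ) (p-prime : Prime (suc (h ℕ.+ h))) (R : CommutativeRing 0ℓ 0ℓ)
  (char-p : HasCharacteristic R (suc (h ℕ.+ h)))
  (A : ℤ) (w : CommutativeRing.Carrier R) (w²≈Aw+1 : IsMetallicMean R A w) where

  open RingLemmas R
  open Characteristic h p-prime R char-p

  private
    p = suc (h ℕ.+ h)
    u = w * w
    F G : ℕ → ℕ → Carrier
    F i j = ι (form A i j)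
    G i j = u * square j - square i

  Aw≈w²-1 : ι A * w ≈ u - 1#
  Aw≈w²-1 = sym (trans (+-congʳ w²≈Aw+1) (solve 1 (λ x → x :+ con (+ 1) :- con (+ 1) := x) refl _))

  w⁻¹ : Carrier
  w⁻¹ = w - ι A

  w*w⁻¹≈1 : w * w⁻¹ ≈ 1#
  w*w⁻¹≈1 = begin
    w * (w - ι A)        ≈⟨ solve 2 (λ w a → w :* (w :- a) := w :* w :- a :* w) refl w (ι A) ⟩
    u - ι A * w          ≈⟨ +-congʳ w²≈Aw+1 ⟩
    ι A * w + 1# - ι A * w  ≈⟨ xyx⁻¹≈y _ _ ⟩
    1#                   ∎

  w-unit : Unit w
  w-unit = w⁻¹ , w*w⁻¹≈1

  -- Since the conjugate of `w` is `-1/w`, the form factors as `-w f(i,j) = (wj - i)(wi + j)`; the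
  -- right-hand side is this product expanded.
  -wF : ∀ i j → - w * F i j ≈ (u - 1#) * (ι (+ i) * ι (+ j)) - w * (square i - square j)
  -wF i j = begin
    - w * F i j  ≈⟨ *-congˡ (ι-form A i j) ⟩
    - w * (square i - ι A * (ι (+ i) * ι (+ j)) - square j)
      ≈⟨ solve 4 (λ w a i j → :- w :* (i :* i :- a :* (i :* j) :- j :* j) :=
           a :* w :* (i :* j) :- w :* (i :* i :- j :* j)) refl w (ι A) (ι (+ i)) (ι (+ j)) ⟩
    ι A * w * (ι (+ i) * ι (+ j)) - w * (square i - square j)  ≈⟨ +-congʳ (*-congʳ Aw≈w²-1) ⟩
    (u - 1#) * (ι (+ i) * ι (+ j)) - w * (square i - square j)  ∎

  -- Exchanging `i` and `j` turns `(wj - i)(wi + j)` into `(wi - j)(wj + i)`. The four factors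
  -- regroup into the differences of squares `(wj - i)(wj + i)` and `(wi - j)(wi + j)`.
  FF≈GG : ∀ i j → - w * F i j * (- w * F j i) ≈ G i j * G j i
  FF≈GG i j = trans (*-cong (-wF i j) (-wF j i))
    (solve 3 (λ w i j →
      ((w :* w :- con (+ 1)) :* (i :* j) :- w :* (i :* i :- j :* j)) :*
      ((w :* w :- con (+ 1)) :* (j :* i) :- w :* (j :* j :- i :* i)) :=
      (w :* w :* (j :* j) :- i :* i) :* (w :* w :* (i :* i) :- j :* j)) refl w (ι (+ i)) (ι (+ j)))

  F≈G : ∀ i → - w * F i i ≈ G i i
  F≈G i = trans (-wF i i)
    (solve 2 (λ w i → (w :* w :- con (+ 1)) :* (i :* i) :- w :* (i :* i :- i :* i) := w :* w :* (i :* i) :- i :* i)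
      refl w (ι (+ i)))

  [uj²]^h : ∀ {j} → InRange h j → (u * square j) ^ h ≈ u ^ h
  [uj²]^h {j} r = trans (^-distrib-* u (square j) h) (trans (*-congˡ (square^h r)) (*-identityʳ _))

  -- This is `Xʰ - 1` at `X = u j²`; as `(j²)ʰ = 1`, the value is the same for every `j`.
  prod-G : ∀ {j} → InRange h j → prod h (λ i → G i j) ≈ u ^ h - 1#
  prod-G {j} r = trans (squares-split (u * square j)) (+-congʳ ([uj²]^h r))

  prod-scale : ∀ c (f : ℕ → ℕ → Carrier) → prod h (λ i → prod h (λ j → c * f i j)) ≈ (c ^ h) ^ h * prod h (λ i → prod h (f i))
  prod-scale c f = begin
    prod h (λ i → prod h (λ j → c * f i j))              ≈⟨ prod-cong h (λ i _ → trans (prod-* h _ _) (*-congʳ (prod-const h c))) ⟩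
    prod h (λ i → c ^ h * prod h (f i))                  ≈⟨ prod-* h _ _ ⟩
    prod h (λ _ → c ^ h) * prod h (λ i → prod h (f i))   ≈⟨ *-congʳ (prod-const h _) ⟩
    (c ^ h) ^ h * prod h (λ i → prod h (f i))            ∎

  T-nonvanishing : (∀ i j → InRange h i → InRange h j → ¬ + p ∣ form A i j) →
    ((- w) ^ h) ^ h * ι (T p A) ≈ (u ^ h - 1#) ^ h
  T-nonvanishing p∤ = begin
    ((- w) ^ h) ^ h * ι (T p A)                      ≈⟨ *-congˡ (trans (ι-T A) (prod-cong h λ i r → prod-cong h λ j s → unmask (p∤ i j r s))) ⟩
    ((- w) ^ h) ^ h * prod h (λ i → prod h (F i))    ≈⟨ prod-scale (- w) F ⟨
    prod h (λ i → prod h (λ j → - w * F i j))        ≈⟨ prod-symmetric h _ _ (λ i _ → F≈G i) (λ i j _ _ _ → FF≈GG i j) ⟩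
    prod h (λ i → prod h (G i))                      ≈⟨ prod-swap h h G ⟩
    prod h (λ j → prod h (λ i → G i j))              ≈⟨ prod-cong h (λ j → prod-G) ⟩
    prod h (λ _ → u ^ h - 1#)                        ≈⟨ prod-const h _ ⟩
    (u ^ h - 1#) ^ h                                 ∎
    where
    unmask : ∀ {i} → ¬ + p ∣ i → masked i ≈ ι i
    unmask {i} p∤i = go (+ p ∣? i)
      where
      go : ∀ d → maskedBy {i} d ≈ ι i
      go (yes p∣i) = ⊥-elim (p∤i p∣i)
      go (no _)    = refl

  -- The setting is 𝔽ₚ containing `w`. Now `uʰ = 1`, so `u j²` is again one of the squares
  -- `1² , … , h²`, and the zeros of `G` form the graph of a permutation of `1 , … , h`.
  module Field (field? : ∀ x → x ≈ 0# ⊎ Unit x) (1≉0 : ¬ 1# ≈ 0#) (w^2h≈1 : w ^ (h ℕ.+ h) ≈ 1#)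
    (A-unit : Unit (ι A)) (D-unit : Unit (ι A * ι A + ι (+ 4))) where

    2-unit : Unit (ι (+ 2))
    2-unit = small-unit (s≤s z≤n) (ℕₚ.+-mono-≤ 1≤h 1≤h)

    u^h≈1 : u ^ h ≈ 1#
    u^h≈1 = trans ([x*x]^h w) w^2h≈1

    c : Carrier
    c = 1# + u

    -- `c = w (w + 1/w) = w (2w - A)`, and the square of `2w - A` is the discriminant `A² + 4`.
    c-unit : Unit c
    c-unit = unit-factor (unit-cong (sym c²) (unit-* (unit-* w-unit w-unit) D-unit))
      where
      c² : c * c ≈ u * (ι A * ι A + ι (+ 4))
      c² = begin
        c * c  ≈⟨ solve 1 (λ u → (con (+ 1) :+ u) :* (con (+ 1) :+ u) := (u :- con (+ 1)) :* (u :- con (+ 1)) :+ con (+ 4) :* u) refl u ⟩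
        (u - 1#) * (u - 1#) + ι (+ 4) * u  ≈⟨ +-congʳ (*-cong Aw≈w²-1 Aw≈w²-1) ⟨
        ι A * w * (ι A * w) + ι (+ 4) * u
          ≈⟨ solve 2 (λ a w → a :* w :* (a :* w) :+ con (+ 4) :* (w :* w) := w :* w :* (a :* a :+ con (+ 4))) refl (ι A) w ⟩
        u * (ι A * ι A + ι (+ 4)) ∎

    c⁻¹ : Carrier
    c⁻¹ = proj₁ c-unit

    -- The product keep x * pick x d is x with the value d substituted at x = 0.
    keepBy : ∀ {x} → x ≈ 0# ⊎ Unit x → Carrier
    keepBy {x} = [ (λ _ → 1#) , (λ _ → x) ]′

    pickBy : ∀ {x} → x ≈ 0# ⊎ Unit x → Carrier → Carrier
    pickBy s d = [ (λ _ → d) , (λ _ → 1#) ]′ s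

    keep : Carrier → Carrier
    keep x = keepBy (field? x)

    pick : Carrier → Carrier → Carrier
    pick x = pickBy (field? x)

    -- The relation covers both sides of the comparison: values of the form, where a zero becomes 1,
    -- and values of `G`, where a zero becomes `Y`.
    Masked : Carrier → Carrier → Carrier → Set
    Masked x m d = (x ≈ 0# × m ≈ d) ⊎ (Unit x × m ≈ x)

    keep*pick-masked : ∀ x d → Masked x (keep x * pick x d) d
    keep*pick-masked x d = go (field? x)
      where
      go : ∀ s → Masked x (keepBy s * pickBy s d) d
      go (inj₁ x≈0) = inj₁ (x≈0 , *-identityˡ d)
      go (inj₂ xu)  = inj₂ (xu , *-identityʳ x)

    pick-zero : ∀ {x} d → x ≈ 0# → pick x d ≈ d
    pick-zero {x} d x≈0 = go (field? x)
      where
      go : ∀ s → pickBy {x} s d ≈ d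
      go (inj₁ _)  = refl
      go (inj₂ xu) = ⊥-elim (unit≉0 1≉0 xu x≈0)

    pick-nonzero : ∀ {x} d → ¬ x ≈ 0# → pick x d ≈ 1#
    pick-nonzero {x} d x≉0 = go (field? x)
      where
      go : ∀ s → pickBy {x} s d ≈ 1#
      go (inj₁ x≈0) = ⊥-elim (x≉0 x≈0)
      go (inj₂ _)   = refl

    keep-zero : ∀ {x} → x ≈ 0# → keep x ≈ 1#
    keep-zero {x} x≈0 = go (field? x)
      where
      go : ∀ s → keepBy {x} s ≈ 1#
      go (inj₁ _)  = refl
      go (inj₂ xu) = ⊥-elim (unit≉0 1≉0 xu x≈0)

    keep-nonzero : ∀ {x} → ¬ x ≈ 0# → keep x ≈ x
    keep-nonzero {x} x≉0 = go (field? x)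
      where
      go : ∀ s → keepBy {x} s ≈ x
      go (inj₁ x≈0) = ⊥-elim (x≉0 x≈0)
      go (inj₂ _)   = refl

    pick-* : ∀ x d e → pick x (d * e) ≈ pick x d * pick x e
    pick-* x d e = go (field? x)
      where
      go : ∀ s → pickBy {x} s (d * e) ≈ pickBy s d * pickBy s e
      go (inj₁ _) = refl
      go (inj₂ _) = sym (*-identityˡ 1#)

    masked-masked : ∀ i → Masked (ι i) (masked i) 1#
    masked-masked i = go (+ p ∣? i)
      where
      go : ∀ d → Masked (ι i) (maskedBy {i} d) 1#
      go (yes p∣i) = inj₁ (ι-multiple p∣i , refl)
      go (no p∤i)  = inj₂ (ℤ-unit i p∤i , refl)

    prod-zero : ∀ n (f : ℕ → Carrier) → prod n f ≈ 0# → ∃[ i ] InRange n i × f i ≈ 0#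
    prod-zero zero    f 1≈0 = ⊥-elim (1≉0 1≈0)
    prod-zero (suc n) f eq = go (field? (f (suc n)))
      where
      go : f (suc n) ≈ 0# ⊎ Unit (f (suc n)) → ∃[ i ] InRange (suc n) i × f i ≈ 0#
      go (inj₁ f≈0) = suc n , top n , f≈0
      go (inj₂ fu)  = let i , r , fi≈0 = prod-zero n f (unit⇒regular fu _ (trans (*-comm _ _) eq)) in i , weaken r , fi≈0

    square-injective : ∀ {i j} → InRange h i → InRange h j → square i ≈ square j → i ≡ j
    square-injective {i} {j} r s eq = go (ℕₚ.<-cmp i j)
      where
      go : Tri (i < j) (i ≡ j) (i > j) → i ≡ j
      go (tri< i<j _ _) = ⊥-elim (unit≉0 1≉0 (square-difference-unit r s i<j) (x≈y⇒x∙y⁻¹≈ε eq))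
      go (tri≈ _ i≡j _) = i≡j
      go (tri> _ _ i>j) = ⊥-elim (unit≉0 1≉0 (square-difference-unit s r i>j) (x≈y⇒x∙y⁻¹≈ε (sym eq)))

    G≈0⇒ : ∀ i j → G i j ≈ 0# → square i ≈ u * square j
    G≈0⇒ i j eq = sym (x∙y⁻¹≈ε⇒x≈y _ _ eq)

    -- The product over `i` is `uʰ - 1 = 0`, so one of its factors is zero.
    row : ∀ j → InRange h j → ∃[ i ] InRange h i × G i j ≈ 0#
    row j r = prod-zero h (λ i → G i j) (trans (prod-G r) (trans (+-congʳ u^h≈1) (-‿inverseʳ 1#)))

    row-unique : ∀ {i k} j → InRange h i → InRange h k → G k j ≈ 0# → i ≢ k → ¬ G i j ≈ 0#
    row-unique {i} {k} j r s Gk≈0 i≢k Gi≈0 =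
      i≢k (square-injective r s (trans (G≈0⇒ i j Gi≈0) (sym (G≈0⇒ k j Gk≈0))))

    -- The required `j²` is `i²/u`, whose `h`-th power is again 1, so it is a root of `∏ (X - j²)`.
    column : ∀ i → InRange h i → ∃[ j ] InRange h j × G i j ≈ 0#
    column i r = let j , s , x≈j² = prod-zero h (λ j → x - square j) vanishes in j , s , (begin
      u * square j - square i                    ≈⟨ +-congʳ (*-congˡ (x∙y⁻¹≈ε⇒x≈y _ _ x≈j²)) ⟨
      u * x - square i
        ≈⟨ solve 3 (λ w v s → w :* w :* (v :* v :* s) :- s := w :* w :* (v :* v) :* s :- s) refl w w⁻¹ (square i) ⟩
      u * (w⁻¹ * w⁻¹) * square i - square i      ≈⟨ +-congʳ (trans (*-congʳ u*w⁻²≈1) (*-identityˡ _)) ⟩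
      square i - square i                        ≈⟨ -‿inverseʳ _ ⟩
      0#                                         ∎)
      where
      x = w⁻¹ * w⁻¹ * square i
      u*w⁻²≈1 : u * (w⁻¹ * w⁻¹) ≈ 1#
      u*w⁻²≈1 = trans (solve 2 (λ w v → w :* w :* (v :* v) := w :* v :* (w :* v)) refl w w⁻¹)
        (trans (*-cong w*w⁻¹≈1 w*w⁻¹≈1) (*-identityˡ 1#))
      vanishes : prod h (λ j → x - square j) ≈ 0#
      vanishes = begin
        prod h (λ j → x - square j)           ≈⟨ squares-split x ⟩
        x ^ h - 1#                            ≈⟨ +-congʳ (trans (^-distrib-* _ _ h) (trans (*-congˡ (square^h r)) (*-identityʳ _))) ⟩
        (w⁻¹ * w⁻¹) ^ h - 1#                  ≈⟨ +-congʳ (trans (sym (*-identityˡ _)) (*-congʳ (sym u^h≈1))) ⟩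
        u ^ h * (w⁻¹ * w⁻¹) ^ h - 1#          ≈⟨ +-congʳ (^-distrib-* u _ h) ⟨
        (u * (w⁻¹ * w⁻¹)) ^ h - 1#            ≈⟨ +-congʳ (trans (^-congˡ h u*w⁻²≈1) (1^n≈1 h)) ⟩
        1# - 1#                               ≈⟨ -‿inverseʳ 1# ⟩
        0#                                    ∎

    column-unique : ∀ i {j k} → InRange h j → InRange h k → G i k ≈ 0# → j ≢ k → ¬ G i j ≈ 0#
    column-unique i {j} {k} r s Gk≈0 j≢k Gj≈0 = j≢k (square-injective r s
      (cancel (unit-* w-unit w-unit) (trans (sym (G≈0⇒ i j Gj≈0)) (G≈0⇒ i k Gk≈0))))

    -- Fermat's inverse `j^(p-2)`: a total function of `j`, so it can stand inside `prod` without a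
    -- range proof.
    inverse : ℕ → Carrier
    inverse j = ι (+ j) ^ (ℕ.pred (h ℕ.+ h))

    ι*inverse≈1 : ∀ {j} → InRange h j → ι (+ j) * inverse j ≈ 1#
    ι*inverse≈1 {j} r = go (h ℕ.+ h) ≡.refl (ℕₚ.≤-trans 1≤h (ℕₚ.m≤m+n h h))
      where
      go : ∀ n → n ≡ h ℕ.+ h → 1 ≤ n → ι (+ j) * ι (+ j) ^ ℕ.pred n ≈ 1#
      go (suc n) eq _ = trans (^-congʳ (ι (+ j)) eq) (fermat-unit (inRange-unit r) (fermat j))

    -- The constant is forced. Where `i² = u j²`, the other factor is
    -- `G j i = (u² - 1) j² = A w c j²`. For the product with `Y` to be `-2 A u i j`, `Y` must be
    -- `-(2w/c)(i/j)`.
    e : Carrier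
    e = - (ι (+ 2) * w * c⁻¹)

    Y : ℕ → ℕ → Carrier
    Y i j = e * (ι (+ i) * inverse j)

    -- Where the form vanishes at (i , j), its value at (j , i) is -2Aij, and the matching factor
    -- of ∏∏ G is replaced by the value Y that restores the identity FF≈GG.
    Y*G : ∀ i {j} → InRange h j → G i j ≈ 0# → Y i j * G j i ≈ u * - (ι (+ 2) * ι A * (ι (+ i) * ι (+ j)))
    Y*G i {j} r G≈0 = begin
      Y i j * (u * square i - square j)       ≈⟨ *-congˡ (+-congʳ (*-congˡ (G≈0⇒ i j G≈0))) ⟩
      Y i j * (u * (u * square j) - square j)
        ≈⟨ solve 7 (λ t w v i k j u → :- (t :* w :* v) :* (i :* k) :* (u :* (u :* (j :* j)) :- j :* j) :=
             :- (t :* w :* i :* j) :* ((con (+ 1) :+ u) :* v) :* (j :* k) :* (u :- con (+ 1)))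
             refl (ι (+ 2)) w c⁻¹ (ι (+ i)) (inverse j) (ι (+ j)) u ⟩
      - (ι (+ 2) * w * ι (+ i) * ι (+ j)) * (c * c⁻¹) * (ι (+ j) * inverse j) * (u - 1#)
        ≈⟨ *-cong (*-cong (*-congˡ (proj₂ c-unit)) (ι*inverse≈1 r)) (sym Aw≈w²-1) ⟩
      - (ι (+ 2) * w * ι (+ i) * ι (+ j)) * 1# * 1# * (ι A * w)
        ≈⟨ solve 5 (λ t w i j a → :- (t :* w :* i :* j) :* con (+ 1) :* con (+ 1) :* (a :* w) :=
             w :* w :* :- (t :* a :* (i :* j))) refl (ι (+ 2)) w (ι (+ i)) (ι (+ j)) (ι A) ⟩
      u * - (ι (+ 2) * ι A * (ι (+ i) * ι (+ j))) ∎

    F+F : ∀ i j → F i j + F j i ≈ - (ι (+ 2) * ι A * (ι (+ i) * ι (+ j)))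
    F+F i j = trans (+-cong (ι-form A i j) (ι-form A j i))
      (solve 3 (λ a i j → i :* i :- a :* (i :* j) :- j :* j :+ (j :* j :- a :* (j :* i) :- i :* i) :=
        :- (con (+ 2) :* a :* (i :* j))) refl (ι A) (ι (+ i)) (ι (+ j)))

    F+F-unit : ∀ {i j} → InRange h i → InRange h j → Unit (- (ι (+ 2) * ι A * (ι (+ i) * ι (+ j))))
    F+F-unit r s = unit-neg (unit-* (unit-* 2-unit A-unit) (unit-* (inRange-unit r) (inRange-unit s)))

    G-not-both : ∀ {i j} → InRange h j → InRange h i → G i j ≈ 0# → ¬ G j i ≈ 0#
    G-not-both {i} {j} r s G≈0 G′≈0 = unit≉0 1≉0 (unit-* (unit-* w-unit w-unit) (F+F-unit s r))
      (trans (sym (Y*G i r G≈0)) (trans (*-congˡ G′≈0) (zeroʳ _)))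

    -- `F i j` and `F j i` cannot both vanish, as their sum `-2Aij` is a unit. By `FF≈GG`, one of
    -- them vanishes exactly when one of `G i j` and `G j i` does, though possibly at the transposed
    -- position: `i = -wj` kills `F j i` and `G i j`. Hence `one-zero` treats both positions of the
    -- zero of `G`.
    off-diagonal : ∀ {i j m m′ n n′} → InRange h i → InRange h j →
      Masked (F i j) m 1# → Masked (F j i) m′ 1# → Masked (G i j) n (Y i j) → Masked (G j i) n′ (Y j i) →
      - w * m * (- w * m′) ≈ n * n′
    off-diagonal {i} {j} {m} {m′} {n} {n′} r s = λ
      { (inj₁ (f , _)) (inj₁ (f′ , _)) _ _ →
          ⊥-elim (unit≉0 1≉0 (F+F-unit r s) (trans (sym (F+F i j)) (trans (+-cong f f′) (+-identityˡ 0#))))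
      ; (inj₁ (f , a)) (inj₂ (_ , b)) g g′ → one-zero g g′ (zeroProduct (inj₁ f))
          (trans (*-cong (*-congˡ a) (*-congˡ b)) (trans (*-congˡ (*-congˡ (otherˡ f)))
            (solve 2 (λ w x → :- w :* con (+ 1) :* (:- w :* x) := w :* w :* x) refl w _)))
      ; (inj₂ (_ , a)) (inj₁ (f′ , b)) g g′ → one-zero g g′ (zeroProduct (inj₂ f′))
          (trans (*-cong (*-congˡ a) (*-congˡ b)) (trans (*-congʳ (*-congˡ (otherʳ f′)))
            (solve 2 (λ w x → :- w :* x :* (:- w :* con (+ 1)) := w :* w :* x) refl w _)))
      ; (inj₂ (f , a)) (inj₂ (f′ , b)) g g′ → trans (*-cong (*-congˡ a) (*-congˡ b)) (trans (FF≈GG i j)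
          (sym (*-cong (keptˡ f f′ g) (keptʳ f f′ g′))))
      }
      where
      target = - (ι (+ 2) * ι A * (ι (+ i) * ι (+ j)))
      zeroProduct : F i j ≈ 0# ⊎ F j i ≈ 0# → G i j * G j i ≈ 0#
      zeroProduct (inj₁ f) = trans (sym (FF≈GG i j)) (trans (*-congʳ (trans (*-congˡ f) (zeroʳ _))) (zeroˡ _))
      zeroProduct (inj₂ f) = trans (sym (FF≈GG i j)) (trans (*-congˡ (trans (*-congˡ f) (zeroʳ _))) (zeroʳ _))
      otherˡ : F i j ≈ 0# → F j i ≈ target
      otherˡ f = trans (sym (trans (+-congʳ f) (+-identityˡ _))) (F+F i j)
      otherʳ : F j i ≈ 0# → F i j ≈ target
      otherʳ f = trans (sym (trans (+-congˡ f) (+-identityʳ _))) (F+F i j)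
      one-zero : Masked (G i j) n (Y i j) → Masked (G j i) n′ (Y j i) → G i j * G j i ≈ 0# →
        ∀ {z} → z ≈ u * target → z ≈ n * n′
      one-zero (inj₁ (g , _)) (inj₁ (g′ , _)) _ _ = ⊥-elim (G-not-both s r g g′)
      one-zero (inj₁ (g , a)) (inj₂ (_ , b)) _ eq = trans eq (sym (trans (*-cong a b) (Y*G i s g)))
      one-zero (inj₂ (_ , a)) (inj₁ (g′ , b)) _ eq = trans eq (sym (trans (*-cong a b) (trans (*-comm _ _)
        (trans (Y*G j r g′) (*-congˡ (-‿cong (*-congˡ (*-comm _ _))))))))
      one-zero (inj₂ (g , _)) (inj₂ (g′ , _)) gg≈0 _ = ⊥-elim (unit≉0 1≉0 (unit-* g g′) gg≈0)
      -w-unit = unit-neg w-unit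
      keptˡ : Unit (F i j) → Unit (F j i) → Masked (G i j) n (Y i j) → n ≈ G i j
      keptˡ f f′ (inj₂ (_ , a)) = a
      keptˡ f f′ (inj₁ (g , _)) = ⊥-elim (unit≉0 1≉0 (unit-* (unit-* -w-unit f) (unit-* -w-unit f′))
        (trans (FF≈GG i j) (trans (*-congʳ g) (zeroˡ _))))
      keptʳ : Unit (F i j) → Unit (F j i) → Masked (G j i) n′ (Y j i) → n′ ≈ G j i
      keptʳ f f′ (inj₂ (_ , a)) = a
      keptʳ f f′ (inj₁ (g , _)) = ⊥-elim (unit≉0 1≉0 (unit-* (unit-* -w-unit f) (unit-* -w-unit f′))
        (trans (FF≈GG i j) (trans (*-congˡ g) (zeroʳ _))))

    F-diagonal-unit : ∀ {i} → InRange h i → Unit (F i i)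
    F-diagonal-unit {i} r = unit-factor (unit-cong eq (F+F-unit r r))
      where
      eq : - (ι (+ 2) * ι A * (ι (+ i) * ι (+ i))) ≈ F i i * ι (+ 2)
      eq = trans (sym (F+F i i)) (solve 1 (λ x → x :+ x := x :* con (+ 2)) refl _)

    diagonal : ∀ {i m n} → InRange h i → Masked (F i i) m 1# → Masked (G i i) n (Y i i) → - w * m ≈ n
    diagonal r (inj₁ (f , _)) _ = ⊥-elim (unit≉0 1≉0 (F-diagonal-unit r) f)
    diagonal {i} r (inj₂ (f , _)) (inj₁ (g , _)) = ⊥-elim (unit≉0 1≉0 (unit-* (unit-neg w-unit) f) (trans (F≈G i) g))
    diagonal {i} r (inj₂ (_ , a)) (inj₂ (_ , b)) = trans (*-congˡ a) (trans (F≈G i) (sym b))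

    prod-pick-row : ∀ (d : ℕ → Carrier) → prod h (λ j → prod h (λ i → pick (G i j) (d j))) ≈ prod h d
    prod-pick-row d = prod-cong h λ j r → go j (row j r)
      where
      go : ∀ j → ∃[ i ] InRange h i × G i j ≈ 0# → prod h (λ i → pick (G i j) (d j)) ≈ d j
      go j (k , s , Gk≈0) = trans
        (prod-single h _ k s (λ i t i≢k → pick-nonzero (d j) (row-unique j t s Gk≈0 i≢k)))
        (pick-zero (d j) Gk≈0)

    prod-pick-column : ∀ (d : ℕ → Carrier) → prod h (λ j → prod h (λ i → pick (G i j) (d i))) ≈ prod h d
    prod-pick-column d = trans (prod-swap h h (λ j i → pick (G i j) (d i))) (prod-cong h λ i r → go i (column i r))
      where
      go : ∀ i → ∃[ j ] InRange h j × G i j ≈ 0# → prod h (λ j → pick (G i j) (d i)) ≈ d i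
      go i (k , s , Gk≈0) = trans
        (prod-single h _ k s (λ j t j≢k → pick-nonzero (d i) (column-unique i t s Gk≈0 j≢k)))
        (pick-zero (d i) Gk≈0)

    -- The zeros of `G` form a permutation, so along them the factors `i` and `1/j` each run once
    -- through the range and cancel. One `e` per `j` remains.
    prod-Y : prod h (λ j → prod h (λ i → pick (G i j) (Y i j))) ≈ e ^ h
    prod-Y = begin
      prod h (λ j → prod h (λ i → pick (G i j) (Y i j)))
        ≈⟨ prod-cong h (λ j _ → trans (prod-cong h λ i _ → trans (pick-* _ _ _) (*-congˡ (pick-* _ _ _)))
             (trans (prod-* h _ _) (*-congˡ (prod-* h _ _)))) ⟩
      prod h (λ j → prod h (λ i → pick (G i j) e) * (prod h (λ i → pick (G i j) (ι (+ i))) * prod h (λ i → pick (G i j) (inverse j))))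
        ≈⟨ trans (prod-* h _ _) (*-congˡ (prod-* h _ _)) ⟩
      prod h (λ j → prod h (λ i → pick (G i j) e)) *
        (prod h (λ j → prod h (λ i → pick (G i j) (ι (+ i)))) * prod h (λ j → prod h (λ i → pick (G i j) (inverse j))))
        ≈⟨ *-cong (prod-pick-row (λ _ → e)) (*-cong (prod-pick-column (λ i → ι (+ i))) (prod-pick-row inverse)) ⟩
      prod h (λ _ → e) * (prod h (λ i → ι (+ i)) * prod h inverse)
        ≈⟨ *-cong (prod-const h e) (trans (sym (prod-* h _ _)) (prod-1 h (λ j r → ι*inverse≈1 r))) ⟩
      e ^ h * 1#  ≈⟨ *-identityʳ _ ⟩
      e ^ h ∎

    -- For each `j` the derivative of `Xʰ - 1` at `x = u j²` gives `x ∏ keep = h xʰ = h`. In the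
    -- product over `j` the factors `u` disappear because `uʰ = 1`, which leaves the squares.
    prod-keep : prod h square * prod h (λ j → prod h (λ i → keep (G i j))) ≈ ι (+ h) ^ h
    prod-keep = begin
      prod h square * prod h (λ j → prod h (λ i → keep (G i j)))
        ≈⟨ *-congʳ (trans (sym (*-identityˡ _)) (*-congʳ (trans (sym u^h≈1) (sym (prod-const h u))))) ⟩
      prod h (λ _ → u) * prod h square * prod h (λ j → prod h (λ i → keep (G i j)))
        ≈⟨ trans (*-congʳ (sym (prod-* h _ _))) (sym (prod-* h _ _)) ⟩
      prod h (λ j → u * square j * prod h (λ i → keep (G i j)))
        ≈⟨ prod-cong h (λ j r → go j r (row j r)) ⟩
      prod h (λ _ → ι (+ h))  ≈⟨ prod-const h _ ⟩
      ι (+ h) ^ h ∎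
      where
      open DualNumbers h p-prime R char-p
      go : ∀ j → InRange h j → ∃[ i ] InRange h i × G i j ≈ 0# → u * square j * prod h (λ i → keep (G i j)) ≈ ι (+ h)
      go j r (k , s , Gk≈0) = trans
        (product-of-differences (u * square j) _ k s Gk≈0 (keep-zero Gk≈0)
          (λ i t i≢k → keep-nonzero (row-unique j t s Gk≈0 i≢k)))
        (trans (*-congˡ (trans ([uj²]^h r) u^h≈1)) (*-identityʳ _))

    -- Wilson's theorem for `(h!)²`, obtained from `∏ (X - i²) = Xʰ - 1` at `X = 0`.
    prod-squares : (- 1#) ^ h * prod h square ≈ - 1#
    prod-squares = begin
      (- 1#) ^ h * prod h square             ≈⟨ trans (*-congʳ (sym (prod-const h _))) (sym (prod-* h _ _)) ⟩
      prod h (λ i → - 1# * square i)         ≈⟨ prod-cong h (λ i _ → trans (-1*x≈-x _) (sym (+-identityˡ _))) ⟩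
      prod h (λ i → 0# - square i)           ≈⟨ squares-split 0# ⟩
      0# ^ h - 1#                            ≈⟨ +-congʳ (0^n≈0 1≤h) ⟩
      0# - 1#                                ≈⟨ +-identityˡ _ ⟩
      - 1#                                   ∎

    -- From `1 + 2h = p = 0` the integer `h` acts as `-1/2`, which cancels the `-2` in `e`.
    he≈wc⁻¹ : ι (+ h) * e ≈ w * c⁻¹
    he≈wc⁻¹ = begin
      ι (+ h) * - (ι (+ 2) * w * c⁻¹)
        ≈⟨ solve 3 (λ n w v → n :* :- (con (+ 2) :* w :* v) := w :* v :- (con (+ 1) :+ (n :+ n)) :* (w :* v)) refl (ι (+ h)) w c⁻¹ ⟩
      w * c⁻¹ - (1# + (ι (+ h) + ι (+ h))) * (w * c⁻¹)
        ≈⟨ +-congˡ (-‿cong (*-congʳ (trans (+-congˡ (sym (ι-+ (+ h) (+ h)))) (sym (ι-+ (+ 1) (+ (h ℕ.+ h))))))) ⟩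
      w * c⁻¹ - ι (+ p) * (w * c⁻¹)  ≈⟨ +-congˡ (-‿cong (trans (*-congʳ char-p) (zeroˡ _))) ⟩
      w * c⁻¹ - 0#                   ≈⟨ trans (+-congˡ -0#≈0#) (+-identityʳ _) ⟩
      w * c⁻¹                        ∎

    T-vanishing : (- 1#) ^ h * ((- w) ^ h) ^ h * (ι (T p A) * (1# + w * w) ^ h) ≈ - w ^ h
    T-vanishing = begin
      ε * ((- w) ^ h) ^ h * (ι (T p A) * c ^ h)
        ≈⟨ solve 4 (λ e z t c → e :* z :* (t :* c) := e :* (z :* t) :* c) refl _ _ _ _ ⟩
      ε * (((- w) ^ h) ^ h * ι (T p A)) * c ^ h
        ≈⟨ *-congʳ (*-congˡ (trans (trans (*-congˡ (ι-T A)) (sym (prod-scale (- w) _))) (prod-symmetric h _ _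
             (λ i r → diagonal r (masked-masked (form A i i)) (keep*pick-masked (G i i) (Y i i)))
             (λ i j r s _ → off-diagonal r s (masked-masked (form A i j)) (masked-masked (form A j i))
                 (keep*pick-masked (G i j) (Y i j)) (keep*pick-masked (G j i) (Y j i)))))) ⟩
      ε * prod h (λ i → prod h (λ j → keep (G i j) * pick (G i j) (Y i j))) * c ^ h
        ≈⟨ *-congʳ (*-congˡ (trans (prod-swap h h (λ i j → keep (G i j) * pick (G i j) (Y i j)))
             (trans (prod-cong h (λ j _ → prod-* h _ _)) (prod-* h _ _)))) ⟩
      ε * (K * prod h (λ j → prod h (λ i → pick (G i j) (Y i j)))) * c ^ h
        ≈⟨ *-congʳ (*-congˡ (*-congˡ prod-Y)) ⟩
      ε * (K * e ^ h) * c ^ h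
        ≈⟨ solve 4 (λ e k x c → e :* (k :* x) :* c := :- (:- con (+ 1) :* (e :* (k :* (x :* c))))) refl ε K (e ^ h) (c ^ h) ⟩
      - (- 1# * (ε * (K * (e ^ h * c ^ h))))
        -- Writing `-1` as `ε Q` supplies the product of squares that `prod-keep` combines with `K`
        -- into `hʰ`.
        ≈⟨ -‿cong (*-congʳ (sym prod-squares)) ⟩
      - (ε * Q * (ε * (K * (e ^ h * c ^ h))))
        ≈⟨ solve 5 (λ e q k x c → :- (e :* q :* (e :* (k :* (x :* c)))) := :- (e :* e :* (q :* k :* x :* c))) refl ε Q K (e ^ h) (c ^ h) ⟩
      - (ε * ε * (Q * K * e ^ h * c ^ h))
        ≈⟨ -‿cong (*-cong εε≈1 (*-congʳ (trans (*-congʳ prod-keep) (sym (^-distrib-* _ _ h))))) ⟩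
      - (1# * ((ι (+ h) * e) ^ h * c ^ h))
        ≈⟨ -‿cong (trans (*-identityˡ _) (trans (*-congʳ (^-congˡ h he≈wc⁻¹)) (sym (^-distrib-* _ _ h)))) ⟩
      - (w * c⁻¹ * c) ^ h
        ≈⟨ -‿cong (^-congˡ h (trans (*-assoc _ _ _) (trans (*-congˡ (trans (*-comm _ _) (proj₂ c-unit))) (*-identityʳ w)))) ⟩
      - w ^ h ∎
      where
      ε = (- 1#) ^ h
      K = prod h (λ j → prod h (λ i → keep (G i j)))
      Q = prod h square
      εε≈1 : ε * ε ≈ 1#
      εε≈1 = trans (sym (^-distrib-* _ _ h)) (trans (^-congˡ h (solve 0 (:- con (+ 1) :* :- con (+ 1) := con (+ 1)) refl)) (1^n≈1 h))

-- The value of `T` from the action of Frobenius on `w`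

module Powers (R : CommutativeRing 0ℓ 0ℓ) where

  open RingLemmas R

  ι-^ : ∀ i n → ι (i ℤ.^ n) ≈ ι i ^ n
  ι-^ i zero    = refl
  ι-^ i (suc n) = trans (ι-* i (i ℤ.^ n)) (*-congˡ (ι-^ i n))

  -1*-1≈1 : - 1# * - 1# ≈ 1#
  -1*-1≈1 = solve 0 (:- con (+ 1) :* :- con (+ 1) := con (+ 1)) refl

  ^-double : ∀ x k → x ^ (k ℕ.+ k) ≈ (x * x) ^ k
  ^-double x k = trans (^-homo-* x k k) (sym (^-distrib-* x x k))

  neg-even : ∀ x k → (- x) ^ (k ℕ.+ k) ≈ x ^ (k ℕ.+ k)
  neg-even x k = trans (^-double (- x) k)
    (trans (^-congˡ k (solve 1 (λ x → :- x :* :- x := x :* x) refl x)) (sym (^-double x k)))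

  neg-odd : ∀ x k → (- x) ^ suc (k ℕ.+ k) ≈ - x ^ suc (k ℕ.+ k)
  neg-odd x k = trans (*-congˡ (neg-even x k)) (sym (-‿distribˡ-* x _))

  ^-period : ∀ x m → x ^ m ≈ 1# → ∀ s k → x ^ (s ℕ.+ k ℕ.* m) ≈ x ^ s
  ^-period x m xᵐ≈1 s k = begin
    x ^ (s ℕ.+ k ℕ.* m)   ≈⟨ ^-homo-* x s (k ℕ.* m) ⟩
    x ^ s * x ^ (k ℕ.* m) ≡⟨ ≡.cong (λ n → x ^ s * x ^ n) (ℕₚ.*-comm k m) ⟩
    x ^ s * x ^ (m ℕ.* k) ≈⟨ *-congˡ (^-assocʳ x m k) ⟨
    x ^ s * (x ^ m) ^ k   ≈⟨ *-congˡ (trans (^-congˡ k xᵐ≈1) (1^n≈1 k)) ⟩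
    x ^ s * 1#            ≈⟨ *-identityʳ _ ⟩
    x ^ s                 ∎

module Evaluation (h : ℕ) (p-prime : Prime (suc (h ℕ.+ h))) (R : CommutativeRing 0ℓ 0ℓ)
  (char-p : HasCharacteristic R (suc (h ℕ.+ h)))
  (A : ℤ) (w : CommutativeRing.Carrier R) (w²≈Aw+1 : IsMetallicMean R A w) where

  open RingLemmas R
  open Characteristic h p-prime R char-p
  open MetallicMean h p-prime R char-p A w w²≈Aw+1 using (Aw≈w²-1; w-unit) renaming (w*w⁻¹≈1 to wv≈1)
  open Powers R

  private
    p = suc (h ℕ.+ h)
    a = ι A
    v = w - a
    c = 1# + w * w
    W = w ^ h

  D : ℤ
  D = A ℤ.* A ℤ.+ + 4

  ι-D : ι D ≈ a * a + ι (+ 4)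
  ι-D = trans (ι-+ (A ℤ.* A) (+ 4)) (+-congʳ (ι-* A A))

  -- `w + v = w + 1/w = 2w - A` is the difference of `w` and its conjugate, hence a square root of
  -- the discriminant.
  d²≈D : (w + v) * (w + v) ≈ ι D
  d²≈D = begin
    (w + v) * (w + v)  ≈⟨ solve 2 (λ w a → (w :+ (w :- a)) :* (w :+ (w :- a)) := con (+ 4) :* (w :* w :- a :* w) :+ a :* a) refl w a ⟩
    ι (+ 4) * (w * w - a * w) + a * a  ≈⟨ +-congʳ (*-congˡ (+-congˡ (-‿cong Aw≈w²-1))) ⟩
    ι (+ 4) * (w * w - (w * w - 1#)) + a * a
      ≈⟨ solve 2 (λ u a → con (+ 4) :* (u :- (u :- con (+ 1))) :+ a :* a := a :* a :+ con (+ 4)) refl (w * w) a ⟩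
    a * a + ι (+ 4)  ≈⟨ ι-D ⟨
    ι D ∎

  unit-^ : ∀ {x} → Unit x → ∀ n → Unit (x ^ n)
  unit-^ u zero    = 1# , *-identityˡ 1#
  unit-^ u (suc n) = unit-* u (unit-^ u n)

  module Split (wᵖ≈w : w ^ p ≈ w) where

    w^2h≈1 : w ^ (h ℕ.+ h) ≈ 1#
    w^2h≈1 = fermat-unit w-unit wᵖ≈w

    WW≈1 : W * W ≈ 1#
    WW≈1 = trans (sym (^-homo-* w h h)) w^2h≈1

    W^2k≈1 : ∀ k → W ^ (k ℕ.+ k) ≈ 1#
    W^2k≈1 k = trans (^-double W k) (trans (^-congˡ k WW≈1) (1^n≈1 k))

    dᵖ≈d : (w + v) ^ p ≈ w + v
    dᵖ≈d = trans (frobenius w v) (+-cong wᵖ≈w (cancel w-unit (begin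
      w * v ^ p      ≈⟨ *-congʳ wᵖ≈w ⟨
      w ^ p * v ^ p  ≈⟨ ^-distrib-* w v p ⟨
      (w * v) ^ p    ≈⟨ trans (^-congˡ p wv≈1) (1^n≈1 p) ⟩
      1#             ≈⟨ wv≈1 ⟨
      w * v          ∎)))

    -- Since `c = w d`, its power is `cʰ = W Dᵏ`. The sign factors are trivial, `W` cancels, and
    -- `Dᵏ = dʰ` is its own inverse because Frobenius fixes `d`.
    T-even : ∀ k → h ≡ k ℕ.+ k → Unit (ι D) →
      (- 1#) ^ h * ((- w) ^ h) ^ h * (ι (T p A) * c ^ h) ≈ - w ^ h → ι (T p A) ≈ - ι D ^ k
    T-even k h≡2k D-unit eq = begin
      t                          ≈⟨ *-identityʳ t ⟨
      t * 1#                     ≈⟨ *-congˡ Dᵏ*Dᵏ≈1 ⟨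
      t * (ι D ^ k * ι D ^ k)    ≈⟨ *-assoc t _ _ ⟨
      t * ι D ^ k * ι D ^ k      ≈⟨ *-congʳ tDᵏ≈-1 ⟩
      - 1# * ι D ^ k             ≈⟨ -1*x≈-x _ ⟩
      - ι D ^ k                  ∎
      where
      t = ι (T p A)
      d = w + v
      even : ∀ x → x ^ h ≈ x ^ (k ℕ.+ k)
      even x = ^-congʳ x h≡2k
      dʰ≈Dᵏ : d ^ h ≈ ι D ^ k
      dʰ≈Dᵏ = trans (even d) (trans (^-double d k) (^-congˡ k d²≈D))
      cʰ≈WDᵏ : c ^ h ≈ W * ι D ^ k
      cʰ≈WDᵏ = begin
        c ^ h         ≈⟨ ^-congˡ h (trans (+-comm _ _) (trans (+-congˡ (sym wv≈1)) (sym (distribˡ w w v)))) ⟩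
        (w * d) ^ h   ≈⟨ ^-distrib-* w d h ⟩
        W * d ^ h     ≈⟨ *-congˡ dʰ≈Dᵏ ⟩
        W * ι D ^ k   ∎
      Dᵏ*Dᵏ≈1 : ι D ^ k * ι D ^ k ≈ 1#
      Dᵏ*Dᵏ≈1 = begin
        ι D ^ k * ι D ^ k  ≈⟨ *-cong dʰ≈Dᵏ dʰ≈Dᵏ ⟨
        d ^ h * d ^ h      ≈⟨ ^-homo-* d h h ⟨
        d ^ (h ℕ.+ h)      ≈⟨ fermat-unit (unit-factor (unit-cong (sym d²≈D) D-unit)) dᵖ≈d ⟩
        1#                 ∎
      tDᵏ≈-1 : t * ι D ^ k ≈ - 1#
      tDᵏ≈-1 = cancel (W , WW≈1) (begin
        W * (t * ι D ^ k)                  ≈⟨ solve 3 (λ w t d → w :* (t :* d) := con (+ 1) :* con (+ 1) :* (t :* (w :* d))) refl W t (ι D ^ k) ⟩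
        1# * 1# * (t * (W * ι D ^ k))      ≈⟨ *-cong (*-cong signs powers) (*-congˡ cʰ≈WDᵏ) ⟨
        (- 1#) ^ h * ((- w) ^ h) ^ h * (t * c ^ h)  ≈⟨ eq ⟩
        - W                                ≈⟨ solve 1 (λ w → :- w := w :* :- con (+ 1)) refl W ⟩
        W * - 1#                           ∎)
        where
        signs : (- 1#) ^ h ≈ 1#
        signs = trans (even _) (trans (neg-even 1# k) (1^n≈1 (k ℕ.+ k)))
        powers : ((- w) ^ h) ^ h ≈ 1#
        powers = trans (^-congˡ h (trans (even _) (trans (neg-even w k) (sym (even w))))) (trans (even W) (W^2k≈1 k))

    -- For odd `h` the sign factors are `-1` and `-W`. The `W` still cancels, but `cʰ` remains, to
    -- be found from the root of unity.
    T-odd : ∀ k → h ≡ suc (k ℕ.+ k) →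
      (- 1#) ^ h * ((- w) ^ h) ^ h * (ι (T p A) * c ^ h) ≈ - w ^ h → ι (T p A) * c ^ h ≈ - 1#
    T-odd k h≡1+2k eq = cancel (W , WW≈1) (begin
      W * x                            ≈⟨ solve 2 (λ w x → w :* x := :- con (+ 1) :* :- w :* x) refl W x ⟩
      - 1# * - W * x                   ≈⟨ *-congʳ (*-cong signs powers) ⟨
      (- 1#) ^ h * ((- w) ^ h) ^ h * x ≈⟨ eq ⟩
      - W                              ≈⟨ solve 1 (λ w → :- w := w :* :- con (+ 1)) refl W ⟩
      W * - 1#                         ∎)
      where
      x = ι (T p A) * c ^ h
      odd : ∀ y → (- y) ^ h ≈ - y ^ h
      odd y = trans (^-congʳ (- y) h≡1+2k) (trans (neg-odd y k) (-‿cong (sym (^-congʳ y h≡1+2k))))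
      signs : (- 1#) ^ h ≈ - 1#
      signs = trans (odd 1#) (-‿cong (1^n≈1 h))
      powers : ((- w) ^ h) ^ h ≈ - W
      powers = trans (^-congˡ h (odd w)) (trans (odd W) (-‿cong
        (trans (^-congʳ W h≡1+2k) (trans (*-congˡ (W^2k≈1 k)) (*-identityʳ W)))))

    T-nonvanishing≈0 : ((- w) ^ h) ^ h * ι (T p A) ≈ ((w * w) ^ h - 1#) ^ h → ι (T p A) ≈ 0#
    T-nonvanishing≈0 eq = unit⇒regular (unit-^ (unit-^ (unit-neg w-unit) h) h) (ι (T p A)) (begin
      ((- w) ^ h) ^ h * ι (T p A)  ≈⟨ eq ⟩
      ((w * w) ^ h - 1#) ^ h       ≈⟨ ^-congˡ h (trans (+-congʳ (trans ([x*x]^h w) w^2h≈1)) (-‿inverseʳ 1#)) ⟩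
      0# ^ h                       ≈⟨ 0^n≈0 1≤h ⟩
      0#                           ∎)

  module Inert (wᵖ≈a-w : w ^ p ≈ a - w) where

    private
      V = W * W

    -- The left side is `w^(p+1)`, that is `w` times its conjugate, and the constant term of
    -- `X² - AX - 1` is `-1`.
    uV≈-1 : w * w * V ≈ - 1#
    uV≈-1 = begin
      w * w * V            ≈⟨ *-assoc w w V ⟩
      w * (w * V)          ≈⟨ *-congˡ (*-congˡ (^-homo-* w h h)) ⟨
      w * w ^ p            ≈⟨ *-congˡ wᵖ≈a-w ⟩
      w * (a - w)          ≈⟨ solve 2 (λ w a → w :* (a :- w) := :- (w :* (w :- a))) refl w a ⟩
      - (w * v)            ≈⟨ -‿cong wv≈1 ⟩
      - 1#                 ∎

    V-1≈Vc : V - 1# ≈ V * c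
    V-1≈Vc = begin
      V - 1#             ≈⟨ +-congˡ uV≈-1 ⟨
      V + w * w * V      ≈⟨ solve 2 (λ u v → v :+ u :* v := v :* (con (+ 1) :+ u)) refl (w * w) V ⟩
      V * c              ∎

    V-unit : Unit V
    V-unit = unit-factor {V} {y = - (w * w)} (1# , (begin
      V * - (w * w) * 1#  ≈⟨ solve 2 (λ u v → v :* :- u :* con (+ 1) := :- (u :* v)) refl (w * w) V ⟩
      - (w * w * V)       ≈⟨ -‿cong uV≈-1 ⟩
      - - 1#              ≈⟨ -‿involutive 1# ⟩
      1#                  ∎))

    -- `(V - 1)² = V² c² = V (u V) d² = -V D`, so the `k`-th power has the factor `Vᵏ = Wʰ` that
    -- stands before `T`.
    T-even : ∀ k → h ≡ k ℕ.+ k → ((- w) ^ h) ^ h * ι (T p A) ≈ ((w * w) ^ h - 1#) ^ h →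
      ι (T p A) ≈ (- ι D) ^ k
    T-even k h≡2k eq = cancel (unit-^ V-unit k) (begin
      V ^ k * ι (T p A)                   ≈⟨ *-congʳ (trans (sym (^-double W k)) (sym (even W))) ⟩
      W ^ h * ι (T p A)                   ≈⟨ *-congʳ (^-congˡ h (trans (even _) (trans (neg-even w k) (sym (even w))))) ⟨
      ((- w) ^ h) ^ h * ι (T p A)         ≈⟨ eq ⟩
      ((w * w) ^ h - 1#) ^ h              ≈⟨ ^-congˡ h (+-congʳ (^-distrib-* w w h)) ⟩
      (V - 1#) ^ h                        ≈⟨ trans (even _) (^-double _ k) ⟩
      ((V - 1#) * (V - 1#)) ^ k           ≈⟨ ^-congˡ k square-V-1 ⟩
      (V * - ι D) ^ k                     ≈⟨ ^-distrib-* V _ k ⟩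
      V ^ k * (- ι D) ^ k                 ∎)
      where
      even : ∀ x → x ^ h ≈ x ^ (k ℕ.+ k)
      even x = ^-congʳ x h≡2k
      c≈wd : c ≈ w * (w + v)
      c≈wd = trans (+-comm _ _) (trans (+-congˡ (sym wv≈1)) (sym (distribˡ w w v)))
      square-V-1 : (V - 1#) * (V - 1#) ≈ V * - ι D
      square-V-1 = begin
        (V - 1#) * (V - 1#)                ≈⟨ *-cong V-1≈Vc V-1≈Vc ⟩
        V * c * (V * c)                    ≈⟨ *-cong (*-congˡ c≈wd) (*-congˡ c≈wd) ⟩
        V * (w * (w + v)) * (V * (w * (w + v)))
          ≈⟨ solve 3 (λ V w d → V :* (w :* d) :* (V :* (w :* d)) := V :* (w :* w :* V) :* (d :* d)) refl V w (w + v) ⟩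
        V * (w * w * V) * ((w + v) * (w + v))  ≈⟨ *-cong (*-congˡ uV≈-1) d²≈D ⟩
        V * - 1# * ι D                     ≈⟨ solve 2 (λ V d → V :* :- con (+ 1) :* d := V :* :- d) refl V (ι D) ⟩
        V * - ι D                          ∎

    T-odd : ∀ k → h ≡ suc (k ℕ.+ k) → ((- w) ^ h) ^ h * ι (T p A) ≈ ((w * w) ^ h - 1#) ^ h →
      ι (T p A) ≈ - (w * (- 1#) ^ k * c ^ h)
    T-odd k h≡1+2k eq = cancel (unit-^ (unit-^ w-unit h) h) (begin
      W ^ h * ι (T p A)                   ≈⟨ solve 2 (λ x t → x :* t := :- (:- x :* t)) refl (W ^ h) _ ⟩
      - (- (W ^ h) * ι (T p A))           ≈⟨ -‿cong (*-congʳ (trans (^-congˡ h (odd w)) (odd W))) ⟨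
      - (((- w) ^ h) ^ h * ι (T p A))     ≈⟨ -‿cong eq ⟩
      - ((w * w) ^ h - 1#) ^ h            ≈⟨ -‿cong (^-congˡ h (trans (+-congʳ (^-distrib-* w w h)) V-1≈Vc)) ⟩
      - (V * c) ^ h                       ≈⟨ -‿cong (trans (^-distrib-* V c h) (*-congʳ (^-distrib-* W W h))) ⟩
      - (W ^ h * W ^ h * c ^ h)           ≈⟨ -‿cong (trans (*-assoc _ _ _) (*-congˡ (*-congʳ W^h))) ⟩
      - (W ^ h * (w * (- 1#) ^ k * c ^ h))  ≈⟨ -‿distribʳ-* _ _ ⟩
      W ^ h * - (w * (- 1#) ^ k * c ^ h)  ∎)
      where
      odd : ∀ y → (- y) ^ h ≈ - y ^ h
      odd y = trans (^-congʳ (- y) h≡1+2k) (trans (neg-odd y k) (-‿cong (sym (^-congʳ y h≡1+2k))))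
      -- `Wʰ` is `w` to the power `h²`, and for `h = 2k + 1` this exponent is `1 + (p + 1) k`. With
      -- `w^(p+1) = -1` only `w (-1)ᵏ` is left.
      h*h : h ℕ.* h ≡ suc ((suc (suc (h ℕ.+ h))) ℕ.* k)
      h*h = ≡.trans (≡.cong (λ n → n ℕ.* n) h≡1+2k) (≡.trans
        (solveℕ k) (≡.cong (λ n → suc (suc (suc (n ℕ.+ n)) ℕ.* k)) (≡.sym h≡1+2k)))
        where
        open +-*-Solver renaming (solve to solve′; _:+_ to _⊕_; _:*_ to _⊗_; _:=_ to _⊜_; con to κ)
        solveℕ : ∀ k → suc (k ℕ.+ k) ℕ.* suc (k ℕ.+ k) ≡ suc (suc (suc (suc (k ℕ.+ k) ℕ.+ suc (k ℕ.+ k))) ℕ.* k)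
        solveℕ = solve′ 1 (λ k → (κ 1 ⊕ (k ⊕ k)) ⊗ (κ 1 ⊕ (k ⊕ k)) ⊜
          κ 1 ⊕ (κ 2 ⊕ ((κ 1 ⊕ (k ⊕ k)) ⊕ (κ 1 ⊕ (k ⊕ k)))) ⊗ k) ≡.refl
      w^[p+1]≈-1 : w ^ suc (suc (h ℕ.+ h)) ≈ - 1#
      w^[p+1]≈-1 = trans (*-congˡ (*-congˡ (^-homo-* w h h))) (trans (sym (*-assoc w w V)) uV≈-1)
      W^h : W ^ h ≈ w * (- 1#) ^ k
      W^h = begin
        W ^ h                                 ≈⟨ ^-assocʳ w h h ⟩
        w ^ (h ℕ.* h)                         ≡⟨ ≡.cong (w ^_) h*h ⟩
        w * w ^ (suc (suc (h ℕ.+ h)) ℕ.* k)   ≈⟨ *-congˡ (^-assocʳ w (suc (suc (h ℕ.+ h))) k) ⟨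
        w * (w ^ suc (suc (h ℕ.+ h))) ^ k     ≈⟨ *-congˡ (^-congˡ k w^[p+1]≈-1) ⟩
        w * (- 1#) ^ k                        ∎

-- Powers of tenth and eighth roots of unity

-- When t² = t + 1 (t² = 2), the roots of b² = tb - 1 are primitive tenth (eighth) roots of unity.
module RootsOfUnity (R : CommutativeRing 0ℓ 0ℓ)
  (t b : CommutativeRing.Carrier R) (b²≈tb-1 : IsNormOneRoot R t b) where

  open RingLemmas R
  open Powers R

  b^2 : b ^ 2 ≈ t * b - 1#
  b^2 = trans (*-congˡ (*-identityʳ b)) b²≈tb-1

  module Tenth (t²≈t+1 : t * t ≈ t + 1#) where

    b^3 : b ^ 3 ≈ t * b - t
    b^3 = begin
      b * b ^ 2              ≈⟨ *-congˡ b^2 ⟩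
      b * (t * b - 1#)       ≈⟨ solve 2 (λ b t → b :* (t :* b :- con (+ 1)) := t :* (b :* b) :- b) refl b t ⟩
      t * (b * b) - b        ≈⟨ +-congʳ (*-congˡ b²≈tb-1) ⟩
      t * (t * b - 1#) - b   ≈⟨ solve 2 (λ b t → t :* (t :* b :- con (+ 1)) :- b := t :* t :* b :- t :- b) refl b t ⟩
      t * t * b - t - b      ≈⟨ +-congʳ (+-congʳ (*-congʳ t²≈t+1)) ⟩
      (t + 1#) * b - t - b   ≈⟨ solve 2 (λ b t → (t :+ con (+ 1)) :* b :- t :- b := t :* b :- t) refl b t ⟩
      t * b - t              ∎

    b^4 : b ^ 4 ≈ b - t
    b^4 = begin
      b * b ^ 3              ≈⟨ *-congˡ b^3 ⟩
      b * (t * b - t)        ≈⟨ solve 2 (λ b t → b :* (t :* b :- t) := t :* (b :* b) :- t :* b) refl b t ⟩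
      t * (b * b) - t * b    ≈⟨ +-congʳ (*-congˡ b²≈tb-1) ⟩
      t * (t * b - 1#) - t * b  ≈⟨ solve 2 (λ b t → t :* (t :* b :- con (+ 1)) :- t :* b := t :* t :* b :- t :- t :* b) refl b t ⟩
      t * t * b - t - t * b  ≈⟨ +-congʳ (+-congʳ (*-congʳ t²≈t+1)) ⟩
      (t + 1#) * b - t - t * b  ≈⟨ solve 2 (λ b t → (t :+ con (+ 1)) :* b :- t :- t :* b := b :- t) refl b t ⟩
      b - t                  ∎

    b^5 : b ^ 5 ≈ - 1#
    b^5 = begin
      b * b ^ 4              ≈⟨ *-congˡ b^4 ⟩
      b * (b - t)            ≈⟨ solve 2 (λ b t → b :* (b :- t) := b :* b :- t :* b) refl b t ⟩
      b * b - t * b          ≈⟨ +-congʳ b²≈tb-1 ⟩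
      t * b - 1# - t * b     ≈⟨ solve 1 (λ x → x :- con (+ 1) :- x := :- con (+ 1)) refl (t * b) ⟩
      - 1#                   ∎

    b^[5+n] : ∀ n → b ^ (5 ℕ.+ n) ≈ - b ^ n
    b^[5+n] n = trans (^-homo-* b 5 n) (trans (*-congʳ b^5) (-1*x≈-x _))

    b^10 : b ^ 10 ≈ 1#
    b^10 = trans (b^[5+n] 5) (trans (-‿cong b^5) (-‿involutive 1#))

  module Eighth (t²≈2 : t * t ≈ ι (+ 2)) where

    b^3 : b ^ 3 ≈ b - t
    b^3 = begin
      b * b ^ 2              ≈⟨ *-congˡ b^2 ⟩
      b * (t * b - 1#)       ≈⟨ solve 2 (λ b t → b :* (t :* b :- con (+ 1)) := t :* (b :* b) :- b) refl b t ⟩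
      t * (b * b) - b        ≈⟨ +-congʳ (*-congˡ b²≈tb-1) ⟩
      t * (t * b - 1#) - b   ≈⟨ solve 2 (λ b t → t :* (t :* b :- con (+ 1)) :- b := t :* t :* b :- t :- b) refl b t ⟩
      t * t * b - t - b      ≈⟨ +-congʳ (+-congʳ (*-congʳ t²≈2)) ⟩
      ι (+ 2) * b - t - b    ≈⟨ solve 2 (λ b t → con (+ 2) :* b :- t :- b := b :- t) refl b t ⟩
      b - t                  ∎

    b^4 : b ^ 4 ≈ - 1#
    b^4 = begin
      b * b ^ 3              ≈⟨ *-congˡ b^3 ⟩
      b * (b - t)            ≈⟨ solve 2 (λ b t → b :* (b :- t) := b :* b :- t :* b) refl b t ⟩
      b * b - t * b          ≈⟨ +-congʳ b²≈tb-1 ⟩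
      t * b - 1# - t * b     ≈⟨ solve 1 (λ x → x :- con (+ 1) :- x := :- con (+ 1)) refl (t * b) ⟩
      - 1#                   ∎

    b^[4+n] : ∀ n → b ^ (4 ℕ.+ n) ≈ - b ^ n
    b^[4+n] n = trans (^-homo-* b 4 n) (trans (*-congʳ b^4) (-1*x≈-x _))

    b^8 : b ^ 8 ≈ 1#
    b^8 = trans (b^[4+n] 4) (trans (-‿cong b^4) (-‿involutive 1#))

module Cyclotomic (h : ℕ) (p-prime : Prime (suc (h ℕ.+ h))) (R : CommutativeRing 0ℓ 0ℓ)
  (char-p : HasCharacteristic R (suc (h ℕ.+ h))) (t : CommutativeRing.Carrier R) where

  open RingLemmas R
  open QuadraticExtension R t (- 1#)
  open Characteristic h p-prime R char-p
  open Powers R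
  private
    module E = RingLemmas extension
    module Eᶜ = Characteristic h p-prime extension
      (E.trans (embed-ι (+ suc (h ℕ.+ h))) (char-p , refl))
    module Eᵖ = Powers extension
    p = suc (h ℕ.+ h)
    τ = embed t
    θ̄ = τ E.- θ

  α : Carrier
  α = ι (+ 2) + t

  private
    θ² : θ E.* θ E.≈ τ E.* θ E.- E.1#
    θ² = E.trans θ²≈aθ+b (E.+-congˡ {τ E.* θ} (refl , sym -0#≈0#))

    θ̄² : θ̄ E.* θ̄ E.≈ τ E.* θ̄ E.- E.1#
    θ̄² = E.trans (E.solve 2 (λ t b → (t E.:- b) E.:* (t E.:- b) E.:= t E.:* t E.:- t E.:* b E.:- t E.:* b E.:+ b E.:* b) E.refl τ θ)
      (E.trans (E.+-congˡ {τ E.* τ E.- τ E.* θ E.- τ E.* θ} θ²)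
        (E.solve 2 (λ t b → t E.:* t E.:- t E.:* b E.:- t E.:* b E.:+ (t E.:* b E.:- E.con (+ 1)) E.:= t E.:* (t E.:- b) E.:- E.con (+ 1)) E.refl τ θ))

    module θ = RootsOfUnity extension τ θ θ²
    module θ̄ = RootsOfUnity extension τ θ̄ θ̄²

    embed-scale : ∀ a x y → embed a E.* (x , y) E.≈ (a * x , a * y)
    embed-scale a x y =
      solve 3 (λ a x y → a :* x :+ :- con (+ 1) :* (con (+ 0) :* y) := a :* x) refl a x y ,
      solve 4 (λ a x y t → a :* y :+ con (+ 0) :* x :+ t :* (con (+ 0) :* y) := a :* y) refl a x y t

    τθ : τ E.* θ E.≈ (0# , t)
    τθ = E.trans (embed-scale t 0# 1#) (zeroʳ t , *-identityʳ t)

    embed-α : embed α E.≈ E.ι (+ 2) E.+ τ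
    embed-α = E.trans (refl , sym (+-identityˡ 0#)) (E.+-congʳ {τ} (E.sym (embed-ι (+ 2))))

  -- `θ̄ = t - θ` is the other root, so this is Frobenius for `t = θ + θ̄`. The residue of `p`
  -- modulo the order of the roots then determines `tᵖ`.
  trace : embed (t ^ p) E.≈ θ E.^ p E.+ θ̄ E.^ p
  trace = E.trans (embed-^ t p) (E.trans
    (E.^-congˡ p (E.solve 2 (λ t b → t E.:= b E.:+ (t E.:- b)) E.refl τ θ))
    (Eᶜ.frobenius θ θ̄))

  -- αθ = (1 + θ)², so this is Frobenius for 1 + θ.
  αʰ : embed (α ^ h) E.* (θ E.^ h E.* (E.1# E.+ θ)) E.≈ E.1# E.+ θ E.^ p
  αʰ = E.begin
    embed (α ^ h) E.* (θ E.^ h E.* x)      E.≈⟨ E.*-congʳ (embed-^ α h) ⟩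
    embed α E.^ h E.* (θ E.^ h E.* x)      E.≈⟨ E.*-assoc (embed α E.^ h) (θ E.^ h) x ⟨
    embed α E.^ h E.* θ E.^ h E.* x        E.≈⟨ E.*-congʳ (E.^-distrib-* (embed α) θ h) ⟨
    (embed α E.* θ) E.^ h E.* x            E.≈⟨ E.*-congʳ (E.^-congˡ h αθ) ⟩
    (x E.* x) E.^ h E.* x                  E.≈⟨ E.*-comm _ x ⟩
    x E.* (x E.* x) E.^ h                  E.≈⟨ E.*-congˡ (Eᵖ.^-double x h) ⟨
    x E.^ p                                E.≈⟨ Eᶜ.frobenius E.1# θ ⟩
    E.1# E.^ p E.+ θ E.^ p                 E.≈⟨ E.+-congʳ (E.1^n≈1 p) ⟩
    E.1# E.+ θ E.^ p                       E.∎
    where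
    x = E.1# E.+ θ
    αθ : embed α E.* θ E.≈ x E.* x
    αθ = E.begin
      embed α E.* θ                                E.≈⟨ E.*-congʳ embed-α ⟩
      (E.ι (+ 2) E.+ τ) E.* θ
        E.≈⟨ E.solve 2 (λ t b → (E.con (+ 2) E.:+ t) E.:* b E.:= E.con (+ 1) E.:+ E.con (+ 2) E.:* b E.:+ (t E.:* b E.:- E.con (+ 1))) E.refl τ θ ⟩
      E.1# E.+ E.ι (+ 2) E.* θ E.+ (τ E.* θ E.- E.1#)  E.≈⟨ E.+-congˡ {E.1# E.+ E.ι (+ 2) E.* θ} θ² ⟨
      E.1# E.+ E.ι (+ 2) E.* θ E.+ θ E.* θ
        E.≈⟨ E.solve 1 (λ b → E.con (+ 1) E.:+ E.con (+ 2) E.:* b E.:+ b E.:* b E.:= (E.con (+ 1) E.:+ b) E.:* (E.con (+ 1) E.:+ b)) E.refl θ ⟩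
      x E.* x                                      E.∎

  -- Both sides of `αʰ` are expanded in the basis `1 , θ`. Each coordinate is then an equation for
  -- `α ^ h` in `R`, and the simpler one can be chosen in each residue class.
  αʰ-components : ∀ {x y x′ y′} → θ E.^ h E.* (E.1# E.+ θ) E.≈ (x , y) → E.1# E.+ θ E.^ p E.≈ (x′ , y′) →
    α ^ h * x ≈ x′ × α ^ h * y ≈ y′
  αʰ-components {x} {y} {x′} {y′} eq eq′ = proj₁ both , proj₂ both
    where
    both : (α ^ h * x , α ^ h * y) E.≈ (x′ , y′)
    both = E.trans (E.sym (embed-scale (α ^ h) x y)) (E.trans (E.*-congˡ {embed (α ^ h)} (E.sym eq)) (E.trans αʰ eq′))

  module Tenth (t²≈t+1 : t * t ≈ t + 1#) where

    private
      τ² : τ E.* τ E.≈ τ E.+ E.1#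
      τ² = E.trans (E.sym (embed-* t t)) (t²≈t+1 , sym (+-identityˡ 0#))
      module θ¹⁰ = θ.Tenth τ²
      module θ̄¹⁰ = θ̄.Tenth τ²

      power-p : ∀ r m → p ≡ r ℕ.+ m ℕ.* 10 → θ E.^ p E.≈ θ E.^ r
      power-p r m eq = E.trans (E.reflexive (≡.cong (θ E.^_) eq)) (Eᵖ.^-period θ 10 θ¹⁰.b^10 r m)

      power-p̄ : ∀ r m → p ≡ r ℕ.+ m ℕ.* 10 → θ̄ E.^ p E.≈ θ̄ E.^ r
      power-p̄ r m eq = E.trans (E.reflexive (≡.cong (θ̄ E.^_) eq)) (Eᵖ.^-period θ̄ 10 θ̄¹⁰.b^10 r m)

      power-h : ∀ s k → h ≡ s ℕ.+ k ℕ.* 10 → θ E.^ h E.≈ θ E.^ s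
      power-h s k eq = E.trans (E.reflexive (≡.cong (θ E.^_) eq)) (Eᵖ.^-period θ 10 θ¹⁰.b^10 s k)

      trace-r : ∀ r m → p ≡ r ℕ.+ m ℕ.* 10 → embed (t ^ p) E.≈ θ E.^ r E.+ θ̄ E.^ r
      trace-r r m eq = E.trans trace (E.+-cong (power-p r m eq) (power-p̄ r m eq))

    t^p-1 : ∀ m → p ≡ 1 ℕ.+ m ℕ.* 10 → t ^ p ≈ t
    t^p-1 m eq = proj₁ (E.trans (trace-r 1 m eq) (E.solve 2 (λ t b → b E.:* E.con (+ 1) E.:+ (t E.:- b) E.:* E.con (+ 1) E.:= t) E.refl τ θ))

    t^p-9 : ∀ m → p ≡ 9 ℕ.+ m ℕ.* 10 → t ^ p ≈ t
    t^p-9 m eq = proj₁ (E.trans (trace-r 9 m eq) (E.trans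
      (E.+-cong (E.trans (θ¹⁰.b^[5+n] 4) (E.-‿cong θ¹⁰.b^4)) (E.trans (θ̄¹⁰.b^[5+n] 4) (E.-‿cong θ̄¹⁰.b^4)))
      (E.solve 2 (λ t b → E.:- (b E.:- t) E.:+ E.:- (t E.:- b E.:- t) E.:= t) E.refl τ θ)))

    t^p-3 : ∀ m → p ≡ 3 ℕ.+ m ℕ.* 10 → t ^ p ≈ 1# - t
    t^p-3 m eq = proj₁ (E.trans (trace-r 3 m eq) (E.trans
      (E.+-cong θ¹⁰.b^3 θ̄¹⁰.b^3)
      (E.trans (E.solve 2 (λ t b → t E.:* b E.:- t E.:+ (t E.:* (t E.:- b) E.:- t) E.:= t E.:* t E.:- t E.:- t) E.refl τ θ)
        (E.trans (E.+-congʳ {E.- τ} (E.+-congʳ {E.- τ} τ²))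
          (E.solve 1 (λ t → t E.:+ E.con (+ 1) E.:- t E.:- t E.:= E.con (+ 1) E.:- t) E.refl τ)))))

    t^p-7 : ∀ m → p ≡ 7 ℕ.+ m ℕ.* 10 → t ^ p ≈ 1# - t
    t^p-7 m eq = proj₁ (E.trans (trace-r 7 m eq) (E.trans
      (E.+-cong (E.trans (θ¹⁰.b^[5+n] 2) (E.-‿cong θ.b^2)) (E.trans (θ̄¹⁰.b^[5+n] 2) (E.-‿cong θ̄.b^2)))
      (E.trans (E.solve 2 (λ t b → E.:- (t E.:* b E.:- E.con (+ 1)) E.:+ E.:- (t E.:* (t E.:- b) E.:- E.con (+ 1)) E.:= E.con (+ 2) E.:- t E.:* t) E.refl τ θ)
        (E.trans (E.+-congˡ {E.ι (+ 2)} (E.-‿cong τ²))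
          (E.solve 1 (λ t → E.con (+ 2) E.:- (t E.:+ E.con (+ 1)) E.:= E.con (+ 1) E.:- t) E.refl τ)))))

    αʰ-1 : ∀ k m → h ≡ 1 ℕ.+ k ℕ.* 10 → p ≡ 3 ℕ.+ m ℕ.* 10 → α ^ h ≈ t - 1#
    αʰ-1 k m eq eq′ = trans (solve 1 (λ a → a := :- (a :* :- con (+ 1))) refl (α ^ h))
      (trans (-‿cong (proj₁ (αʰ-components lhs rhs))) (solve 1 (λ t → :- (con (+ 1) :- t) := t :- con (+ 1)) refl t))
      where
      lhs : θ E.^ h E.* (E.1# E.+ θ) E.≈ (- 1# , 1# + t)
      lhs = E.trans (E.*-congʳ (power-h 1 k eq))
        (E.trans (E.solve 1 (λ b → b E.:* E.con (+ 1) E.:* (E.con (+ 1) E.:+ b) E.:= b E.:+ b E.:* b) E.refl θ)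
        (E.trans (E.+-congˡ {θ} (E.trans θ² (E.+-congʳ {E.- E.1#} τθ)))
        ( solve 0 (con (+ 0) :+ (con (+ 0) :- con (+ 1)) := :- con (+ 1)) refl
        , solve 1 (λ t → con (+ 1) :+ (t :- con (+ 0)) := con (+ 1) :+ t) refl t)))
      rhs : E.1# E.+ θ E.^ p E.≈ (1# - t , t)
      rhs = E.trans (E.+-congˡ {E.1#} (E.trans (power-p 3 m eq′) (E.trans θ¹⁰.b^3 (E.+-congʳ {E.- τ} τθ))))
        ( solve 1 (λ t → con (+ 1) :+ (con (+ 0) :- t) := con (+ 1) :- t) refl t
        , solve 1 (λ t → con (+ 0) :+ (t :- con (+ 0)) := t) refl t)

    αʰ-3 : ∀ k m → h ≡ 3 ℕ.+ k ℕ.* 10 → p ≡ 7 ℕ.+ m ℕ.* 10 → α ^ h ≈ 1# - t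
    αʰ-3 k m eq eq′ = begin
      -- The second coordinate reads `αʰ (1 + t) = -t`, and `(1 + t)(2 - t) = 1` follows from
      -- `t² = t + 1`.
      α ^ h                                   ≈⟨ solve 2 (λ a t → a := a :* (con (+ 1) :+ t :- (t :+ con (+ 1)) :+ con (+ 1))) refl (α ^ h) t ⟩
      α ^ h * (1# + t - (t + 1#) + 1#)        ≈⟨ *-congˡ (+-congʳ (+-congˡ (-‿cong t²≈t+1))) ⟨
      α ^ h * (1# + t - t * t + 1#)           ≈⟨ solve 2 (λ a t → a :* (con (+ 1) :+ t :- t :* t :+ con (+ 1)) := a :* (con (+ 1) :+ t) :* (con (+ 2) :- t)) refl (α ^ h) t ⟩
      α ^ h * (1# + t) * (ι (+ 2) - t)        ≈⟨ *-congʳ (proj₂ (αʰ-components lhs rhs)) ⟩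
      - t * (ι (+ 2) - t)                     ≈⟨ solve 1 (λ t → :- t :* (con (+ 2) :- t) := t :* t :- con (+ 2) :* t) refl t ⟩
      t * t - ι (+ 2) * t                     ≈⟨ +-congʳ t²≈t+1 ⟩
      t + 1# - ι (+ 2) * t                    ≈⟨ solve 1 (λ t → t :+ con (+ 1) :- con (+ 2) :* t := con (+ 1) :- t) refl t ⟩
      1# - t                                  ∎
      where
      lhs : θ E.^ h E.* (E.1# E.+ θ) E.≈ (- t - t , 1# + t)
      lhs = E.trans (E.*-congʳ (power-h 3 k eq))
        (E.trans (E.solve 2 (λ b c → c E.:* (E.con (+ 1) E.:+ b) E.:= c E.:+ b E.:* c) E.refl θ (θ E.^ 3))
        (E.trans (E.+-cong (E.trans θ¹⁰.b^3 (E.+-congʳ {E.- τ} τθ)) θ¹⁰.b^4)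
        ( solve 1 (λ t → con (+ 0) :- t :+ (con (+ 0) :- t) := :- t :- t) refl t
        , solve 1 (λ t → t :- con (+ 0) :+ (con (+ 1) :- con (+ 0)) := con (+ 1) :+ t) refl t)))
      rhs : E.1# E.+ θ E.^ p E.≈ (ι (+ 2) , - t)
      rhs = E.trans (E.+-congˡ {E.1#} (E.trans (power-p 7 m eq′) (E.trans (θ¹⁰.b^[5+n] 2)
              (E.-‿cong (E.trans θ.b^2 (E.+-congʳ {E.- E.1#} τθ))))))
        ( solve 0 (con (+ 1) :- (con (+ 0) :- con (+ 1)) := con (+ 2)) refl
        , solve 1 (λ t → con (+ 0) :- (t :- con (+ 0)) := :- t) refl t)

    αʰ-5 : ∀ k m → h ≡ 5 ℕ.+ k ℕ.* 10 → p ≡ 1 ℕ.+ m ℕ.* 10 → α ^ h ≈ - 1#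
    αʰ-5 k m eq eq′ = trans (solve 1 (λ a → a := :- (a :* :- con (+ 1))) refl (α ^ h))
      (-‿cong (proj₁ (αʰ-components lhs rhs)))
      where
      lhs : θ E.^ h E.* (E.1# E.+ θ) E.≈ (- 1# , - 1#)
      lhs = E.trans (E.*-congʳ (E.trans (power-h 5 k eq) θ¹⁰.b^5))
        (E.trans (E.-1*x≈-x (E.1# E.+ θ)) (-‿cong (+-identityʳ 1#) , -‿cong (+-identityˡ 1#)))
      rhs : E.1# E.+ θ E.^ p E.≈ (1# , 1#)
      rhs = E.trans (E.+-congˡ {E.1#} (E.trans (power-p 1 m eq′) (E.*-identityʳ θ))) (+-identityʳ 1# , +-identityˡ 1#)

    αʰ-9 : ∀ k m → h ≡ 9 ℕ.+ k ℕ.* 10 → p ≡ 9 ℕ.+ m ℕ.* 10 → α ^ h ≈ 1#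
    αʰ-9 k m eq eq′ = trans (solve 1 (λ a → a := :- (a :* :- con (+ 1))) refl (α ^ h))
      (trans (-‿cong (proj₂ (αʰ-components lhs rhs))) (-‿involutive 1#))
      where
      θ^9 : θ E.^ 9 E.≈ (t , - 1#)
      θ^9 = E.trans (θ¹⁰.b^[5+n] 4) (E.trans (E.-‿cong θ¹⁰.b^4)
        ( solve 1 (λ t → :- (con (+ 0) :- t) := t) refl t
        , solve 0 (:- (con (+ 1) :- con (+ 0)) := :- con (+ 1)) refl))
      lhs : θ E.^ h E.* (E.1# E.+ θ) E.≈ (t + 1# , - 1#)
      lhs = E.trans (E.*-congʳ (power-h 9 k eq))
        (E.trans (E.solve 2 (λ b c → c E.:* (E.con (+ 1) E.:+ b) E.:= c E.:+ b E.:* c) E.refl θ (θ E.^ 9))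
        (E.trans (E.+-cong θ^9 θ¹⁰.b^10) (refl , +-identityʳ _)))
      rhs : E.1# E.+ θ E.^ p E.≈ (1# + t , - 1#)
      rhs = E.trans (E.+-congˡ {E.1#} (E.trans (power-p 9 m eq′) θ^9)) (refl , +-identityˡ _)

  module Eighth (t²≈2 : t * t ≈ ι (+ 2)) where

    private
      τ² : τ E.* τ E.≈ E.ι (+ 2)
      τ² = E.trans (E.sym (embed-* t t)) (E.trans (t²≈2 , refl) (E.sym (embed-ι (+ 2))))
      module θ⁸ = θ.Eighth τ²
      module θ̄⁸ = θ̄.Eighth τ²

      power-p : ∀ r m → p ≡ r ℕ.+ m ℕ.* 8 → θ E.^ p E.≈ θ E.^ r
      power-p r m eq = E.trans (E.reflexive (≡.cong (θ E.^_) eq)) (Eᵖ.^-period θ 8 θ⁸.b^8 r m)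

      power-p̄ : ∀ r m → p ≡ r ℕ.+ m ℕ.* 8 → θ̄ E.^ p E.≈ θ̄ E.^ r
      power-p̄ r m eq = E.trans (E.reflexive (≡.cong (θ̄ E.^_) eq)) (Eᵖ.^-period θ̄ 8 θ̄⁸.b^8 r m)

      -- The class of `p` mod 8 fixes `h` only mod 4, half the order of `θ`; `θ⁴ = -1` turns the
      -- rest into the sign `(-1)ᵏ`, the source of the sign in the theorem for `p` congruent to 3 or
      -- 7.
      power-h : ∀ s k → h ≡ s ℕ.+ k ℕ.* 4 → θ E.^ h E.≈ embed ((- 1#) ^ k) E.* θ E.^ s
      power-h s k eq = E.trans (E.reflexive (≡.cong (θ E.^_) (≡.trans eq (≡.cong (s ℕ.+_) (ℕₚ.*-comm k 4)))))
        (E.trans (E.^-homo-* θ s (4 ℕ.* k)) (E.trans (E.*-comm (θ E.^ s) _) (E.*-congʳ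
          (E.trans (E.sym (E.^-assocʳ θ 4 k)) (E.trans (E.^-congˡ k (E.trans θ⁸.b^4 (refl , -0#≈0#))) (E.sym (embed-^ (- 1#) k)))))))

      trace-r : ∀ r m → p ≡ r ℕ.+ m ℕ.* 8 → embed (t ^ p) E.≈ θ E.^ r E.+ θ̄ E.^ r
      trace-r r m eq = E.trans trace (E.+-cong (power-p r m eq) (power-p̄ r m eq))

      lhs-scale : ∀ s k {x y} → h ≡ s ℕ.+ k ℕ.* 4 → θ E.^ s E.* (E.1# E.+ θ) E.≈ (x , y) →
        θ E.^ h E.* (E.1# E.+ θ) E.≈ ((- 1#) ^ k * x , (- 1#) ^ k * y)
      lhs-scale s k {x} {y} eq value = E.trans (E.*-congʳ (power-h s k eq))
        (E.trans (E.*-assoc (embed ((- 1#) ^ k)) (θ E.^ s) (E.1# E.+ θ))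
          (E.trans (E.*-congˡ {embed ((- 1#) ^ k)} value) (embed-scale ((- 1#) ^ k) x y)))

    t^p-1 : ∀ m → p ≡ 1 ℕ.+ m ℕ.* 8 → t ^ p ≈ t
    t^p-1 m eq = proj₁ (E.trans (trace-r 1 m eq) (E.solve 2 (λ t b → b E.:* E.con (+ 1) E.:+ (t E.:- b) E.:* E.con (+ 1) E.:= t) E.refl τ θ))

    t^p-7 : ∀ m → p ≡ 7 ℕ.+ m ℕ.* 8 → t ^ p ≈ t
    t^p-7 m eq = proj₁ (E.trans (trace-r 7 m eq) (E.trans
      (E.+-cong (E.trans (θ⁸.b^[4+n] 3) (E.-‿cong θ⁸.b^3)) (E.trans (θ̄⁸.b^[4+n] 3) (E.-‿cong θ̄⁸.b^3)))
      (E.solve 2 (λ t b → E.:- (b E.:- t) E.:+ E.:- (t E.:- b E.:- t) E.:= t) E.refl τ θ)))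

    t^p-3 : ∀ m → p ≡ 3 ℕ.+ m ℕ.* 8 → t ^ p ≈ - t
    t^p-3 m eq = proj₁ (E.trans (trace-r 3 m eq) (E.trans (E.+-cong θ⁸.b^3 θ̄⁸.b^3)
      (E.solve 2 (λ t b → b E.:- t E.:+ (t E.:- b E.:- t) E.:= E.:- t) E.refl τ θ)))

    t^p-5 : ∀ m → p ≡ 5 ℕ.+ m ℕ.* 8 → t ^ p ≈ - t
    t^p-5 m eq = proj₁ (E.trans (trace-r 5 m eq) (E.trans (E.+-cong (θ⁸.b^[4+n] 1) (θ̄⁸.b^[4+n] 1))
      (E.solve 2 (λ t b → E.:- (b E.:* E.con (+ 1)) E.:+ E.:- ((t E.:- b) E.:* E.con (+ 1)) E.:= E.:- t) E.refl τ θ)))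

    αʰ-1 : ∀ k m → h ≡ 1 ℕ.+ k ℕ.* 4 → p ≡ 3 ℕ.+ m ℕ.* 8 → α ^ h * (- 1#) ^ k ≈ t - 1#
    αʰ-1 k m eq eq′ = trans (solve 2 (λ a s → a :* s := :- (a :* (s :* :- con (+ 1)))) refl (α ^ h) ((- 1#) ^ k))
      (trans (-‿cong (proj₁ (αʰ-components (lhs-scale 1 k eq lhs) rhs))) (solve 1 (λ t → :- (con (+ 1) :- t) := t :- con (+ 1)) refl t))
      where
      lhs : θ E.^ 1 E.* (E.1# E.+ θ) E.≈ (- 1# , 1# + t)
      lhs = E.trans (E.solve 1 (λ b → b E.:* E.con (+ 1) E.:* (E.con (+ 1) E.:+ b) E.:= b E.:+ b E.:* b) E.refl θ)
        (E.trans (E.+-congˡ {θ} (E.trans θ² (E.+-congʳ {E.- E.1#} τθ)))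
        ( solve 0 (con (+ 0) :+ (con (+ 0) :- con (+ 1)) := :- con (+ 1)) refl
        , solve 1 (λ t → con (+ 1) :+ (t :- con (+ 0)) := con (+ 1) :+ t) refl t))
      rhs : E.1# E.+ θ E.^ p E.≈ (1# - t , 1#)
      rhs = E.trans (E.+-congˡ {E.1#} (E.trans (power-p 3 m eq′) θ⁸.b^3))
        ( solve 1 (λ t → con (+ 1) :+ (con (+ 0) :- t) := con (+ 1) :- t) refl t
        , solve 0 (con (+ 0) :+ (con (+ 1) :- con (+ 0)) := con (+ 1)) refl)

    αʰ-3 : ∀ k m → h ≡ 3 ℕ.+ k ℕ.* 4 → p ≡ 7 ℕ.+ m ℕ.* 8 → α ^ h * (- 1#) ^ k ≈ - 1#
    αʰ-3 k m eq eq′ = trans (*-congˡ (sym (*-identityʳ _))) (proj₂ (αʰ-components (lhs-scale 3 k eq lhs) rhs))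
      where
      lhs : θ E.^ 3 E.* (E.1# E.+ θ) E.≈ (- t - 1# , 1#)
      lhs = E.trans (E.solve 2 (λ b c → c E.:* (E.con (+ 1) E.:+ b) E.:= c E.:+ b E.:* c) E.refl θ (θ E.^ 3))
        (E.trans (E.+-cong θ⁸.b^3 θ⁸.b^4)
        ( solve 1 (λ t → con (+ 0) :- t :- con (+ 1) := :- t :- con (+ 1)) refl t
        , solve 0 (con (+ 1) :- con (+ 0) :- con (+ 0) := con (+ 1)) refl))
      rhs : E.1# E.+ θ E.^ p E.≈ (1# + t , - 1#)
      rhs = E.trans (E.+-congˡ {E.1#} (E.trans (power-p 7 m eq′) (E.trans (θ⁸.b^[4+n] 3) (E.-‿cong θ⁸.b^3))))
        ( solve 1 (λ t → con (+ 1) :- (con (+ 0) :- t) := con (+ 1) :+ t) refl t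
        , solve 0 (con (+ 0) :- (con (+ 1) :- con (+ 0)) := :- con (+ 1)) refl)

    -- As `2 = t²`, the power `2ʰ` is `t^(p-1)`, the factor by which Frobenius multiplies `t`.
    2^h : ∀ {x} → Unit (ι (+ 2)) → t ^ p ≈ x * t → ι (+ 2) ^ h ≈ x
    2^h {x} 2-unit tᵖ≈xt = cancel 2-unit (begin
      ι (+ 2) * ι (+ 2) ^ h      ≈⟨ *-cong t²≈2 (trans (^-double t h) (^-congˡ h t²≈2)) ⟨
      t * t * t ^ (h ℕ.+ h)      ≈⟨ *-assoc t t _ ⟩
      t * t ^ p                  ≈⟨ *-congˡ tᵖ≈xt ⟩
      t * (x * t)                ≈⟨ solve 2 (λ t x → t :* (x :* t) := t :* t :* x) refl t x ⟩
      t * t * x                  ≈⟨ *-congʳ t²≈2 ⟩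
      ι (+ 2) * x                ∎)

-- Split and inert primes

module Dichotomy (h : ℕ) (p-prime : Prime (suc (h ℕ.+ h))) (A : ℤ)
  (p∤A : ¬ + suc (h ℕ.+ h) ∣ A) (p∤D : ¬ + suc (h ℕ.+ h) ∣ A ℤ.* A ℤ.+ + 4) where

  private
    p = suc (h ℕ.+ h)
    D = A ℤ.* A ℤ.+ + 4

  module _ (R : CommutativeRing 0ℓ 0ℓ) where
    open RingLemmas R

    Fixed Conjugated : Carrier → Set
    Fixed w      = w ^ p ≈ w
    Conjugated w = w ^ p ≈ ι A - w

    HasValue : ℤ → Set
    HasValue v = ι (T p A) ≈ ι v

    Vanishing : Carrier → Set
    Vanishing w = (- 1#) ^ h * ((- w) ^ h) ^ h * (ι (T p A) * (1# + w * w) ^ h) ≈ - w ^ h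

    Nonvanishing : Carrier → Set
    Nonvanishing w = ((- w) ^ h) ^ h * ι (T p A) ≈ ((w * w) ^ h - 1#) ^ h

  -- The law ranges over all rings because it is applied in two of them: in the extension to show
  -- that the form has a zero, and in 𝔽ₚ to evaluate `T`.
  SplitLaw : Set₁
  SplitLaw = ∀ R → HasCharacteristic R p → ∀ w → IsMetallicMean R A w → Fixed R w

  InertLaw : Set₁
  InertLaw = ∀ R → HasCharacteristic R p → ∀ w → IsMetallicMean R A w → Conjugated R w

  private
    ℤ/p = integersMod p
    module Z = RingLemmas ℤ/p

    ι≋ : ∀ i → Z.ι i Z.≈ i
    ι≋ i = Z.reflexive (ι-mod p i)

    reflect : ∀ i j → Z.ι i Z.≈ Z.ι j → i ≡ j [mod p ]
    reflect i j eq = _≋_.difference (Z.trans (Z.sym (ι≋ i)) (Z.trans eq (ι≋ j)))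

    multiple≋0 : ∀ {i} → + p ∣ i → i Z.≈ + 0
    multiple≋0 {i} (divides q eq) = congruent (divides q (≡.trans (ℤₚ.+-identityʳ i) eq))

    ≋0⇒multiple : ∀ {i} → i Z.≈ + 0 → + p ∣ i
    ≋0⇒multiple {i} (congruent (divides q eq)) = divides q (≡.trans (≡.sym (ℤₚ.+-identityʳ i)) eq)

    char-ℤ/p : Z.ι (+ p) Z.≈ + 0
    char-ℤ/p = Z.trans (ι≋ (+ p)) (multiple≋0 ℤᵈ.∣-refl)

    module C = Characteristic h p-prime ℤ/p char-ℤ/p

    1≢0 : ¬ + 1 Z.≈ + 0
    1≢0 eq with ℕᵈ.∣1⇒≡1 (∣⇒∣ᵤ (≋0⇒multiple eq))
    ... | p≡1 = ¬prime[1] (≡.subst Prime p≡1 p-prime)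

    field? : ∀ z → z Z.≈ + 0 ⊎ C.Unit z
    field? z = go (+ p ∣? z)
      where
      go : Dec (+ p ∣ z) → z Z.≈ + 0 ⊎ C.Unit z
      go (yes p∣z) = inj₁ (multiple≋0 p∣z)
      go (no p∤z)  = inj₂ (C.unit-cong (ι≋ z) (C.ℤ-unit z p∤z))

    z^p≋z : ∀ z → z Z.^ p Z.≈ z
    z^p≋z z = Z.trans (Z.^-congˡ p z≋n) (Z.trans (C.fermat n) (Z.sym z≋n))
      where
      n = z %ℕ p
      z≋n : z Z.≈ Z.ι (+ n)
      z≋n = Z.trans (congruent (divides (z /ℕ p) (≡.trans (≡.cong (ℤ._- + n) (ℤᵐ.a≡a%ℕn+[a/ℕn]*n z p))
        (solve 2 (λ n q → n :+ q :- n := q) ≡.refl (+ n) ((z /ℕ p) ℤ.* + p))))) (Z.sym (ι≋ (+ n)))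
        where
        open ℤ-Solver.+-*-Solver

    Form∣ : ℕ → ℕ → Set
    Form∣ i j = + p ∣ form A (suc i) (suc j)

    zero? : Dec (∃[ i ] i < h × ∃[ j ] j < h × Form∣ i j)
    zero? = ℕₚ.anyUpTo? (λ i → ℕₚ.anyUpTo? (λ j → + p ∣? form A (suc i) (suc j)) h) h

    no-zero : ¬ (∃[ i ] i < h × ∃[ j ] j < h × Form∣ i j) →
      ∀ i j → InRange h i → InRange h j → ¬ + p ∣ form A i j
    no-zero none zero    _       (() , _) _ _
    no-zero none (suc _) zero    _ (() , _) _
    no-zero none (suc i) (suc j) (_ , i≤h) (_ , j≤h) p∣ = none (i , i≤h , j , j≤h , p∣)

    -- Dividing `i² = A i j + j²` by `j²` makes `i/j` a root.
    zero⇒root : ∀ i j → InRange h j → + p ∣ form A i j → ∃[ w ] IsMetallicMean ℤ/p A w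
    zero⇒root i j r p∣ = x Z.* y , (begin
      x Z.* y Z.* (x Z.* y)    ≈⟨ solve 2 (λ x y → x :* y :* (x :* y) := x :* x :* (y :* y)) refl x y ⟩
      x Z.* x Z.* (y Z.* y)    ≈⟨ *-congʳ {y Z.* y} xx ⟩
      (a Z.* (x Z.* z) Z.+ z Z.* z) Z.* (y Z.* y)
        ≈⟨ solve 4 (λ a x y z → (a :* (x :* z) :+ z :* z) :* (y :* y) := a :* (x :* y) :* (z :* y) :+ z :* y :* (z :* y)) refl a x y z ⟩
      a Z.* (x Z.* y) Z.* (z Z.* y) Z.+ z Z.* y Z.* (z Z.* y)
        ≈⟨ +-cong (*-congˡ {a Z.* (x Z.* y)} zy≈1) (*-cong zy≈1 zy≈1) ⟩
      a Z.* (x Z.* y) Z.* 1# Z.+ 1# Z.* 1#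
        ≈⟨ +-cong (*-identityʳ (a Z.* (x Z.* y))) (*-identityʳ 1#) ⟩
      a Z.* (x Z.* y) Z.+ 1# ∎)
      where
      open Z hiding (_*_; _+_)
      x = ι (+ i)
      z = ι (+ j)
      a = ι A
      y = proj₁ (C.inRange-unit r)
      zy≈1 = proj₂ (C.inRange-unit r)
      xx : x Z.* x ≈ a Z.* (x Z.* z) Z.+ z Z.* z
      xx = begin
        x Z.* x ≈⟨ solve 3 (λ x a z → x :* x := x :* x :- a :* (x :* z) :- z :* z :+ (a :* (x :* z) :+ z :* z)) refl x a z ⟩
        x Z.* x - a Z.* (x Z.* z) - z Z.* z Z.+ (a Z.* (x Z.* z) Z.+ z Z.* z)
          ≈⟨ +-congʳ {a Z.* (x Z.* z) Z.+ z Z.* z} (trans (sym (C.ι-form A i j)) (C.ι-multiple p∣)) ⟩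
        0# Z.+ (a Z.* (x Z.* z) Z.+ z Z.* z) ≈⟨ +-identityˡ (a Z.* (x Z.* z) Z.+ z Z.* z) ⟩
        a Z.* (x Z.* z) Z.+ z Z.* z ∎

    open QuadraticExtension ℤ/p (Z.ι A) (+ 1)
    module E = RingLemmas extension

    char-E : E.ι (+ p) E.≈ E.0#
    char-E = E.trans (embed-ι (+ p)) (char-ℤ/p , Z.refl)

    θ-root : IsMetallicMean extension A θ
    θ-root = E.trans θ²≈aθ+b (E.+-congʳ {E.1#} (E.*-congʳ {θ} (E.sym (embed-ι A))))

    -- Integers lie in the first coordinate of the extension, so a congruence proved there descends
    -- to 𝔽ₚ.
    reflectᴱ : ∀ i j → E.ι i E.≈ E.ι j → i ≡ j [mod p ]
    reflectᴱ i j eq = reflect i j (proj₁ (E.trans (E.sym (embed-ι i)) (E.trans eq (embed-ι j))))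

    root⇒vanishing : ∀ w → IsMetallicMean ℤ/p A w → Vanishing ℤ/p w
    root⇒vanishing w root = T-vanishing
      where
      open MetallicMean.Field h p-prime ℤ/p char-ℤ/p A w root field? 1≢0
        (C.fermat-unit (MetallicMean.w-unit h p-prime ℤ/p char-ℤ/p A w root) (z^p≋z w)) (C.ℤ-unit A p∤A)
        (C.unit-cong (Evaluation.ι-D h p-prime ℤ/p char-ℤ/p A w root) (C.ℤ-unit D p∤D))

    -- In 𝔽ₚ Fermat gives `wᵖ = w`, whereas the law gives `A - w`. Hence `2w - A = 0`, and its
    -- square `D` would vanish.
    no-root-if-inert : InertLaw → ∀ w → ¬ IsMetallicMean ℤ/p A w
    no-root-if-inert law w root = C.unit≉0 1≢0 (C.ℤ-unit D p∤D) (begin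
      ι D                        ≈⟨ d²≈D ⟨
      (w Z.+ (w - ι A)) Z.* (w Z.+ (w - ι A))  ≈⟨ *-congʳ {w Z.+ (w - ι A)} (trans (+-congʳ {w - ι A} w≈a-w)
          (solve 2 (λ a w → a :- w :+ (w :- a) := con (+ 0)) refl (ι A) w)) ⟩
      0# Z.* (w Z.+ (w - ι A))   ≈⟨ zeroˡ (w Z.+ (w - ι A)) ⟩
      0#                         ∎)
      where
      open Z hiding (_*_; _+_)
      open Evaluation h p-prime ℤ/p char-ℤ/p A w root using (d²≈D)
      w≈a-w : w ≈ ι A - w
      w≈a-w = trans (sym (z^p≋z w)) (law ℤ/p char-ℤ/p w root)

    nonvanishing : (∀ i j → InRange h i → InRange h j → ¬ + p ∣ form A i j) → Nonvanishing extension θ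
    nonvanishing = MetallicMean.T-nonvanishing h p-prime extension char-E A θ θ-root

    -- If no form vanished, w²ʰ = 1 in the extension would force T ≡ 0, although T is a product of units.
    zero-if-split : SplitLaw → ¬ (∀ i j → InRange h i → InRange h j → ¬ + p ∣ form A i j)
    zero-if-split law none = C.unit≉0 1≢0 (C.T-unit A none)
      (proj₁ (E.trans (E.sym (embed-ι (T p A))) T≈0))
      where
      open Evaluation.Split h p-prime extension char-E A θ θ-root (law extension char-E θ θ-root)
      T≈0 : E.ι (T p A) E.≈ E.0#
      T≈0 = T-nonvanishing≈0 (nonvanishing none)

  split-conclude : SplitLaw → ∀ v →
    (∀ R → HasCharacteristic R p → ∀ w → IsMetallicMean R A w → Vanishing R w → HasValue R v) →
    T p A ≡ v [mod p ]
  split-conclude law v evaluate = go zero?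
    where
    go : Dec (∃[ i ] i < h × ∃[ j ] j < h × Form∣ i j) → T p A ≡ v [mod p ]
    go (yes (i , _ , j , j<h , p∣)) =
      let w , root = zero⇒root (suc i) (suc j) (s≤s z≤n , j<h) p∣ in
      reflect (T p A) v (evaluate ℤ/p char-ℤ/p w root (root⇒vanishing w root))
    go (no none) = ⊥-elim (zero-if-split law (no-zero none))

  inert-conclude : InertLaw → ∀ v →
    (∀ R → HasCharacteristic R p → ∀ w → IsMetallicMean R A w → Nonvanishing R w → HasValue R v) →
    T p A ≡ v [mod p ]
  inert-conclude law v evaluate = go zero?
    where
    go : Dec (∃[ i ] i < h × ∃[ j ] j < h × Form∣ i j) → T p A ≡ v [mod p ]
    go (yes (i , _ , j , j<h , p∣)) =
      let w , root = zero⇒root (suc i) (suc j) (s≤s z≤n , j<h) p∣ in ⊥-elim (no-root-if-inert law w root)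
    go (no none) = reflectᴱ (T p A) v (evaluate extension char-E θ θ-root (nonvanishing (no-zero none)))

-- A = 1, with w in the role of the golden ratio.
module GoldenEvaluation (h : ℕ) (p-prime : Prime (suc (h ℕ.+ h))) (R : CommutativeRing 0ℓ 0ℓ)
  (char-p : HasCharacteristic R (suc (h ℕ.+ h)))
  (w : CommutativeRing.Carrier R) (root : IsMetallicMean R (+ 1) w) where

  open RingLemmas R
  open Characteristic h p-prime R char-p
  open Powers R
  private
    p = suc (h ℕ.+ h)
    t = ι (T p (+ 1))
  module Ev = Evaluation h p-prime R char-p (+ 1) w root

  w²≈w+1 : w * w ≈ w + 1#
  w²≈w+1 = trans root (+-congʳ (*-identityˡ w))

  open Cyclotomic h p-prime R char-p w using (α; module Tenth)
  open Tenth w²≈w+1 public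

  c≈α : 1# + w * w ≈ α
  c≈α = trans (+-congˡ w²≈w+1) (solve 1 (λ w → con (+ 1) :+ (w :+ con (+ 1)) := con (+ 2) :+ w) refl w)

  -- `T αʰ = -1` with `αʰ = -x` makes `T` the inverse of `x`, which is `x` itself for a sign.
  split-odd : ∀ k → h ≡ suc (k ℕ.+ k) → w ^ p ≈ w → ∀ x → x * x ≈ 1# → α ^ h ≈ - x →
    (- 1#) ^ h * ((- w) ^ h) ^ h * (t * (1# + w * w) ^ h) ≈ - w ^ h → t ≈ x
  split-odd k h≡ wᵖ≈w x xx≈1 αʰ≈-x van = cancel {x = - x} (unit-neg (x , xx≈1)) (begin
    - x * t                 ≈⟨ trans (*-comm _ _) (*-congˡ (sym (trans (^-congˡ h c≈α) αʰ≈-x))) ⟩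
    t * (1# + w * w) ^ h   ≈⟨ Ev.Split.T-odd wᵖ≈w k h≡ van ⟩
    - 1#                    ≈⟨ trans (-‿cong (sym xx≈1)) (-‿distribˡ-* x x) ⟩
    - x * x                 ∎)

  inert-odd : ∀ k → h ≡ suc (k ℕ.+ k) → w ^ p ≈ 1# - w →
    ((- w) ^ h) ^ h * t ≈ ((w * w) ^ h - 1#) ^ h → t ≈ - (w * (- 1#) ^ k * α ^ h)
  inert-odd k h≡ wᵖ non = trans (Ev.Inert.T-odd wᵖ k h≡ non) (-‿cong (*-congˡ (^-congˡ h c≈α)))

module GoldenClasses (h : ℕ) (p-prime : Prime (suc (h ℕ.+ h))) (p∤5 : ¬ + suc (h ℕ.+ h) ∣ + 5) where

  private
    p = suc (h ℕ.+ h)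

    p∤1 : ¬ + p ∣ + 1
    p∤1 p∣1 = ¬prime[1] (≡.subst Prime (ℕᵈ.∣1⇒≡1 (∣⇒∣ᵤ p∣1)) p-prime)

  -- For `A = 1` the discriminant `A² + 4` computes to 5.
  open Dichotomy h p-prime (+ 1) p∤1 p∤5

  split-law : ∀ m → p ≡ 1 ℕ.+ m ℕ.* 10 ⊎ p ≡ 9 ℕ.+ m ℕ.* 10 → SplitLaw
  split-law m (inj₁ eq) R char-p w root = GoldenEvaluation.t^p-1 h p-prime R char-p w root m eq
  split-law m (inj₂ eq) R char-p w root = GoldenEvaluation.t^p-9 h p-prime R char-p w root m eq

  inert-law : ∀ m → p ≡ 3 ℕ.+ m ℕ.* 10 ⊎ p ≡ 7 ℕ.+ m ℕ.* 10 → InertLaw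
  inert-law m (inj₁ eq) R char-p w root = GoldenEvaluation.t^p-3 h p-prime R char-p w root m eq
  inert-law m (inj₂ eq) R char-p w root = GoldenEvaluation.t^p-7 h p-prime R char-p w root m eq

  split-even : ∀ k → h ≡ k ℕ.+ k → SplitLaw → T p (+ 1) ≡ ℤ.- ((+ 5) ℤ.^ k) [mod p ]
  split-even k h≡2k law = split-conclude law _ λ R char-p w root van →
    let open RingLemmas R
        open Powers R
    in
    trans (Evaluation.Split.T-even h p-prime R char-p (+ 1) w root (law R char-p w root) k h≡2k
            (Characteristic.ℤ-unit h p-prime R char-p (+ 5) p∤5) van)
      (sym (trans (ι-neg ((+ 5) ℤ.^ k)) (-‿cong (ι-^ (+ 5) k))))

  inert-even : ∀ k → h ≡ k ℕ.+ k → InertLaw → T p (+ 1) ≡ (ℤ.- (+ 5)) ℤ.^ k [mod p ]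
  inert-even k h≡2k law = inert-conclude law _ λ R char-p w root non →
    let open RingLemmas R
        open Powers R
    in
    trans (Evaluation.Inert.T-even h p-prime R char-p (+ 1) w root (law R char-p w root) k h≡2k non)
      (sym (ι-^ (ℤ.- (+ 5)) k))

  T≡1 : ∀ k m → h ≡ 5 ℕ.+ k ℕ.* 10 → p ≡ 1 ℕ.+ m ℕ.* 10 → ∀ n → h ≡ suc (n ℕ.+ n) → T p (+ 1) ≡ + 1 [mod p ]
  T≡1 k m h≡ p≡ n h≡1+2n = split-conclude (split-law m (inj₁ p≡)) (+ 1) λ R char-p w root van →
    let open RingLemmas R
        open GoldenEvaluation h p-prime R char-p w root
    in
    split-odd n h≡1+2n (t^p-1 m p≡) 1# (*-identityˡ 1#) (αʰ-5 k m h≡ p≡) van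

  T≡-1 : ∀ k m → h ≡ 9 ℕ.+ k ℕ.* 10 → p ≡ 9 ℕ.+ m ℕ.* 10 → ∀ n → h ≡ suc (n ℕ.+ n) → T p (+ 1) ≡ -[1+ 0 ] [mod p ]
  T≡-1 k m h≡ p≡ n h≡1+2n = split-conclude (split-law m (inj₂ p≡)) -[1+ 0 ] λ R char-p w root van →
    let open RingLemmas R
        open GoldenEvaluation h p-prime R char-p w root
        open Powers R
    in
    split-odd n h≡1+2n (t^p-9 m p≡) (- 1#) -1*-1≈1 (trans (αʰ-9 k m h≡ p≡) (sym (-‿involutive 1#))) van

  -- Here `αʰ = w - 1` is `1/w`, which cancels the factor `w` in the value of `T`.
  T≡-[-1]ⁿ : ∀ k m → h ≡ 1 ℕ.+ k ℕ.* 10 → p ≡ 3 ℕ.+ m ℕ.* 10 → ∀ n → h ≡ suc (n ℕ.+ n) →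
    T p (+ 1) ≡ ℤ.- (-[1+ 0 ] ℤ.^ n) [mod p ]
  T≡-[-1]ⁿ k m h≡ p≡ n h≡1+2n = inert-conclude (inert-law m (inj₁ p≡)) _ λ R char-p w root non →
    let open RingLemmas R
        open GoldenEvaluation h p-prime R char-p w root
        open Powers R
    in begin
    ι (T p (+ 1))                     ≈⟨ inert-odd n h≡1+2n (t^p-3 m p≡) non ⟩
    - (w * (- 1#) ^ n * _)            ≈⟨ -‿cong (*-congˡ (αʰ-1 k m h≡ p≡)) ⟩
    - (w * (- 1#) ^ n * (w - 1#))
      ≈⟨ solve 2 (λ w s → :- (w :* s :* (w :- con (+ 1))) := :- ((w :* w :- w) :* s)) refl w _ ⟩
    - ((w * w - w) * (- 1#) ^ n)      ≈⟨ -‿cong (*-congʳ (+-congʳ w²≈w+1)) ⟩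
    - ((w + 1# - w) * (- 1#) ^ n)     ≈⟨ solve 2 (λ w s → :- ((w :+ con (+ 1) :- w) :* s) := :- s) refl w _ ⟩
    - (- 1#) ^ n                      ≈⟨ trans (ι-neg (-[1+ 0 ] ℤ.^ n)) (-‿cong (ι-^ -[1+ 0 ] n)) ⟨
    ι (ℤ.- (-[1+ 0 ] ℤ.^ n))          ∎

  -- Here `αʰ = 1 - w` is `-1/w`, so the sign is opposite to that of the class of 3.
  T≡[-1]ⁿ : ∀ k m → h ≡ 3 ℕ.+ k ℕ.* 10 → p ≡ 7 ℕ.+ m ℕ.* 10 → ∀ n → h ≡ suc (n ℕ.+ n) →
    T p (+ 1) ≡ -[1+ 0 ] ℤ.^ n [mod p ]
  T≡[-1]ⁿ k m h≡ p≡ n h≡1+2n = inert-conclude (inert-law m (inj₂ p≡)) _ λ R char-p w root non →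
    let open RingLemmas R
        open GoldenEvaluation h p-prime R char-p w root
        open Powers R
    in begin
    ι (T p (+ 1))                     ≈⟨ inert-odd n h≡1+2n (t^p-7 m p≡) non ⟩
    - (w * (- 1#) ^ n * _)            ≈⟨ -‿cong (*-congˡ (αʰ-3 k m h≡ p≡)) ⟩
    - (w * (- 1#) ^ n * (1# - w))
      ≈⟨ solve 2 (λ w s → :- (w :* s :* (con (+ 1) :- w)) := (w :* w :- w) :* s) refl w _ ⟩
    (w * w - w) * (- 1#) ^ n          ≈⟨ *-congʳ (+-congʳ w²≈w+1) ⟩
    (w + 1# - w) * (- 1#) ^ n         ≈⟨ solve 2 (λ w s → (w :+ con (+ 1) :- w) :* s := s) refl w _ ⟩
    (- 1#) ^ n                        ≈⟨ ι-^ -[1+ 0 ] n ⟨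
    ι (-[1+ 0 ] ℤ.^ n)                ∎

-- A = 2, where w = 1 + t with t² = 2.
module SilverEvaluation (h : ℕ) (p-prime : Prime (suc (h ℕ.+ h))) (R : CommutativeRing 0ℓ 0ℓ)
  (char-p : HasCharacteristic R (suc (h ℕ.+ h)))
  (w : CommutativeRing.Carrier R) (root : IsMetallicMean R (+ 2) w) where

  open RingLemmas R
  open Characteristic h p-prime R char-p
  open Powers R
  private
    p = suc (h ℕ.+ h)
    T′ = ι (T p (+ 2))
  module Ev = Evaluation h p-prime R char-p (+ 2) w root

  t : Carrier
  t = w - 1#

  t²≈2 : t * t ≈ ι (+ 2)
  t²≈2 = begin
    (w - 1#) * (w - 1#)              ≈⟨ solve 1 (λ w → (w :- con (+ 1)) :* (w :- con (+ 1)) := w :* w :- con (+ 2) :* w :+ con (+ 1)) refl w ⟩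
    w * w - ι (+ 2) * w + 1#         ≈⟨ +-congʳ (+-congʳ root) ⟩
    ι (+ 2) * w + 1# - ι (+ 2) * w + 1#  ≈⟨ solve 1 (λ x → x :+ con (+ 1) :- x :+ con (+ 1) := con (+ 2)) refl (ι (+ 2) * w) ⟩
    ι (+ 2)                          ∎

  open Cyclotomic h p-prime R char-p t using (α; module Eighth)
  open Eighth t²≈2 public

  wᵖ≈tᵖ+1 : w ^ p ≈ t ^ p + 1#
  wᵖ≈tᵖ+1 = trans (^-congˡ p (solve 1 (λ w → w := w :- con (+ 1) :+ con (+ 1)) refl w))
    (trans (frobenius t 1#) (+-congˡ (1^n≈1 p)))

  split-power : t ^ p ≈ t → w ^ p ≈ w
  split-power eq = trans wᵖ≈tᵖ+1 (trans (+-congʳ eq) (solve 1 (λ w → w :- con (+ 1) :+ con (+ 1) := w) refl w))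

  inert-power : t ^ p ≈ - t → w ^ p ≈ ι (+ 2) - w
  inert-power eq = trans wᵖ≈tᵖ+1 (trans (+-congʳ eq) (solve 1 (λ w → :- (w :- con (+ 1)) :+ con (+ 1) := con (+ 2) :- w) refl w))

  -- `1 + w² = 2 + 2w = 2 (2 + t)`, because `t = w - 1`.
  cʰ≈2ʰαʰ : (1# + w * w) ^ h ≈ ι (+ 2) ^ h * α ^ h
  cʰ≈2ʰαʰ = trans (^-congˡ h (trans (+-congˡ root)
    (solve 1 (λ w → con (+ 1) :+ (con (+ 2) :* w :+ con (+ 1)) := con (+ 2) :* (con (+ 2) :+ (w :- con (+ 1)))) refl w)))
    (^-distrib-* (ι (+ 2)) α h)

  split-2ʰ : Unit (ι (+ 2)) → t ^ p ≈ t → ι (+ 2) ^ h ≈ 1#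
  split-2ʰ u eq = 2^h u (trans eq (sym (*-identityˡ t)))

  inert-2ʰ : Unit (ι (+ 2)) → t ^ p ≈ - t → ι (+ 2) ^ h ≈ - 1#
  inert-2ʰ u eq = 2^h u (trans eq (sym (-1*x≈-x t)))

  -- The discriminant 8 is `2 · 4`, and `4ᵏ = 2^(2k) = 2ʰ` is a sign already known from Frobenius.
  8^k : ∀ k → h ≡ k ℕ.+ k → ι (+ 8) ^ k ≈ ι (+ 2) ^ k * ι (+ 2) ^ h
  8^k k h≡2k = trans (^-congˡ k (solve 0 (con (+ 8) := con (+ 2) :* (con (+ 2) :* con (+ 2))) refl))
    (trans (^-distrib-* (ι (+ 2)) (ι (+ 2) * ι (+ 2)) k)
      (*-congˡ (trans (sym (^-double (ι (+ 2)) k)) (sym (^-congʳ (ι (+ 2)) h≡2k)))))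

  [-1]ⁿ*[-1]ⁿ≈1 : ∀ n → (- 1#) ^ n * (- 1#) ^ n ≈ 1#
  [-1]ⁿ*[-1]ⁿ≈1 n = trans (sym (^-distrib-* _ _ n)) (trans (^-congˡ n -1*-1≈1) (1^n≈1 n))

  split-odd : ∀ n k → h ≡ suc (n ℕ.+ n) → Unit (ι (+ 2)) → t ^ p ≈ t → α ^ h * (- 1#) ^ k ≈ - 1# →
    (- 1#) ^ h * ((- w) ^ h) ^ h * (T′ * (1# + w * w) ^ h) ≈ - w ^ h → T′ ≈ (- 1#) ^ k
  split-odd n k h≡ u eq αʰσ≈-1 van = begin
    T′                                 ≈⟨ solve 1 (λ t → t := :- (t :* :- con (+ 1))) refl T′ ⟩
    - (T′ * - 1#)                      ≈⟨ -‿cong (*-congˡ αʰσ≈-1) ⟨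
    - (T′ * (α ^ h * (- 1#) ^ k))      ≈⟨ solve 3 (λ t a s → :- (t :* (a :* s)) := :- (t :* (con (+ 1) :* a) :* s)) refl T′ (α ^ h) _ ⟩
    - (T′ * (1# * α ^ h) * (- 1#) ^ k) ≈⟨ -‿cong (*-congʳ (*-congˡ (trans cʰ≈2ʰαʰ (*-congʳ (split-2ʰ u eq))))) ⟨
    - (T′ * (1# + w * w) ^ h * (- 1#) ^ k)  ≈⟨ -‿cong (*-congʳ (Ev.Split.T-odd (split-power eq) n h≡ van)) ⟩
    - (- 1# * (- 1#) ^ k)              ≈⟨ solve 1 (λ s → :- (:- con (+ 1) :* s) := s) refl _ ⟩
    (- 1#) ^ k                         ∎

  -- The sign `(-1)ⁿ` is 1 because `n` is even, and `2ʰ = -1` cancels the leading minus. What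
  -- remains is `w αʰ` with `αʰ = (-1)ᵏ (t - 1)`, where `t - 1 = w - 2 = 1/w`.
  inert-odd : ∀ n k → h ≡ suc (n ℕ.+ n) → n ≡ k ℕ.+ k → Unit (ι (+ 2)) → t ^ p ≈ - t → α ^ h * (- 1#) ^ k ≈ t - 1# →
    ((- w) ^ h) ^ h * T′ ≈ ((w * w) ^ h - 1#) ^ h → T′ ≈ (- 1#) ^ k
  inert-odd n k h≡ n≡2k u eq αʰσ≈ non = begin
    T′                                             ≈⟨ Ev.Inert.T-odd (inert-power eq) n h≡ non ⟩
    - (w * (- 1#) ^ n * (1# + w * w) ^ h)
      ≈⟨ -‿cong (*-cong (*-congˡ (trans (^-congʳ (- 1#) n≡2k) (trans (neg-even 1# k) (1^n≈1 (k ℕ.+ k))))) (trans cʰ≈2ʰαʰ (*-congʳ (inert-2ʰ u eq)))) ⟩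
    - (w * 1# * (- 1# * α ^ h))
      ≈⟨ solve 2 (λ w a → :- (w :* con (+ 1) :* (:- con (+ 1) :* a)) := w :* (a :* con (+ 1))) refl w (α ^ h) ⟩
    w * (α ^ h * 1#)                               ≈⟨ *-congˡ (*-congˡ ([-1]ⁿ*[-1]ⁿ≈1 k)) ⟨
    w * (α ^ h * ((- 1#) ^ k * (- 1#) ^ k))        ≈⟨ solve 3 (λ w a s → w :* (a :* (s :* s)) := w :* (a :* s) :* s) refl w (α ^ h) _ ⟩
    w * (α ^ h * (- 1#) ^ k) * (- 1#) ^ k          ≈⟨ *-congʳ (*-congˡ αʰσ≈) ⟩
    w * (w - 1# - 1#) * (- 1#) ^ k
      ≈⟨ *-congʳ (solve 1 (λ w → w :* (w :- con (+ 1) :- con (+ 1)) := w :* w :- con (+ 2) :* w) refl w) ⟩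
    (w * w - ι (+ 2) * w) * (- 1#) ^ k             ≈⟨ *-congʳ (+-congʳ root) ⟩
    (ι (+ 2) * w + 1# - ι (+ 2) * w) * (- 1#) ^ k
      ≈⟨ solve 2 (λ x s → (x :+ con (+ 1) :- x) :* s := s) refl (ι (+ 2) * w) _ ⟩
    (- 1#) ^ k                                     ∎

module SilverClasses (h : ℕ) (p-prime : Prime (suc (h ℕ.+ h))) (2<p : 2 < suc (h ℕ.+ h)) where

  private
    p = suc (h ℕ.+ h)

    p∤2 : ¬ p ℕᵈ.∣ 2
    p∤2 p∣2 = ℕₚ.<⇒≱ 2<p (ℕᵈ.∣⇒≤ p∣2)

    p∤8 : ¬ p ℕᵈ.∣ 8
    p∤8 p∣8 with euclidsLemma 2 4 p-prime p∣8
    ... | inj₁ p∣2 = p∤2 p∣2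
    ... | inj₂ p∣4 with euclidsLemma 2 2 p-prime p∣4
    ...   | inj₁ p∣2 = p∤2 p∣2
    ...   | inj₂ p∣2 = p∤2 p∣2

  -- For `A = 2` the discriminant `A² + 4` computes to 8.
  open Dichotomy h p-prime (+ 2) (λ p∣2 → p∤2 (∣⇒∣ᵤ p∣2)) (λ p∣8 → p∤8 (∣⇒∣ᵤ p∣8))

  private
    2-unit : ∀ R char-p → Characteristic.Unit h p-prime R char-p (Integers.ι R (+ 2))
    2-unit R char-p = Characteristic.ℕ-unit h p-prime R char-p 2 p∤2

    8-unit : ∀ R char-p → Characteristic.Unit h p-prime R char-p (Integers.ι R (+ 8))
    8-unit R char-p = Characteristic.ℕ-unit h p-prime R char-p 8 p∤8

  T≡-2^k : ∀ k m → h ≡ k ℕ.+ k → p ≡ 1 ℕ.+ m ℕ.* 8 → T p (+ 2) ≡ ℤ.- ((+ 2) ℤ.^ k) [mod p ]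
  T≡-2^k k m h≡2k p≡ = split-conclude
    (λ R char-p w root → let open SilverEvaluation h p-prime R char-p w root in split-power (t^p-1 m p≡)) _
    λ R char-p w root van →
    let open RingLemmas R
        open Powers R
        open SilverEvaluation h p-prime R char-p w root
    in begin
    ι (T p (+ 2))                  ≈⟨ Ev.Split.T-even (split-power (t^p-1 m p≡)) k h≡2k (8-unit R char-p) van ⟩
    - ι (+ 8) ^ k                  ≈⟨ -‿cong (trans (8^k k h≡2k) (*-congˡ (split-2ʰ (2-unit R char-p) (t^p-1 m p≡)))) ⟩
    - (ι (+ 2) ^ k * 1#)           ≈⟨ -‿cong (*-identityʳ _) ⟩
    - ι (+ 2) ^ k                  ≈⟨ trans (ι-neg ((+ 2) ℤ.^ k)) (-‿cong (ι-^ (+ 2) k)) ⟨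
    ι (ℤ.- ((+ 2) ℤ.^ k))          ∎

  -- Two signs cancel: `(-8)ᵏ = -8ᵏ` since `k` is odd, and `8ᵏ = 2ᵏ 2ʰ` with `2ʰ = -1`.
  T≡2^k : ∀ k m n → h ≡ k ℕ.+ k → k ≡ suc (n ℕ.+ n) → p ≡ 5 ℕ.+ m ℕ.* 8 → T p (+ 2) ≡ (+ 2) ℤ.^ k [mod p ]
  T≡2^k k m n h≡2k k≡1+2n p≡ = inert-conclude
    (λ R char-p w root → let open SilverEvaluation h p-prime R char-p w root in inert-power (t^p-5 m p≡)) _
    λ R char-p w root non →
    let open RingLemmas R
        open Powers R
        open SilverEvaluation h p-prime R char-p w root
    in begin
    ι (T p (+ 2))                  ≈⟨ Ev.Inert.T-even (inert-power (t^p-5 m p≡)) k h≡2k non ⟩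
    (- ι (+ 8)) ^ k                ≈⟨ trans (^-congʳ (- ι (+ 8)) k≡1+2n) (trans (neg-odd (ι (+ 8)) n) (-‿cong (sym (^-congʳ (ι (+ 8)) k≡1+2n)))) ⟩
    - ι (+ 8) ^ k                  ≈⟨ -‿cong (trans (8^k k h≡2k) (*-congˡ (inert-2ʰ (2-unit R char-p) (t^p-5 m p≡)))) ⟩
    - (ι (+ 2) ^ k * - 1#)         ≈⟨ solve 1 (λ x → :- (x :* :- con (+ 1)) := x) refl _ ⟩
    ι (+ 2) ^ k                    ≈⟨ ι-^ (+ 2) k ⟨
    ι ((+ 2) ℤ.^ k)                ∎

  T≡[-1]ᵏ-inert : ∀ k m n → h ≡ 1 ℕ.+ k ℕ.* 4 → h ≡ suc (n ℕ.+ n) → n ≡ k ℕ.+ k → p ≡ 3 ℕ.+ m ℕ.* 8 →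
    T p (+ 2) ≡ -[1+ 0 ] ℤ.^ k [mod p ]
  T≡[-1]ᵏ-inert k m n h≡ h≡1+2n n≡2k p≡ = inert-conclude
    (λ R char-p w root → let open SilverEvaluation h p-prime R char-p w root in inert-power (t^p-3 m p≡)) _
    λ R char-p w root non →
    let open RingLemmas R
        open Powers R
        open SilverEvaluation h p-prime R char-p w root
    in
    trans (inert-odd n k h≡1+2n n≡2k (2-unit R char-p) (t^p-3 m p≡) (αʰ-1 k m h≡ p≡) non) (sym (ι-^ -[1+ 0 ] k))

  T≡[-1]ᵏ-split : ∀ k m n → h ≡ 3 ℕ.+ k ℕ.* 4 → h ≡ suc (n ℕ.+ n) → p ≡ 7 ℕ.+ m ℕ.* 8 →
    T p (+ 2) ≡ -[1+ 0 ] ℤ.^ k [mod p ]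
  T≡[-1]ᵏ-split k m n h≡ h≡1+2n p≡ = split-conclude
    (λ R char-p w root → let open SilverEvaluation h p-prime R char-p w root in split-power (t^p-7 m p≡)) _
    λ R char-p w root van →
    let open RingLemmas R
        open Powers R
        open SilverEvaluation h p-prime R char-p w root
    in
    trans (split-odd n k h≡1+2n (2-unit R char-p) (t^p-7 m p≡) (αʰ-3 k m h≡ p≡) van) (sym (ι-^ -[1+ 0 ] k))

-- Residue classes

-- With `k = p / 2d`, the residue `1 + 2s` makes `p = 2h + 1` for `h = s + kd`. The goal is a
-- predicate `Q` on `p`, so each class can be proved for numbers already in this shape.
by-residue : ∀ d s .{{_ : NonZero (d ℕ.+ d)}} (Q : ℕ → Set) →
  (∀ k → let h = s ℕ.+ k ℕ.* d in Prime (suc (h ℕ.+ h)) → Q (suc (h ℕ.+ h))) →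
  ∀ {p} → Prime p → p % (d ℕ.+ d) ≡ suc (s ℕ.+ s) → Q p
by-residue d s Q class {p} p-prime p%2d≡1+2s = ≡.subst Q (≡.sym p≡) (class k (≡.subst Prime p≡ p-prime))
  where
  open +-*-Solver
  k = p / (d ℕ.+ d)
  p≡ : p ≡ suc ((s ℕ.+ k ℕ.* d) ℕ.+ (s ℕ.+ k ℕ.* d))
  p≡ = ≡.trans (ℕᵐ.m≡m%n+[m/n]*n p (d ℕ.+ d)) (≡.trans (≡.cong (ℕ._+ k ℕ.* (d ℕ.+ d)) p%2d≡1+2s)
    (solve 3 (λ s k d → con 1 :+ (s :+ s) :+ k :* (d :+ d) := con 1 :+ ((s :+ k :* d) :+ (s :+ k :* d))) ≡.refl s k d))

quarter : ∀ h k → h ≡ k ℕ.+ k → (suc (h ℕ.+ h) ∸ 1) / 4 ≡ k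
quarter h k ≡.refl = ≡.trans (≡.cong (_/ 4) (solve 1 (λ k → k :+ k :+ (k :+ k) := k :* con 4) ≡.refl k)) (ℕᵐ.m*n/n≡m k 4)
  where open +-*-Solver

-- The premise `r / d ≡ 0` says that `r` is a remainder below `d`; for numerals it holds by
-- computation.
floor : ∀ p b r q d .{{_ : NonZero d}} → p ≡ b ℕ.+ (r ℕ.+ q ℕ.* d) → r / d ≡ 0 → (+ p ℤ.- + b) ℤ./ℕ d ≡ + q
floor p b r q d ≡.refl r/d≡0 = ≡.trans (≡.cong (ℤ._/ℕ d) p-b) (≡.cong +_ (≡.trans
  (ℕᵐ.+-distrib-/-∣ʳ r (ℕᵈ.divides q ≡.refl)) (≡.cong₂ ℕ._+_ r/d≡0 (ℕᵐ.m*n/n≡m q d))))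
  where
  p-b : + p ℤ.- + b ≡ + (r ℕ.+ q ℕ.* d)
  p-b = ≡.trans (ℤₚ.m-n≡m⊖n p b) (≡.trans (ℤₚ.⊖-≥ (ℕₚ.m≤m+n b _)) (≡.cong +_ (ℕₚ.m+n∸m≡n b _)))

eighth : ∀ p r k → p ≡ r ℕ.+ k ℕ.* 8 → (p ∸ r) / 8 ≡ k
eighth p r k ≡.refl = ≡.trans (≡.cong (_/ 8) (ℕₚ.m+n∸m≡n r (k ℕ.* 8))) (ℕᵐ.m*n/n≡m k 8)

negOnePow-ℕ : ∀ n → negOnePow (+ n) ≡ -[1+ 0 ] ℤ.^ n
negOnePow-ℕ zero          = ≡.refl
negOnePow-ℕ (suc zero)    = ≡.refl
negOnePow-ℕ (suc (suc n)) = ≡.trans (negOnePow-ℕ n) (≡.trans (≡.sym (ℤₚ.*-identityˡ _)) (ℤₚ.*-assoc -[1+ 0 ] -[1+ 0 ] (-[1+ 0 ] ℤ.^ n)))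

[-1]^[n+n]≡1 : ∀ n → -[1+ 0 ] ℤ.^ (n ℕ.+ n) ≡ + 1
[-1]^[n+n]≡1 n = ≡.trans (≡.cong (-[1+ 0 ] ℤ.^_) (≡.cong (n ℕ.+_) (≡.sym (ℕₚ.+-identityʳ n)))) (≡.trans (≡.sym (ℤₚ.^-*-assoc -[1+ 0 ] 2 n)) (ℤₚ.^-zeroˡ n))

not-five : ∀ {p r} → Prime p → 5 ≢ r → p % 20 ≡ r → ¬ + p ∣ + 5
not-five p-prime 5≢r p%20≡r p∣5 with prime⇒irreducible (toWitness {a? = prime? 5} _) (∣⇒∣ᵤ p∣5)
... | inj₁ ≡.refl = ¬prime[1] p-prime
... | inj₂ ≡.refl = 5≢r p%20≡r

[-1]^[n*5]≡[-1]^n : ∀ n → -[1+ 0 ] ℤ.^ (n ℕ.* 5) ≡ -[1+ 0 ] ℤ.^ n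
[-1]^[n*5]≡[-1]^n n = ≡.trans (≡.cong (-[1+ 0 ] ℤ.^_) (ℕₚ.*-comm n 5)) (≡.sym (ℤₚ.^-*-assoc -[1+ 0 ] 5 n))

-[-1]^[1+n]≡[-1]^n : ∀ n → ℤ.- (-[1+ 0 ] ℤ.^ suc n) ≡ -[1+ 0 ] ℤ.^ n
-[-1]^[1+n]≡[-1]^n n = ≡.trans (≡.cong ℤ.-_ (ℤₚ.-1*i≡-i (-[1+ 0 ] ℤ.^ n))) (ℤₚ.neg-involutive (-[1+ 0 ] ℤ.^ n))

module _ where

  open +-*-Solver
  open GoldenClasses

  private
    Golden : (ℕ → ℤ) → ℕ → Set
    Golden v p = ¬ + p ∣ + 5 → T p (+ 1) ≡ v p [mod p ]

    Silver : (ℕ → ℤ) → ℕ → Set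
    Silver v p = 2 < p → T p (+ 2) ≡ v p [mod p ]

    with-value : ∀ p A {v w} → w ≡ v → T p A ≡ v [mod p ] → T p A ≡ w [mod p ]
    with-value p A ≡.refl eq = eq

    -5^¼ [-5]^¼ ⌊p-10/20⌋ ⌊p-5/10⌋ -2^¼ 2^¼ ⌊p-3/8⌋ ⌊p-7/8⌋ : ℕ → ℤ
    -5^¼ p        = ℤ.- ((+ 5) ℤ.^ ((p ∸ 1) / 4))
    [-5]^¼ p       = (ℤ.- (+ 5)) ℤ.^ ((p ∸ 1) / 4)
    ⌊p-10/20⌋ p = negOnePow ((+ p ℤ.- + 10) ℤ./ℕ 20)
    ⌊p-5/10⌋ p  = negOnePow ((+ p ℤ.- + 5) ℤ./ℕ 10)
    -2^¼ p       = ℤ.- ((+ 2) ℤ.^ ((p ∸ 1) / 4))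
    2^¼ p        = (+ 2) ℤ.^ ((p ∸ 1) / 4)
    ⌊p-3/8⌋ p   = negOnePow (+ ((p ∸ 3) / 8))
    ⌊p-7/8⌋ p   = negOnePow (+ ((p ∸ 7) / 8))

  golden-1 : ∀ {p} → Prime p → p % 20 ≡ 1 → Golden -5^¼ p
  golden-1 = by-residue 10 0 (Golden -5^¼) λ k pr p∤5 →
    let h = k ℕ.* 10
        h≡ = solve 1 (λ k → k :* con 10 := k :* con 5 :+ k :* con 5) ≡.refl k
        p≡ = solve 1 (λ k → con 1 :+ (k :* con 10 :+ k :* con 10) := con 1 :+ (k :+ k) :* con 10) ≡.refl k
    in with-value _ (+ 1) (≡.cong (λ n → ℤ.- ((+ 5) ℤ.^ n)) (quarter h (k ℕ.* 5) h≡))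
         (split-even h pr p∤5 (k ℕ.* 5) h≡ (split-law h pr p∤5 (k ℕ.+ k) (inj₁ p≡)))

  golden-9 : ∀ {p} → Prime p → p % 20 ≡ 9 → Golden -5^¼ p
  golden-9 = by-residue 10 4 (Golden -5^¼) λ k pr p∤5 →
    let h = 4 ℕ.+ k ℕ.* 10
        h≡ = solve 1 (λ k → con 4 :+ k :* con 10 := con 2 :+ k :* con 5 :+ (con 2 :+ k :* con 5)) ≡.refl k
        p≡ = solve 1 (λ k → con 5 :+ (k :* con 10 :+ (con 4 :+ k :* con 10)) := con 9 :+ (k :+ k) :* con 10) ≡.refl k
    in with-value _ (+ 1) (≡.cong (λ n → ℤ.- ((+ 5) ℤ.^ n)) (quarter h (2 ℕ.+ k ℕ.* 5) h≡))
         (split-even h pr p∤5 (2 ℕ.+ k ℕ.* 5) h≡ (split-law h pr p∤5 (k ℕ.+ k) (inj₂ p≡)))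

  golden-13 : ∀ {p} → Prime p → p % 20 ≡ 13 → Golden [-5]^¼ p
  golden-13 = by-residue 10 6 (Golden [-5]^¼) λ k pr p∤5 →
    let h = 6 ℕ.+ k ℕ.* 10
        h≡ = solve 1 (λ k → con 6 :+ k :* con 10 := con 3 :+ k :* con 5 :+ (con 3 :+ k :* con 5)) ≡.refl k
        p≡ = solve 1 (λ k → con 7 :+ (k :* con 10 :+ (con 6 :+ k :* con 10)) := con 3 :+ (con 1 :+ (k :+ k)) :* con 10) ≡.refl k
    in with-value _ (+ 1) (≡.cong (λ n → (ℤ.- (+ 5)) ℤ.^ n) (quarter h (3 ℕ.+ k ℕ.* 5) h≡))
         (inert-even h pr p∤5 (3 ℕ.+ k ℕ.* 5) h≡ (inert-law h pr p∤5 (suc (k ℕ.+ k)) (inj₁ p≡)))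

  golden-17 : ∀ {p} → Prime p → p % 20 ≡ 17 → Golden [-5]^¼ p
  golden-17 = by-residue 10 8 (Golden [-5]^¼) λ k pr p∤5 →
    let h = 8 ℕ.+ k ℕ.* 10
        h≡ = solve 1 (λ k → con 8 :+ k :* con 10 := con 4 :+ k :* con 5 :+ (con 4 :+ k :* con 5)) ≡.refl k
        p≡ = solve 1 (λ k → con 9 :+ (k :* con 10 :+ (con 8 :+ k :* con 10)) := con 7 :+ (con 1 :+ (k :+ k)) :* con 10) ≡.refl k
    in with-value _ (+ 1) (≡.cong (λ n → (ℤ.- (+ 5)) ℤ.^ n) (quarter h (4 ℕ.+ k ℕ.* 5) h≡))
         (inert-even h pr p∤5 (4 ℕ.+ k ℕ.* 5) h≡ (inert-law h pr p∤5 (suc (k ℕ.+ k)) (inj₂ p≡)))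

  golden-3 : ∀ {p} → Prime p → p % 20 ≡ 3 → Golden ⌊p-10/20⌋ p
  golden-3 = by-residue 10 1 (Golden ⌊p-10/20⌋) λ k pr p∤5 →
    let h = 1 ℕ.+ k ℕ.* 10
        h≡ = solve 1 (λ k → con 1 :+ k :* con 10 := con 1 :+ (k :* con 5 :+ k :* con 5)) ≡.refl k
        p≡ = solve 1 (λ k → con 2 :+ (k :* con 10 :+ (con 1 :+ k :* con 10)) := con 3 :+ (k :+ k) :* con 10) ≡.refl k
    in with-value _ (+ 1) (value k) (T≡-[-1]ⁿ h pr p∤5 k (k ℕ.+ k) ≡.refl p≡ (k ℕ.* 5) h≡)
    where
    value : ∀ k → let h = 1 ℕ.+ k ℕ.* 10 in ⌊p-10/20⌋ (suc (h ℕ.+ h)) ≡ ℤ.- (-[1+ 0 ] ℤ.^ (k ℕ.* 5))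
    -- This is `p = 3`, where the numerator `-7` is negative and the floor is `-1`. The other primes
    -- of the class are `3 + 20(k + 1) = 10 + (13 + 20k)`, with floor `k`.
    value zero    = ≡.refl
    value (suc k) = ≡.trans (≡.cong negOnePow (floor _ 10 13 k 20
        (solve 1 (λ k → con 12 :+ (k :* con 10 :+ (con 11 :+ k :* con 10)) := con 10 :+ (con 13 :+ k :* con 20)) ≡.refl k) ≡.refl))
      (≡.trans (negOnePow-ℕ k) (≡.sym (≡.trans (≡.cong ℤ.-_ ([-1]^[n*5]≡[-1]^n (suc k))) (-[-1]^[1+n]≡[-1]^n k))))

  golden-7 : ∀ {p} → Prime p → p % 20 ≡ 7 → Golden ⌊p-10/20⌋ p
  golden-7 = by-residue 10 3 (Golden ⌊p-10/20⌋) λ k pr p∤5 →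
    let h = 3 ℕ.+ k ℕ.* 10
        h≡ = solve 1 (λ k → con 3 :+ k :* con 10 := con 1 :+ (con 1 :+ k :* con 5 :+ (con 1 :+ k :* con 5))) ≡.refl k
        p≡ = solve 1 (λ k → con 4 :+ (k :* con 10 :+ (con 3 :+ k :* con 10)) := con 7 :+ (k :+ k) :* con 10) ≡.refl k
    in with-value _ (+ 1) (value k) (T≡[-1]ⁿ h pr p∤5 k (k ℕ.+ k) ≡.refl p≡ (1 ℕ.+ k ℕ.* 5) h≡)
    where
    value : ∀ k → let h = 3 ℕ.+ k ℕ.* 10 in ⌊p-10/20⌋ (suc (h ℕ.+ h)) ≡ -[1+ 0 ] ℤ.^ suc (k ℕ.* 5)
    -- This is `p = 7`, with numerator `-3` and floor `-1`. Otherwise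
    -- `7 + 20(k + 1) = 10 + (17 + 20k)`, again with floor `k`.
    value zero    = ≡.refl
    value (suc k) = ≡.trans (≡.cong negOnePow (floor _ 10 17 k 20
        (solve 1 (λ k → con 14 :+ (k :* con 10 :+ (con 13 :+ k :* con 10)) := con 10 :+ (con 17 :+ k :* con 20)) ≡.refl k) ≡.refl))
      (≡.trans (negOnePow-ℕ k) (≡.sym (≡.trans (ℤₚ.-1*i≡-i (-[1+ 0 ] ℤ.^ (suc k ℕ.* 5)))
        (≡.trans (≡.cong ℤ.-_ ([-1]^[n*5]≡[-1]^n (suc k))) (-[-1]^[1+n]≡[-1]^n k)))))

  golden-11 : ∀ {p} → Prime p → p % 20 ≡ 11 → Golden ⌊p-5/10⌋ p
  golden-11 = by-residue 10 5 (Golden ⌊p-5/10⌋) λ k pr p∤5 →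
    let h = 5 ℕ.+ k ℕ.* 10
        h≡ = solve 1 (λ k → con 5 :+ k :* con 10 := con 1 :+ (con 2 :+ k :* con 5 :+ (con 2 :+ k :* con 5))) ≡.refl k
        p≡ = solve 1 (λ k → con 6 :+ (k :* con 10 :+ (con 5 :+ k :* con 10)) := con 1 :+ (con 1 :+ (k :+ k)) :* con 10) ≡.refl k
        -- The floor is `2k`, always even, so the sign in this class is constantly 1.
        value = floor _ 5 6 (k ℕ.+ k) 10
          (solve 1 (λ k → con 6 :+ (k :* con 10 :+ (con 5 :+ k :* con 10)) := con 5 :+ (con 6 :+ (k :+ k) :* con 10)) ≡.refl k) ≡.refl
    in with-value _ (+ 1) (≡.trans (≡.cong negOnePow value) (≡.trans (negOnePow-ℕ (k ℕ.+ k)) ([-1]^[n+n]≡1 k)))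
         (T≡1 h pr p∤5 k (suc (k ℕ.+ k)) ≡.refl p≡ (2 ℕ.+ k ℕ.* 5) h≡)

  golden-19 : ∀ {p} → Prime p → p % 20 ≡ 19 → Golden ⌊p-5/10⌋ p
  golden-19 = by-residue 10 9 (Golden ⌊p-5/10⌋) λ k pr p∤5 →
    let h = 9 ℕ.+ k ℕ.* 10
        h≡ = solve 1 (λ k → con 9 :+ k :* con 10 := con 1 :+ (con 4 :+ k :* con 5 :+ (con 4 :+ k :* con 5))) ≡.refl k
        p≡ = solve 1 (λ k → con 10 :+ (k :* con 10 :+ (con 9 :+ k :* con 10)) := con 9 :+ (con 1 :+ (k :+ k)) :* con 10) ≡.refl k
        -- The floor is `2k + 1`, always odd, so the sign in this class is constantly -1.
        value = floor _ 5 4 (suc (k ℕ.+ k)) 10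
          (solve 1 (λ k → con 10 :+ (k :* con 10 :+ (con 9 :+ k :* con 10)) := con 5 :+ (con 4 :+ (con 1 :+ (k :+ k)) :* con 10)) ≡.refl k) ≡.refl
    in with-value _ (+ 1) (≡.trans (≡.cong negOnePow value)
         (≡.trans (negOnePow-ℕ (suc (k ℕ.+ k))) (≡.cong (-[1+ 0 ] ℤ.*_) ([-1]^[n+n]≡1 k))))
         (T≡-1 h pr p∤5 k (suc (k ℕ.+ k)) ≡.refl p≡ (4 ℕ.+ k ℕ.* 5) h≡)

  open SilverClasses

  silver-1 : ∀ {p} → Prime p → p % 8 ≡ 1 → Silver -2^¼ p
  silver-1 = by-residue 4 0 (Silver -2^¼) λ k pr 2<p →
    let h = k ℕ.* 4
        h≡ = solve 1 (λ k → k :* con 4 := k :* con 2 :+ k :* con 2) ≡.refl k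
        p≡ = solve 1 (λ k → con 1 :+ (k :* con 4 :+ k :* con 4) := con 1 :+ k :* con 8) ≡.refl k
    in with-value _ (+ 2) (≡.cong (λ n → ℤ.- ((+ 2) ℤ.^ n)) (quarter h (k ℕ.* 2) h≡)) (T≡-2^k h pr 2<p (k ℕ.* 2) k h≡ p≡)

  silver-5 : ∀ {p} → Prime p → p % 8 ≡ 5 → Silver 2^¼ p
  silver-5 = by-residue 4 2 (Silver 2^¼) λ k pr 2<p →
    let h = 2 ℕ.+ k ℕ.* 4
        h≡ = solve 1 (λ k → con 2 :+ k :* con 4 := con 1 :+ (k :+ k) :+ (con 1 :+ (k :+ k))) ≡.refl k
        p≡ = solve 1 (λ k → con 3 :+ (k :* con 4 :+ (con 2 :+ k :* con 4)) := con 5 :+ k :* con 8) ≡.refl k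
    in with-value _ (+ 2) (≡.cong (λ n → (+ 2) ℤ.^ n) (quarter h (suc (k ℕ.+ k)) h≡))
         (T≡2^k h pr 2<p (suc (k ℕ.+ k)) k k h≡ ≡.refl p≡)

  silver-3 : ∀ {p} → Prime p → p % 8 ≡ 3 → Silver ⌊p-3/8⌋ p
  silver-3 = by-residue 4 1 (Silver ⌊p-3/8⌋) λ k pr 2<p →
    let h = 1 ℕ.+ k ℕ.* 4
        h≡ = solve 1 (λ k → con 1 :+ k :* con 4 := con 1 :+ (k :+ k :+ (k :+ k))) ≡.refl k
        p≡ = solve 1 (λ k → con 2 :+ (k :* con 4 :+ (con 1 :+ k :* con 4)) := con 3 :+ k :* con 8) ≡.refl k
    in with-value _ (+ 2) (≡.trans (≡.cong (λ n → negOnePow (+ n)) (eighth _ 3 k p≡)) (negOnePow-ℕ k))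
         (T≡[-1]ᵏ-inert h pr 2<p k k (k ℕ.+ k) ≡.refl h≡ ≡.refl p≡)

  silver-7 : ∀ {p} → Prime p → p % 8 ≡ 7 → Silver ⌊p-7/8⌋ p
  silver-7 = by-residue 4 3 (Silver ⌊p-7/8⌋) λ k pr 2<p →
    let h = 3 ℕ.+ k ℕ.* 4
        h≡ = solve 1 (λ k → con 3 :+ k :* con 4 := con 1 :+ (con 1 :+ (k :+ k) :+ (con 1 :+ (k :+ k)))) ≡.refl k
        p≡ = solve 1 (λ k → con 4 :+ (k :* con 4 :+ (con 3 :+ k :* con 4)) := con 7 :+ k :* con 8) ≡.refl k
    in with-value _ (+ 2) (≡.trans (≡.cong (λ n → negOnePow (+ n)) (eighth _ 7 k p≡)) (negOnePow-ℕ k))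
         (T≡[-1]ᵏ-split h pr 2<p k k (suc (k ℕ.+ k)) ≡.refl h≡ p≡)

open import Data.Integer using (-_; _^_; _-_)

theorem1p5 : (p : ℕ) → Prime p → p > 2 →
    ((p % 20 ≡ 1 → T p (+ 1) ≡ - ((+ 5) ^ ((p ∸ 1) / 4)) [mod p ])
    × (p % 20 ≡ 9 → T p (+ 1) ≡ - ((+ 5) ^ ((p ∸ 1) / 4)) [mod p ])
    × (p % 20 ≡ 13 → T p (+ 1) ≡ (- (+ 5)) ^ ((p ∸ 1) / 4) [mod p ])
    × (p % 20 ≡ 17 → T p (+ 1) ≡ (- (+ 5)) ^ ((p ∸ 1) / 4) [mod p ])
    × (p % 20 ≡ 3 → T p (+ 1) ≡ negOnePow (((+ p) - (+ 10)) /ℕ 20) [mod p ])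
    × (p % 20 ≡ 7 → T p (+ 1) ≡ negOnePow (((+ p) - (+ 10)) /ℕ 20) [mod p ])
    × (p % 20 ≡ 11 → T p (+ 1) ≡ negOnePow (((+ p) - (+ 5)) /ℕ 10) [mod p ])
    × (p % 20 ≡ 19 → T p (+ 1) ≡ negOnePow (((+ p) - (+ 5)) /ℕ 10) [mod p ]))
    ×
    ((p % 8 ≡ 1 → T p (+ 2) ≡ - ((+ 2) ^ ((p ∸ 1) / 4)) [mod p ])
    × (p % 8 ≡ 5 → T p (+ 2) ≡ (+ 2) ^ ((p ∸ 1) / 4) [mod p ])
    × (p % 8 ≡ 3 → T p (+ 2) ≡ negOnePow (+ ((p ∸ 3) / 8)) [mod p ])
    × (p % 8 ≡ 7 → T p (+ 2) ≡ negOnePow (+ ((p ∸ 7) / 8)) [mod p ]))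
theorem1p5 p pr p>2 =
    ( (λ e → golden-1 pr e (not-five pr (λ ()) e))
    , (λ e → golden-9 pr e (not-five pr (λ ()) e))
    , (λ e → golden-13 pr e (not-five pr (λ ()) e))
    , (λ e → golden-17 pr e (not-five pr (λ ()) e))
    , (λ e → golden-3 pr e (not-five pr (λ ()) e))
    , (λ e → golden-7 pr e (not-five pr (λ ()) e))
    , (λ e → golden-11 pr e (not-five pr (λ ()) e))
    , (λ e → golden-19 pr e (not-five pr (λ ()) e)) )
  , ( (λ e → silver-1 pr e p>2)
    , (λ e → silver-5 pr e p>2)
    , (λ e → silver-3 pr e p>2)
    , (λ e → silver-7 pr e p>2) )
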